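{- Let $\mathcal A=\{H_1,\dots,H_n\}$ be an essential hyperplane arrangement in $V=\mathbb C^r$, and let $h_1,\dots,h_m$ be the lines in the arrangement. The multigraded Hilbert series of the zonotopal Cox ring $\mathcal Z(\mathcal A)$ is given by $$\mathrm{Hilb}(\mathcal Z(\mathcal A);t,s_1,\dots,s_m)=\frac{1}{\prod_{i=1}^n(1-S_it)}\;\widetilde Z_{\mathcal A}\!\left(1-t;\frac{S_1(1-t)}{1-S_1},\dots,\frac{S_n(1-t)}{1-S_n}\right),$$ where $S_j=\prod_{i:\,h_i\not\subset H_j}s_i$ for $1\le j\le n$.
   Context: $\mathcal A$ is a finite list of hyperplanes $H_j=\{l_j=0\}$ through the origin, $0\ne l_j\in V^*$; essential means the $l_j$ span $V^*$. The lines of $\mathcal A$ are its one-dimensional intersections of hyperplanes (with $V$ itself regarded as the empty intersection); for each line choose a nonzero vector, also denoted $h_i$. Let $G=\{\lambda\in\mathbb C^m:\sum_i\lambda_ih_i=0\}$, an additive group acting on $R=\mathbb C[s_1,\dots,s_m,t_1,\dots,t_m]$ by $s_i\mapsto s_i$, $t_i\mapsto t_i+\lambda_is_i$. The invariant ring $R^G$ is $\mathbb Z^{m+1}$-graded by $\deg s_i=e_i$, $\deg t_i=e_0+e_i$, where $e_0,\dots,e_m$ is the standard basis; $R^G_{(d,\mathbf u)}$ is the component of degree $d e_0+\sum_i u_ie_i$. Let $H$ be the $m\times n$ matrix with $(i,j)$ entry $0$ if $h_i\subset H_j$ and $1$ otherwise. The zonotopal Cox ring is $\mathcal Z(\mathcal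 A)=\bigoplus_{(d,\mathbf a)\in\mathbb N\times\mathbb N^n}R^G_{(d,H\mathbf a)}$, and its multigraded Hilbert series is $\sum_{(d,\mathbf a)}\dim R^G_{(d,H\mathbf a)}\,t^d\prod_{i=1}^m s_i^{(H\mathbf a)_i}$. The multivariate Tutte polynomial is $\widetilde Z_{\mathcal A}(q;v_1,\dots,v_n)=\sum_{\mathcal B\subseteq[n]}q^{ -r(\mathcal B)}\prod_{e\in\mathcal B}v_e$, where $r(\mathcal B)=\dim\mathrm{span}\{l_e:e\in\mathcal B\}$. -}

module Defs where

open import Algebra.Bundles using (CommutativeRing)
open import Algebra.Bundles.Raw using (RawRing)
import Algebra.Definitions.RawMonoid as RawMonoidDefinitions
import Algebra.Definitions.RawSemiring as RawSemiringDefinitions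
open import Algebra.Module.Bundles.Raw using (RawLeftModule)
open import Data.Bool.Base using (if_then_else_)
open import Data.Fin.Base using (Fin; zero; suc; _↑ˡ_; _↑ʳ_; splitAt)
open import Data.Fin.Subset using (Subset; inside; outside; _∈_)
open import Data.Integer.Base as ℤ using (ℤ)
open import Data.List.Base as List using (List; []; _∷_; _++_)
import Data.List.Membership.Propositional as ListMembership
open import Data.List.Relation.Unary.Unique.Propositional using (Unique)
open import Data.Nat.Base as ℕ using (ℕ; zero; suc)
import Data.Nat.ListAction as ℕ using (sum)
import Data.Nat.Properties as ℕ
open import Data.Product.Base using (∃; _×_; _,_; proj₁; uncurry)
open import Data.Product.Relation.Binary.Pointwise.NonDependent
  using (Pointwise; ×-decidable)
open import Data.Sum.Base using ([_,_]′)
open import Data.Unit.Base using (⊤)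
open import Data.Vec.Base as Vec using (Vec; []; _∷_; lookup; tabulate)
open import Data.Vec.Properties using (≡-dec)
open import Function.Base using (_∘_)
open import Function.Bundles using (_⇔_)
open import Level using (0ℓ) renaming (suc to lsuc)
open import Relation.Binary.Core using (Rel)
open import Relation.Binary.Definitions using (Decidable)
open import Relation.Binary.PropositionalEquality using (_≡_; _≢_)
open import Relation.Binary.Structures using (IsStrictTotalOrder)
open import Relation.Nullary.Decidable.Core using (Dec; does)
open import Relation.Nullary.Negation.Core using (¬_)
open import Relation.Unary using (Pred; _≐_)

-- The real numbers, given by the axioms that determine them up to
-- isomorphism: a Dedekind-complete (strictly, totally) ordered field.

record CompleteOrderedField : Set (lsuc 0ℓ) where
  infix 4 _<_
  field
    commutativeRing : CommutativeRing 0ℓ 0ℓ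

  open CommutativeRing commutativeRing public

  field
    _<_                : Rel Carrier 0ℓ
    isStrictTotalOrder : IsStrictTotalOrder _≈_ _<_
    0<1                : 0# < 1#
    +-monoˡ-<          : ∀ {x y} z → x < y → x + z < y + z
    *-positive         : ∀ {x y} → 0# < x → 0# < y → 0# < x * y
    invertible         : ∀ x → ¬ x ≈ 0# → ∃ λ y → x * y ≈ 1#

  UpperBound : Pred Carrier 0ℓ → Pred Carrier 0ℓ
  UpperBound P b = ∀ x → P x → ¬ b < x

  field
    supremum : (P : Pred Carrier 0ℓ) → ∃ P → ∃ (UpperBound P) →
               ∃ λ b → UpperBound P b × (∀ c → UpperBound P c → ¬ c < b)

  open IsStrictTotalOrder isStrictTotalOrder public using (compare; _≟_)

-- ℂ = ℝ[i], with (a , b) standing for a + bi.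

module ComplexNumbers (ℝ : CompleteOrderedField) where
  private
    module ℝ = CompleteOrderedField ℝ
    open ℝ using (_+_; _*_; -_; _-_; 0#; 1#)

  ℂ : RawRing 0ℓ 0ℓ
  ℂ = record
    { Carrier = ℝ.Carrier × ℝ.Carrier
    ; _≈_     = Pointwise ℝ._≈_ ℝ._≈_
    ; _+_     = λ (a , b) (c , d) → (a + c , b + d)
    ; _*_     = λ (a , b) (c , d) → (a * c - b * d , a * d + b * c)
    ; -_      = λ (a , b) → (- a , - b)
    ; 0#      = (0# , 0#)
    ; 1#      = (1# , 0#)
    }

  _≟ℂ_ : Decidable (RawRing._≈_ ℂ)
  _≟ℂ_ = ×-decidable ℝ._≟_ ℝ._≟_

module LinearAlgebra (K : RawRing 0ℓ 0ℓ)
                     (M : RawLeftModule (RawRing.Carrier K) 0ℓ 0ℓ) where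
  open RawRing K using (Carrier; _≈_; 0#)
  open RawLeftModule M
  open RawMonoidDefinitions +ᴹ-rawMonoid using (sum)

  combination : ∀ {k} → (Fin k → Carrier) → (Fin k → Carrierᴹ) → Carrierᴹ
  combination c v = sum (λ i → c i *ₗ v i)

  Span : {I : Set} → (I → Carrierᴹ) → Pred Carrierᴹ 0ℓ
  Span {I} v x = ∃ λ k → ∃ λ (ι : Fin k → I) → ∃ λ (c : Fin k → Carrier) →
                 x ≈ᴹ combination c (v ∘ ι)

  -- Meaningful when P is a linear subspace.
  record HasDimension (P : Pred Carrierᴹ 0ℓ) (k : ℕ) : Set where
    field
      basis       : Fin k → Carrierᴹ
      basis∈P     : ∀ i → P (basis i)
      independent : ∀ c → combination c basis ≈ᴹ 0ᴹ → ∀ i → c i ≈ 0#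
      spanning    : ∀ x → P x → Span basis x

-- A monomial x₁^α₁ ⋯ x_k^α_k is encoded by its exponent vector α.
Monomial : ℕ → Set
Monomial k = Vec ℕ k

-- A polynomial is a finite list of terms in no particular order, possibly
-- with repeated monomials or zero coefficients; equality compares the total
-- coefficient of each monomial.

module Polynomials (K : RawRing 0ℓ 0ℓ) where
  open RawRing K

  Poly : ℕ → Set
  Poly k = List (Carrier × Monomial k)

  coeff : ∀ {k} → Poly k → Monomial k → Carrier
  coeff []            α = 0#
  coeff ((c , β) ∷ p) α = (if does (≡-dec ℕ._≟_ β α) then c else 0#) + coeff p α

  infixr 7 _•_
  _•_ : ∀ {k} → Carrier → Poly k → Poly k
  a • p = List.map (λ (c , α) → (a * c , α)) p

  polyRing : ℕ → RawRing 0ℓ 0ℓ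
  polyRing k = record
    { Carrier = Poly k
    ; _≈_     = λ p q → ∀ α → coeff p α ≈ coeff q α
    ; _+_     = _++_
    ; _*_     = List.cartesianProductWith
                  (λ (a , α) (b , β) → (a * b , Vec.zipWith ℕ._+_ α β))
    ; -_      = (- 1#) •_
    ; 0#      = []
    ; 1#      = (1# , Vec.replicate k 0) ∷ []
    }

  polyModule : ℕ → RawLeftModule Carrier 0ℓ 0ℓ
  polyModule k = record
    { Carrierᴹ = Poly k
    ; _≈ᴹ_     = RawRing._≈_ (polyRing k)
    ; _+ᴹ_     = RawRing._+_ (polyRing k)
    ; _*ₗ_     = _•_
    ; 0ᴹ       = RawRing.0# (polyRing k)
    ; -ᴹ_      = RawRing.-_ (polyRing k)
    }

  var : ∀ {k} → Fin k → Poly k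
  var {k} i = (1# , Vec.updateAt (Vec.replicate k 0) i suc) ∷ []

  substitute : ∀ {k l} → (Fin k → Poly l) → Poly k → Poly l
  substitute {k} {l} σ =
    List.concatMap (λ (c , α) → c • product (λ i → σ i ^ lookup α i))
    where
    open RawSemiringDefinitions (RawRing.rawSemiring (polyRing l))
      using (product; _^_)

-- Formal power series over ℤ in k variables, as coefficient functions.

module PowerSeries (k : ℕ) where

  Series : Set
  Series = Monomial k → ℤ

  -- All pairs (β , γ) with β + γ = α.
  splittings : ∀ {k} → Monomial k → List (Monomial k × Monomial k)
  splittings []      = ([] , []) ∷ []
  splittings (e ∷ α) =
    List.cartesianProductWith (λ b (β , γ) → (b ∷ β , (e ℕ.∸ b) ∷ γ))
      (List.upTo (suc e)) (splittings α)

  sumℤ : List ℤ → ℤ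
  sumℤ = List.foldr ℤ._+_ ℤ.0ℤ

  monomial : Monomial k → Series
  monomial β α = if does (≡-dec ℕ._≟_ β α) then ℤ.1ℤ else ℤ.0ℤ

  seriesRing : RawRing 0ℓ 0ℓ
  seriesRing = record
    { Carrier = Series
    ; _≈_     = λ f g → ∀ α → f α ≡ g α
    ; _+_     = λ f g α → f α ℤ.+ g α
    ; _*_     = λ f g α →
                  sumℤ (List.map (λ (β , γ) → f β ℤ.* g γ) (splittings α))
    ; -_      = λ f α → ℤ.- f α
    ; 0#      = λ _ → ℤ.0ℤ
    ; 1#      = monomial (Vec.replicate k 0)
    }

  variableₛ : Fin k → Series
  variableₛ i = monomial (Vec.updateAt (Vec.replicate k 0) i suc)

  open RawRing seriesRing public using (_≈_; _+_; _*_; -_; 0#; 1#)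
  open RawSemiringDefinitions (RawRing.rawSemiring seriesRing) public
    using (sum; product; _^_)

  infixl 6 _-_
  _-_ : Series → Series → Series
  f - g = f + (- g)

  -- The inverse Σ_{j ≥ 0} (1 - f)^j of a series f with constant term 1.
  -- The powers with j > |α| do not contribute to the coefficient at α.
  inverse : Series → Series
  inverse f α =
    sumℤ (List.map (λ j → ((1# - f) ^ j) α) (List.upTo (suc (Vec.sum α))))

  -- F = Σ_{i ∈ I} c i · x^(e i), where every monomial arises from only
  -- finitely many i.
  IsSumOfMonomials : {I : Set} → (I → ℕ) → (I → Monomial k) → Series → Set
  IsSumOfMonomials {I} c e F =
    ∀ α → ∃ λ (is : List I) →
      Unique is × (∀ i → i ∈ₗ is ⇔ e i ≡ α) ×
      F α ≡ ℤ.+ ℕ.sum (List.map c is)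
    where open ListMembership using () renaming (_∈_ to _∈ₗ_)

subsets : ∀ n → List (Subset n)
subsets zero    = [] ∷ []
subsets (suc n) = List.map (outside ∷_) (subsets n) ++ List.map (inside ∷_) (subsets n)

-- The multivariate Tutte polynomial with rank function rk, evaluated at
-- power series, q having constant term 1.
Z̃ : ∀ {k n} → (Subset n → ℕ) →
    PowerSeries.Series k → (Fin n → PowerSeries.Series k) → PowerSeries.Series k
Z̃ {k} {n} rk q v = List.foldr _+_ 0# (List.map summand (subsets n))
  where
  open PowerSeries k
  summand : Subset n → Series
  summand B = inverse q ^ rk B * product (λ e → if lookup B e then v e else 1#)

module Arrangements (K : RawRing 0ℓ 0ℓ) (_≟_ : Decidable (RawRing._≈_ K)) where
  open RawRing K
  open RawSemiringDefinitions rawSemiring using (sum)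
  open Polynomials K

  coordinateSpace : ℕ → RawLeftModule Carrier 0ℓ 0ℓ
  coordinateSpace r = record
    { Carrierᴹ = Fin r → Carrier
    ; _≈ᴹ_     = λ x y → ∀ i → x i ≈ y i
    ; _+ᴹ_     = λ x y i → x i + y i
    ; _*ₗ_     = λ c x i → c * x i
    ; 0ᴹ       = λ _ → 0#
    ; -ᴹ_      = λ x i → - x i
    }

  module V (r : ℕ) where
    open RawLeftModule (coordinateSpace r) public
    open LinearAlgebra K (coordinateSpace r) public

  -- Linear forms on K^r are given by their coordinates in the dual basis.
  Form : ℕ → Set
  Form r = V.Carrierᴹ r

  ⟨_,_⟩ : ∀ {r} → Form r → V.Carrierᴹ r → Carrier
  ⟨ l , x ⟩ = sum (λ i → l i * x i)

  record Arrangement (r n : ℕ) : Set where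
    open V r
    field
      form    : Fin n → Form r
      nonzero : ∀ j → ¬ form j ≈ᴹ 0ᴹ

    Essential : Set
    Essential = ∀ x → Span form x

    IsRankFunction : (Subset n → ℕ) → Set
    IsRankFunction rk =
      ∀ B → HasDimension (Span {I = ∃ (_∈ B)} (form ∘ proj₁)) (rk B)

    _∈H_ : V.Carrierᴹ r → Fin n → Set
    x ∈H j = ⟨ form j , x ⟩ ≈ 0#

    ⋂H : Subset n → Pred Carrierᴹ 0ℓ
    ⋂H B x = ∀ j → j ∈ B → x ∈H j

  line : ∀ {r} → V.Carrierᴹ r → Pred (V.Carrierᴹ r) 0ℓ
  line {r} h = V.Span r {I = ⊤} (λ _ → h)

  -- The lines of A, each listed exactly once through a nonzero vector h i.
  record Lines {r n : ℕ} (A : Arrangement r n) (m : ℕ) : Set where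
    open V r
    open Arrangement A using (⋂H; _∈H_; form)
    field
      h          : Fin m → Carrierᴹ
      h-nonzero  : ∀ i → ¬ h i ≈ᴹ 0ᴹ
      isLine     : ∀ i → ∃ λ B → HasDimension (⋂H B) 1 × ⋂H B ≐ line (h i)
      complete   : ∀ B → HasDimension (⋂H B) 1 → ∃ λ i → ⋂H B ≐ line (h i)
      distinct   : ∀ i j → line (h i) ≐ line (h j) → i ≡ j

    _∈H?_ : ∀ i j → Dec (h i ∈H j)
    i ∈H? j = ⟨ form j , h i ⟩ ≟ 0#

    H : Fin m → Fin n → ℕ
    H i j = if does (i ∈H? j) then 0 else 1

    H·_ : Vec ℕ n → Vec ℕ m
    H· a = tabulate (λ i → Vec.sum (tabulate (λ j → H i j ℕ.* lookup a j)))

    -- The variables of R are numbered s₁, …, s_m, t₁, …, t_m.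
    R : Set
    R = Poly (m ℕ.+ m)

    s t : Fin m → R
    s i = var (i ↑ˡ m)
    t i = var (m ↑ʳ i)

    G : Pred (Fin m → Carrier) 0ℓ
    G λ′ = combination λ′ h ≈ᴹ 0ᴹ

    act : (Fin m → Carrier) → R → R
    act λ′ = substitute ([ s , (λ i → t i ++ λ′ i • s i) ]′ ∘ splitAt m)

    -- The degree d e₀ + Σ uᵢ eᵢ is the vector d ∷ u.
    degree : Monomial (m ℕ.+ m) → Vec ℕ (suc m)
    degree α = Vec.sum τ ∷ Vec.zipWith ℕ._+_ σ τ
      where
      σ = Vec.take m α
      τ = Vec.drop m α

    module R = RawLeftModule (polyModule (m ℕ.+ m))
    module RLin = LinearAlgebra K (polyModule (m ℕ.+ m))

    Invariant : Pred R 0ℓ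
    Invariant p = ∀ λ′ → G λ′ → act λ′ p R.≈ᴹ p

    Homogeneous : Vec ℕ (suc m) → Pred R 0ℓ
    Homogeneous δ p = ∀ α → degree α ≢ δ → coeff p α ≈ 0#

    R^G[_] : Vec ℕ (suc m) → Pred R 0ℓ
    R^G[ δ ] p = Invariant p × Homogeneous δ p

    -- The graded components of the zonotopal Cox ring.
    𝒵 : ℕ × Vec ℕ n → Pred R 0ℓ
    𝒵 (d , a) = R^G[ d ∷ H· a ]

    module PS = PowerSeries (suc m)

    -- The power series variables are numbered t, s₁, …, s_m.
    IsHilbertSeries : PS.Series → Set
    IsHilbertSeries F = ∃ λ (dim : ℕ × Vec ℕ n → ℕ) →
      (∀ da → RLin.HasDimension (𝒵 da) (dim da)) ×
      PS.IsSumOfMonomials dim (λ (d , a) → d ∷ H· a) F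

    tₛ : PS.Series
    tₛ = PS.variableₛ zero

    S : Fin n → PS.Series
    S j = PS.product (λ i → if does (i ∈H? j) then PS.1# else PS.variableₛ (suc i))

-- Setting s = 1 turns an invariant of degree d e₀ + Σ uᵢ eᵢ into a polynomial function on ℂᵐ which is
-- constant along G, hence lives on V, and has degree at most uᵢ in the direction of the line hᵢ.  For
-- u = H a these functions have a basis of products of the forms l_j, found by deletion and contraction:
-- if l is a form with aₗ > 0 then f restricts to the hyperplane {l = 0}, where the contracted arrangement
-- spans by induction, and after subtracting products of the other forms f becomes divisible by l, with a
-- quotient that satisfies the degree bounds for a with aₗ lowered by one.  In characteristic zero "degree at
-- most u along h" can be expressed by finite differences, so that everything happens for functions.
--
-- The same recursion reads (1 - S t) F = F_deletion + S / (1 - S) F_contraction on generating functions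
-- (and (1 - S) F = F_deletion for a loop), and the right-hand side of the theorem satisfies it too.

module Submission where

open import Defs
open import Algebra.Bundles using (CommutativeRing; RawRing)
import Algebra.Definitions
import Algebra.Definitions.RawMonoid as RawMonoidDefinitions
import Algebra.Definitions.RawSemiring as RawSemiringDefinitions
import Algebra.Properties.AbelianGroup
import Algebra.Properties.Ring
import Algebra.Properties.Semiring.Mult
import Algebra.Solver.Ring
open import Algebra.Solver.Ring.AlmostCommutativeRing
  using (fromCommutativeRing; _-Raw-AlmostCommutative⟶_; Induced-equivalence)
open import Algebra.Structures using (IsCommutativeRing)
open import Data.Bool.Base using (Bool; if_then_else_; true; false)
open import Data.Empty using (⊥-elim)
open import Data.Fin.Base using (Fin; zero; suc; _↑ˡ_; _↑ʳ_; splitAt)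
import Data.Fin.Properties as Fin
open import Data.Fin.Subset using (Subset; inside; outside)
import Data.Fin.Subset as Subset
import Data.Fin.Subset.Properties as Subset
open import Data.Integer.Base as ℤ using (ℤ)
import Data.Integer.Properties as ℤ
open import Data.List.Base as List using (List; []; _∷_; _++_)
open import Data.List.Membership.Propositional using (_∈_)
open import Data.List.Membership.Propositional.Properties
  using (∈-map⁺; ∈-map⁻; ∈-++⁺ˡ; ∈-++⁺ʳ; ∈-++⁻; ∈-upTo⁻; ∈-allFin; ∈-lookup; ∈-filter⁻)
import Data.List.Properties as List
open import Data.List.Relation.Unary.All as All using (All; []; _∷_)
import Data.List.Relation.Unary.All.Properties as All
open import Data.List.Relation.Unary.AllPairs using ([]; _∷_)
open import Data.List.Relation.Unary.Any using (here; there)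
open import Data.List.Relation.Unary.Unique.Propositional using (Unique)
import Data.List.Relation.Unary.Unique.Propositional.Properties as Unique
open import Data.Maybe.Base using (just; nothing)
open import Data.Nat.Base as ℕ using (ℕ; zero; suc)
import Data.Nat.ListAction as ℕ
import Data.Nat.ListAction.Properties as ℕ
import Data.Nat.Properties as ℕ
open import Data.Product.Base using (∃; _×_; _,_; proj₁; proj₂)
open import Data.Sum.Base using (_⊎_; inj₁; inj₂; [_,_]′)
open import Data.Vec.Base as Vec using (Vec; []; _∷_; lookup; tabulate)
import Data.Vec.Properties as Vec
open import Function.Base using (_∘_; id)
open import Function.Bundles using (mk⇔)
open import Level using (0ℓ)
open import Relation.Binary.Definitions using (WeaklyDecidable)
open import Relation.Binary.PropositionalEquality as ≡ using (_≡_; _≢_; cong; cong₂; subst)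
import Relation.Binary.Reasoning.Setoid
open import Relation.Nullary.Decidable using (Dec; yes; no; does; dec-true; dec-false; ¬?)
open import Relation.Nullary.Negation using (¬_)

-- The obstacle is contraction: it changes the space, the forms and the set of lines at once.
-- Everything therefore stays on one space K^m, mapped onto V by `Φ h`, with the forms pulled back.
-- Contracting only shrinks a subspace, and the directions that count are those lying in it:
-- coordinate vectors of lines inside the current flat, and the group G, along which every bound is
-- 0. When no forms are left all bounds are 0; that the function is then constant needs every flat
-- to be spanned by the lines it contains, and here essentiality and the completeness of the list of
-- lines enter. A form is zero on its own kernel, so its multiplicity does not matter after
-- contraction; summing over it produces 1/(1 - S). Characteristic zero is needed because the
-- Leibniz rule for the N-th difference of l q carries the factor N. Ranks and dimensions are read
-- off one and the same `Tree`, which turns the identity of series into a statement about trees,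
-- without geometry. Different a may share the degree H a; the fibres are finite because every
-- hyperplane misses some line.

-- Integer coefficients let the ring solver cancel terms over a ring whose equality does not compute.
module IntegerSolver (R : CommutativeRing 0ℓ 0ℓ) where
  open CommutativeRing R
  open Algebra.Properties.Semiring.Mult semiring renaming (_×_ to _×ₙ_)
  open Algebra.Properties.Ring ring
  open Algebra.Properties.AbelianGroup +-abelianGroup using (⁻¹-∙-comm)
  open Relation.Binary.Reasoning.Setoid setoid

  ⟦_⟧ℤ : ℤ → Carrier
  ⟦ ℤ.+ n ⟧ℤ      = n ×ₙ 1#
  ⟦ ℤ.-[1+ n ] ⟧ℤ = - (suc n ×ₙ 1#)

  private
    cancel-suc : ∀ a b → (1# + a) - (1# + b) ≈ a - b
    cancel-suc a b = begin
      (1# + a) + - (1# + b)     ≈⟨ +-cong (+-comm 1# a) (sym (⁻¹-∙-comm 1# b)) ⟩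
      (a + 1#) + (- 1# + - b)   ≈⟨ +-assoc a 1# _ ⟩
      a + (1# + (- 1# + - b))   ≈⟨ +-congˡ (sym (+-assoc _ _ _)) ⟩
      a + ((1# - 1#) + - b)     ≈⟨ +-congˡ (+-congʳ (-‿inverseʳ 1#)) ⟩
      a + (0# + - b)            ≈⟨ +-congˡ (+-identityˡ _) ⟩
      a - b                     ∎

    ⊖-homo : ∀ m n → ⟦ m ℤ.⊖ n ⟧ℤ ≈ m ×ₙ 1# - n ×ₙ 1#
    ⊖-homo zero    zero    = sym (-‿inverseʳ 0#)
    ⊖-homo (suc m) zero    = sym (trans (+-congˡ -0#≈0#) (+-identityʳ _))
    ⊖-homo zero    (suc n) = sym (+-identityˡ _)
    ⊖-homo (suc m) (suc n) = begin
      ⟦ suc m ℤ.⊖ suc n ⟧ℤ       ≡⟨ ≡.cong ⟦_⟧ℤ (ℤ.[1+m]⊖[1+n]≡m⊖n m n) ⟩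
      ⟦ m ℤ.⊖ n ⟧ℤ               ≈⟨ ⊖-homo m n ⟩
      m ×ₙ 1# - n ×ₙ 1#            ≈⟨ cancel-suc _ _ ⟨
      suc m ×ₙ 1# - suc n ×ₙ 1#    ∎

    +-homoℤ : ∀ i j → ⟦ i ℤ.+ j ⟧ℤ ≈ ⟦ i ⟧ℤ + ⟦ j ⟧ℤ
    +-homoℤ (ℤ.+ m)      (ℤ.+ n)      = ×-homo-+ 1# m n
    +-homoℤ (ℤ.+ m)      (ℤ.-[1+ n ]) = ⊖-homo m (suc n)
    +-homoℤ (ℤ.-[1+ m ]) (ℤ.+ n)      = trans (⊖-homo n (suc m)) (+-comm _ _)
    +-homoℤ (ℤ.-[1+ m ]) (ℤ.-[1+ n ]) = begin
      - (suc (suc (m ℕ.+ n)) ×ₙ 1#)       ≡⟨ ≡.cong (λ k → - (suc k ×ₙ 1#)) (≡.sym (ℕ.+-suc m n)) ⟩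
      - ((suc m ℕ.+ suc n) ×ₙ 1#)         ≈⟨ -‿cong (×-homo-+ 1# (suc m) (suc n)) ⟩
      - (suc m ×ₙ 1# + suc n ×ₙ 1#)        ≈⟨ ⁻¹-∙-comm _ _ ⟨
      - (suc m ×ₙ 1#) + - (suc n ×ₙ 1#)    ∎

    -‿homoℤ : ∀ i → ⟦ ℤ.- i ⟧ℤ ≈ - ⟦ i ⟧ℤ
    -‿homoℤ (ℤ.+ zero)    = sym -0#≈0#
    -‿homoℤ (ℤ.+ suc n)   = refl
    -‿homoℤ (ℤ.-[1+ n ])  = sym (-‿involutive _)

    *-homoℤ⁺ : ∀ m j → ⟦ ℤ.+ m ℤ.* j ⟧ℤ ≈ (m ×ₙ 1#) * ⟦ j ⟧ℤ
    *-homoℤ⁺ m (ℤ.+ n) = begin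
      ⟦ ℤ.+ m ℤ.* ℤ.+ n ⟧ℤ  ≡⟨ ≡.cong ⟦_⟧ℤ (≡.sym (ℤ.pos-* m n)) ⟩
      (m ℕ.* n) ×ₙ 1#        ≈⟨ ×1-homo-* m n ⟩
      (m ×ₙ 1#) * (n ×ₙ 1#)   ∎
    *-homoℤ⁺ m (ℤ.-[1+ n ]) = begin
      ⟦ ℤ.+ m ℤ.* ℤ.-[1+ n ] ⟧ℤ        ≡⟨ ≡.cong ⟦_⟧ℤ (≡.sym (ℤ.neg-distribʳ-* (ℤ.+ m) (ℤ.+ suc n))) ⟩
      ⟦ ℤ.- (ℤ.+ m ℤ.* ℤ.+ suc n) ⟧ℤ   ≈⟨ -‿homoℤ (ℤ.+ m ℤ.* ℤ.+ suc n) ⟩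
      - ⟦ ℤ.+ m ℤ.* ℤ.+ suc n ⟧ℤ       ≈⟨ -‿cong (*-homoℤ⁺ m (ℤ.+ suc n)) ⟩
      - ((m ×ₙ 1#) * (suc n ×ₙ 1#))      ≈⟨ -‿distribʳ-* _ _ ⟩
      (m ×ₙ 1#) * - (suc n ×ₙ 1#)        ∎

    *-homoℤ : ∀ i j → ⟦ i ℤ.* j ⟧ℤ ≈ ⟦ i ⟧ℤ * ⟦ j ⟧ℤ
    *-homoℤ (ℤ.+ m)    j = *-homoℤ⁺ m j
    *-homoℤ (ℤ.-[1+ m ]) j = begin
      ⟦ ℤ.-[1+ m ] ℤ.* j ⟧ℤ           ≡⟨ ≡.cong ⟦_⟧ℤ (≡.sym (ℤ.neg-distribˡ-* (ℤ.+ suc m) j)) ⟩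
      ⟦ ℤ.- (ℤ.+ suc m ℤ.* j) ⟧ℤ      ≈⟨ -‿homoℤ (ℤ.+ suc m ℤ.* j) ⟩
      - ⟦ ℤ.+ suc m ℤ.* j ⟧ℤ          ≈⟨ -‿cong (*-homoℤ⁺ (suc m) j) ⟩
      - ((suc m ×ₙ 1#) * ⟦ j ⟧ℤ)       ≈⟨ -‿distribˡ-* _ _ ⟩
      - (suc m ×ₙ 1#) * ⟦ j ⟧ℤ         ∎

    -- The case of 1 is separate so that `con ℤ.1ℤ` evaluates to `1#` itself rather than to
    -- `1# + 0#`; goals for the solver can then contain `1#` literally.
    ⟦_⟧′ : ℤ → Carrier
    ⟦ ℤ.+ 1 ⟧′ = 1#
    ⟦ i ⟧′     = ⟦ i ⟧ℤ

    ⟦⟧′≈⟦⟧ℤ : ∀ i → ⟦ i ⟧′ ≈ ⟦ i ⟧ℤ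
    ⟦⟧′≈⟦⟧ℤ (ℤ.+ 0)           = refl
    ⟦⟧′≈⟦⟧ℤ (ℤ.+ 1)           = sym (+-identityʳ 1#)
    ⟦⟧′≈⟦⟧ℤ (ℤ.+ suc (suc n)) = refl
    ⟦⟧′≈⟦⟧ℤ (ℤ.-[1+ n ])      = refl

    morphism : ℤ.+-*-rawRing -Raw-AlmostCommutative⟶ fromCommutativeRing R
    morphism = record
      { ⟦_⟧    = ⟦_⟧′
      ; +-homo = λ i j → trans (⟦⟧′≈⟦⟧ℤ (i ℤ.+ j))
                   (trans (+-homoℤ i j) (sym (+-cong (⟦⟧′≈⟦⟧ℤ i) (⟦⟧′≈⟦⟧ℤ j))))
      ; *-homo = λ i j → trans (⟦⟧′≈⟦⟧ℤ (i ℤ.* j))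
                   (trans (*-homoℤ i j) (sym (*-cong (⟦⟧′≈⟦⟧ℤ i) (⟦⟧′≈⟦⟧ℤ j))))
      ; -‿homo = λ i → trans (⟦⟧′≈⟦⟧ℤ (ℤ.- i))
                   (trans (-‿homoℤ i) (sym (-‿cong (⟦⟧′≈⟦⟧ℤ i))))
      ; 0-homo = refl
      ; 1-homo = refl
      }

    weakly-equal : WeaklyDecidable (Induced-equivalence morphism)
    weakly-equal i j with i ℤ.≟ j
    ... | yes ≡.refl = just refl
    ... | no _       = nothing

  open Algebra.Solver.Ring ℤ.+-*-rawRing (fromCommutativeRing R) morphism weakly-equal public
    using (Polynomial; solve; _:+_; _:*_; _:-_; :-_; _:=_; con)

  𝟘 𝟙 : ∀ {n} → Polynomial n
  𝟘 = con ℤ.0ℤ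
  𝟙 = con ℤ.1ℤ

-- Cauchy products of sequences over a commutative ring

module CauchyProduct (A : CommutativeRing 0ℓ 0ℓ) where
  open CommutativeRing A
  open IntegerSolver A
  open Relation.Binary.Reasoning.Setoid setoid

  infixl 7 _⊛_
  -- Recursion that shifts the first factor replaces the usual sum over pairs of indices and avoids
  -- subtracting them.
  _⊛_ : (ℕ → Carrier) → (ℕ → Carrier) → ℕ → Carrier
  (f ⊛ g) zero    = f 0 * g 0
  (f ⊛ g) (suc n) = f 0 * g (suc n) + ((f ∘ suc) ⊛ g) n

  ⊛-cong : ∀ {f f′ g g′} → (∀ i → f i ≈ f′ i) → (∀ i → g i ≈ g′ i) →
           ∀ n → (f ⊛ g) n ≈ (f′ ⊛ g′) n
  ⊛-cong p q zero    = *-cong (p 0) (q 0)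
  ⊛-cong p q (suc n) = +-cong (*-cong (p 0) (q (suc n))) (⊛-cong (p ∘ suc) q n)

  ⊛-distribʳ : ∀ f f′ g n → ((λ i → f i + f′ i) ⊛ g) n ≈ (f ⊛ g) n + (f′ ⊛ g) n
  ⊛-distribʳ f f′ g zero    = distribʳ _ _ _
  ⊛-distribʳ f f′ g (suc n) = trans (+-congˡ (⊛-distribʳ (f ∘ suc) (f′ ∘ suc) g n))
    (solve 5 (λ a b c x y → (a :+ b) :* c :+ (x :+ y) := (a :* c :+ x) :+ (b :* c :+ y))
       refl (f 0) (f′ 0) (g (suc n)) _ _)

  ⊛-*-assoc : ∀ a f g n → ((λ i → a * f i) ⊛ g) n ≈ a * (f ⊛ g) n
  ⊛-*-assoc a f g zero    = *-assoc _ _ _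
  ⊛-*-assoc a f g (suc n) = trans (+-congˡ (⊛-*-assoc a (f ∘ suc) g n))
    (solve 4 (λ a b c x → a :* b :* c :+ a :* x := a :* (b :* c :+ x)) refl a (f 0) (g (suc n)) _)

  ⊛-assoc : ∀ f g h n → ((f ⊛ g) ⊛ h) n ≈ (f ⊛ (g ⊛ h)) n
  ⊛-assoc f g h zero    = *-assoc _ _ _
  ⊛-assoc f g h (suc n) = begin
    f 0 * g 0 * h (suc n) + ((λ i → f 0 * g (suc i) + ((f ∘ suc) ⊛ g) i) ⊛ h) n
      ≈⟨ +-congˡ (⊛-distribʳ (λ i → f 0 * g (suc i)) ((f ∘ suc) ⊛ g) h n) ⟩
    f 0 * g 0 * h (suc n) + (((λ i → f 0 * g (suc i)) ⊛ h) n + (((f ∘ suc) ⊛ g) ⊛ h) n)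
      ≈⟨ +-congˡ (+-cong (⊛-*-assoc (f 0) (g ∘ suc) h n) (⊛-assoc (f ∘ suc) g h n)) ⟩
    f 0 * g 0 * h (suc n) + (f 0 * ((g ∘ suc) ⊛ h) n + ((f ∘ suc) ⊛ (g ⊛ h)) n)
      ≈⟨ solve 5 (λ a b c x y → a :* b :* c :+ (a :* x :+ y) := a :* (b :* c :+ x) :+ y)
           refl (f 0) (g 0) (h (suc n)) _ _ ⟩
    f 0 * (g 0 * h (suc n) + ((g ∘ suc) ⊛ h) n) + ((f ∘ suc) ⊛ (g ⊛ h)) n ∎

  -- The definition takes terms off the first factor only; this mirror image of it is what
  -- commutativity needs.
  ⊛-sucʳ : ∀ f g n → (f ⊛ g) (suc n) ≈ f (suc n) * g 0 + (f ⊛ (g ∘ suc)) n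
  ⊛-sucʳ f g zero    = +-comm _ _
  ⊛-sucʳ f g (suc n) = trans (+-congˡ (⊛-sucʳ (f ∘ suc) g n))
    (solve 3 (λ x y z → x :+ (y :+ z) := y :+ (x :+ z)) refl _ _ _)

  ⊛-comm : ∀ f g n → (f ⊛ g) n ≈ (g ⊛ f) n
  ⊛-comm f g zero    = *-comm _ _
  ⊛-comm f g (suc n) = trans (⊛-sucʳ f g n) (+-cong (*-comm _ _) (⊛-comm f (g ∘ suc) n))

  ⊛-zeroˡ : ∀ {f} g → (∀ i → f i ≈ 0#) → ∀ n → (f ⊛ g) n ≈ 0#
  ⊛-zeroˡ g p zero    = trans (*-congʳ (p 0)) (zeroˡ _)
  ⊛-zeroˡ g p (suc n) =
    trans (+-cong (trans (*-congʳ (p 0)) (zeroˡ _)) (⊛-zeroˡ g (p ∘ suc) n)) (+-identityˡ _)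

  -- A sequence with a single entry acts as a shift. This is multiplication by a power of one
  -- variable, with `x` collecting the remaining variables.
  ⊛-concentrated : ∀ {f x} g b → f b ≈ x → (∀ i → i ≢ b → f i ≈ 0#) →
                   ∀ n → (f ⊛ g) (b ℕ.+ n) ≈ x * g n
  ⊛-concentrated g zero    p q zero    = *-congʳ p
  ⊛-concentrated g zero    p q (suc n) =
    trans (+-cong (*-congʳ p) (⊛-zeroˡ g (λ i → q (suc i) λ ()) n)) (+-identityʳ _)
  ⊛-concentrated g (suc b) p q n =
    trans (+-cong (trans (*-congʳ (q 0 λ ())) (zeroˡ _))
                  (⊛-concentrated g b p (λ i i≢b → q (suc i) (i≢b ∘ ℕ.suc-injective)) n))
          (+-identityˡ _)

  ⊛-concentrated-< : ∀ {f} g b → (∀ i → i ≢ b → f i ≈ 0#) → ∀ n → n ℕ.< b → (f ⊛ g) n ≈ 0#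
  ⊛-concentrated-< g (suc b) q zero    _         = trans (*-congʳ (q 0 λ ())) (zeroˡ _)
  ⊛-concentrated-< g (suc b) q (suc n) (ℕ.s≤s l) =
    trans (+-cong (trans (*-congʳ (q 0 λ ())) (zeroˡ _))
                  (⊛-concentrated-< g b (λ i i≢b → q (suc i) (i≢b ∘ ℕ.suc-injective)) n l))
          (+-identityˡ _)

  ⊛-identityˡ : ∀ {f} g → f 0 ≈ 1# → (∀ i → f (suc i) ≈ 0#) → ∀ n → (f ⊛ g) n ≈ g n
  ⊛-identityˡ g p q n = trans (⊛-concentrated g 0 p (λ { zero ¬p → ⊥-elim (¬p ≡.refl) ; (suc i) _ → q i }) n)
                              (*-identityˡ _)

-- Formal power series form a commutative ring

module SeriesProperties where

  module S (k : ℕ) = PowerSeries k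
  open ≡.≡-Reasoning

  sumL : List ℤ → ℤ
  sumL = List.foldr ℤ._+_ ℤ.0ℤ

  sumL-++ : ∀ xs ys → sumL (xs ++ ys) ≡ sumL xs ℤ.+ sumL ys
  sumL-++ []       ys = ≡.sym (ℤ.+-identityˡ _)
  sumL-++ (x ∷ xs) ys = ≡.trans (cong (λ z → x ℤ.+ z) (sumL-++ xs ys)) (≡.sym (ℤ.+-assoc x _ _))

  sumL-cartesianProductWith : ∀ {A B C : Set} (F : C → ℤ) (G : A → B → C) xs ys →
    sumL (List.map F (List.cartesianProductWith G xs ys)) ≡
    sumL (List.map (λ x → sumL (List.map (λ y → F (G x y)) ys)) xs)
  sumL-cartesianProductWith F G []       ys = ≡.refl
  sumL-cartesianProductWith F G (x ∷ xs) ys = begin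
    sumL (List.map F (List.map (G x) ys ++ List.cartesianProductWith G xs ys))
      ≡⟨ cong sumL (List.map-++ F (List.map (G x) ys) _) ⟩
    sumL (List.map F (List.map (G x) ys) ++ List.map F (List.cartesianProductWith G xs ys))
      ≡⟨ sumL-++ (List.map F (List.map (G x) ys)) _ ⟩
    sumL (List.map F (List.map (G x) ys)) ℤ.+ sumL (List.map F (List.cartesianProductWith G xs ys))
      ≡⟨ cong₂ ℤ._+_ (cong sumL (≡.sym (List.map-∘ ys))) (sumL-cartesianProductWith F G xs ys) ⟩
    _ ∎

  -- The function `splittings` of `PowerSeries (suc k)` is not the one of `PowerSeries k`; induction
  -- on the number of variables has to pass from one to the other.
  splittings-ambient : ∀ k l {j} (α : Monomial j) → S.splittings k α ≡ S.splittings l α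
  splittings-ambient k l []      = ≡.refl
  splittings-ambient k l (e ∷ α) = cong (List.cartesianProductWith (λ b (β , γ) → (b ∷ β , (e ℕ.∸ b) ∷ γ)) (List.upTo (suc e))) (splittings-ambient k l α)

  tails : ∀ {k} → S.Series (suc k) → ℕ → S.Series k
  tails f i β = f (i ∷ β)

  *-cong : ∀ k {f f′ g g′} → S._≈_ k f f′ → S._≈_ k g g′ → S._≈_ k (S._*_ k f g) (S._*_ k f′ g′)
  *-cong k p q α = cong sumL (List.map-cong (λ (β , γ) → cong₂ ℤ._*_ (p β) (q γ)) (S.splittings k α))

  IsSeriesRing : ℕ → Set
  IsSeriesRing k = IsCommutativeRing (S._≈_ k) (S._+_ k) (S._*_ k) (S.-_ k) (S.0# k) (S.1# k)

  module _ (k : ℕ) where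
    open PowerSeries k
    open Algebra.Definitions _≈_

    isSeriesRing : Associative _*_ → Commutative _*_ → LeftIdentity 1# _*_ → _*_ DistributesOverʳ _+_ → IsSeriesRing k
    isSeriesRing *-assoc *-comm *-identityˡ *-distribʳ = record
      { isRing = record
        { +-isAbelianGroup = record
          { isGroup = record
            { isMonoid = record
              { isSemigroup = record
                { isMagma = record
                  { isEquivalence = record
                    { refl  = λ α → ≡.refl
                    ; sym   = λ p α → ≡.sym (p α)
                    ; trans = λ p q α → ≡.trans (p α) (q α) }
                  ; ∙-cong = λ p q α → cong₂ ℤ._+_ (p α) (q α) }
                ; assoc = λ f g h α → ℤ.+-assoc (f α) (g α) (h α) }
              ; identity = (λ f α → ℤ.+-identityˡ (f α)) , λ f α → ℤ.+-identityʳ (f α) }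
            ; inverse = (λ f α → ℤ.+-inverseˡ (f α)) , λ f α → ℤ.+-inverseʳ (f α)
            ; ⁻¹-cong = λ p α → cong ℤ.-_ (p α) }
          ; comm = λ f g α → ℤ.+-comm (f α) (g α) }
        ; *-cong     = *-cong k
        ; *-assoc    = *-assoc
        ; *-identity = *-identityˡ , λ f α → ≡.trans (*-comm f 1# α) (*-identityˡ f α)
        ; distrib    = (λ f g h α → ≡.trans (*-comm f (g + h) α)
                         (≡.trans (*-distribʳ f g h α) (cong₂ ℤ._+_ (*-comm g f α) (*-comm h f α))))
                     , *-distribʳ
        }
      ; *-comm = *-comm
      }

  module Constants where
    open PowerSeries 0
    open Algebra.Definitions _≈_

    *-[] : ∀ f g → (f * g) [] ≡ f [] ℤ.* g []
    *-[] f g = ℤ.+-identityʳ (f [] ℤ.* g [])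

    *-assoc : Associative _*_
    *-assoc f g h [] = begin
      ((f * g) * h) []             ≡⟨ *-[] (f * g) h ⟩
      (f * g) [] ℤ.* h []          ≡⟨ cong (ℤ._* h []) (*-[] f g) ⟩
      f [] ℤ.* g [] ℤ.* h []       ≡⟨ ℤ.*-assoc (f []) (g []) (h []) ⟩
      f [] ℤ.* (g [] ℤ.* h [])     ≡⟨ cong (f [] ℤ.*_) (*-[] g h) ⟨
      f [] ℤ.* (g * h) []          ≡⟨ *-[] f (g * h) ⟨
      (f * (g * h)) []             ∎

    *-comm : Commutative _*_
    *-comm f g [] = cong (ℤ._+ ℤ.0ℤ) (ℤ.*-comm (f []) (g []))

    *-identityˡ : LeftIdentity 1# _*_
    *-identityˡ f [] = ≡.trans (*-[] 1# f) (ℤ.*-identityˡ (f []))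

    *-distribʳ : _*_ DistributesOverʳ _+_
    *-distribʳ h f g [] = begin
      ((f + g) * h) []                  ≡⟨ *-[] (f + g) h ⟩
      (f [] ℤ.+ g []) ℤ.* h []          ≡⟨ ℤ.*-distribʳ-+ (h []) (f []) (g []) ⟩
      f [] ℤ.* h [] ℤ.+ g [] ℤ.* h []   ≡⟨ cong₂ ℤ._+_ (*-[] f h) (*-[] g h) ⟨
      (f * h + g * h) []                ∎

  -- Power series in k + 1 variables are power series in one variable over power series in k variables.
  module Step (k : ℕ) (isRing : IsSeriesRing k) where
    ring : CommutativeRing 0ℓ 0ℓ
    ring = record { isCommutativeRing = isRing }

    open CauchyProduct ring
    open PowerSeries (suc k)
    open Algebra.Definitions _≈_

    -- A splitting of `e ∷ α` is some `b` up to `e` together with a splitting of `α`, so the double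
    -- sum is a Cauchy product whose coefficients are series in `k` variables. In `rows` the first
    -- sequence is arbitrary because the induction shifts it.
    *≡⊛ : ∀ f g e α → (f * g) (e ∷ α) ≡ (tails f ⊛ tails g) e α
    *≡⊛ f g e α = begin
      (f * g) (e ∷ α)
        ≡⟨ sumL-cartesianProductWith (λ (β , γ) → f β ℤ.* g γ) (λ b (β , γ) → (b ∷ β , (e ℕ.∸ b) ∷ γ))
             (List.upTo (suc e)) (splittings α) ⟩
      sumL (List.map (λ b → row b (splittings α)) (List.upTo (suc e)))
        ≡⟨ cong (λ ss → sumL (List.map (λ b → row b ss) (List.upTo (suc e)))) (splittings-ambient (suc k) k α) ⟩
      sumL (List.map (λ b → row b (S.splittings k α)) (List.upTo (suc e)))
        ≡⟨ cong sumL (List.map-upTo (λ b → row b (S.splittings k α)) (suc e)) ⟩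
      sumL (List.applyUpTo (λ b → row b (S.splittings k α)) (suc e))
        ≡⟨ rows e (tails f) ⟩
      (tails f ⊛ tails g) e α ∎
      where
      row : ℕ → List (Monomial k × Monomial k) → ℤ
      row b ss = sumL (List.map (λ (β , γ) → f (b ∷ β) ℤ.* g ((e ℕ.∸ b) ∷ γ)) ss)
      rows : ∀ e (u : ℕ → S.Series k) →
             sumL (List.applyUpTo (λ b → S._*_ k (u b) (tails g (e ℕ.∸ b)) α) (suc e)) ≡ (u ⊛ tails g) e α
      rows zero    u = ℤ.+-identityʳ _
      rows (suc e) u = cong (λ z → S._*_ k (u 0) (tails g (suc e)) α ℤ.+ z) (rows e (u ∘ suc))

    *-assoc : Associative _*_
    *-assoc f g h (e ∷ α) = begin
      _ ≡⟨ *≡⊛ (f * g) h e α ⟩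
      _ ≡⟨ ⊛-cong {g = tails h} (*≡⊛ f g) (λ i β → ≡.refl) e α ⟩
      _ ≡⟨ ⊛-assoc (tails f) (tails g) (tails h) e α ⟩
      _ ≡⟨ ⊛-cong {f = tails f} (λ i β → ≡.refl) (*≡⊛ g h) e α ⟨
      _ ≡⟨ *≡⊛ f (g * h) e α ⟨
      _ ∎

    *-comm : Commutative _*_
    *-comm f g (e ∷ α) = begin
      _ ≡⟨ *≡⊛ f g e α ⟩
      _ ≡⟨ ⊛-comm (tails f) (tails g) e α ⟩
      _ ≡⟨ *≡⊛ g f e α ⟨
      _ ∎

    *-identityˡ : LeftIdentity 1# _*_
    *-identityˡ f (e ∷ α) = ≡.trans (*≡⊛ 1# f e α) (⊛-identityˡ (tails f) (λ β → ≡.refl) (λ i β → ≡.refl) e α)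

    *-distribʳ : _*_ DistributesOverʳ _+_
    *-distribʳ h f g (e ∷ α) = begin
      _ ≡⟨ *≡⊛ (f + g) h e α ⟩
      _ ≡⟨ ⊛-distribʳ (tails f) (tails g) (tails h) e α ⟩
      _ ≡⟨ cong₂ ℤ._+_ (*≡⊛ f h e α) (*≡⊛ g h e α) ⟨
      _ ∎

  seriesIsCommutativeRing : ∀ k → IsSeriesRing k
  seriesIsCommutativeRing zero    = isSeriesRing 0 *-assoc *-comm *-identityˡ *-distribʳ
    where open Constants
  seriesIsCommutativeRing (suc k) = isSeriesRing (suc k) *-assoc *-comm *-identityˡ *-distribʳ
    where open Step k (seriesIsCommutativeRing k)

  seriesCommutativeRing : ℕ → CommutativeRing 0ℓ 0ℓ
  seriesCommutativeRing k = record { isCommutativeRing = seriesIsCommutativeRing k }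

infixl 6 _⊕_
_⊕_ : ∀ {k} → Vec ℕ k → Vec ℕ k → Vec ℕ k
_⊕_ = Vec.zipWith ℕ._+_

≡-decℕ : ∀ {k} (α β : Vec ℕ k) → _
≡-decℕ = Vec.≡-dec ℕ._≟_

∸? : ∀ a b → (∃ λ c → a ℕ.+ c ≡ b) ⊎ (b ℕ.< a)
∸? a b with a ℕ.≤? b
... | yes a≤b = inj₁ (b ℕ.∸ a , ℕ.m+[n∸m]≡n a≤b)
... | no a≰b  = inj₂ (ℕ.≰⇒> a≰b)

divides? : ∀ {k} (γ α : Vec ℕ k) → (∃ λ α′ → γ ⊕ α′ ≡ α) ⊎ (∀ α′ → γ ⊕ α′ ≢ α)
divides? []      []      = inj₁ ([] , ≡.refl)
divides? (c ∷ γ) (a ∷ α) with ∸? c a | divides? γ α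
... | inj₁ (b , p) | inj₁ (β , q) = inj₁ (b ∷ β , cong₂ _∷_ p q)
... | inj₂ a<c     | _            = inj₂ λ { (b ∷ β) ≡.refl → ℕ.<⇒≱ a<c (ℕ.m≤m+n c b) }
... | inj₁ _       | inj₂ ¬q      = inj₂ λ { (b ∷ β) ≡.refl → ¬q β ≡.refl }

sum-⊕ : ∀ {k} (α β : Vec ℕ k) → Vec.sum (α ⊕ β) ≡ Vec.sum α ℕ.+ Vec.sum β
sum-⊕ []      []      = ≡.refl
sum-⊕ (a ∷ α) (b ∷ β) = ≡.trans (cong (a ℕ.+ b ℕ.+_) (sum-⊕ α β)) (+-interchange a b _ _)
  where
  open import Algebra.Properties.CommutativeSemigroup ℕ.+-commutativeSemigroup
    renaming (interchange to +-interchange)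

⊕-cancelˡ : ∀ {k} (γ : Vec ℕ k) {α β} → γ ⊕ α ≡ γ ⊕ β → α ≡ β
⊕-cancelˡ []      {[]}    {[]}    _ = ≡.refl
⊕-cancelˡ (c ∷ γ) {a ∷ α} {b ∷ β} p =
  cong₂ _∷_ (ℕ.+-cancelˡ-≡ c a b (Vec.∷-injectiveˡ p)) (⊕-cancelˡ γ (Vec.∷-injectiveʳ p))

⊕-identityˡ : ∀ {k} (α : Vec ℕ k) → Vec.replicate k 0 ⊕ α ≡ α
⊕-identityˡ []      = ≡.refl
⊕-identityˡ (a ∷ α) = cong (a ∷_) (⊕-identityˡ α)

-- Multiplication of series by monomials

module MonomialMultiplication where
  open SeriesProperties
  open ≡.≡-Reasoning

  monomial-≢ : ∀ {k} (γ β : Monomial k) → γ ≢ β → S.monomial k γ β ≡ ℤ.0ℤ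
  monomial-≢ γ β p rewrite dec-false (≡-decℕ γ β) p = ≡.refl

  monomial-≡ : ∀ {k} (γ : Monomial k) → S.monomial k γ γ ≡ ℤ.1ℤ
  monomial-≡ γ rewrite dec-true (≡-decℕ γ γ) ≡.refl = ≡.refl

  monomial-∷-≡ : ∀ {k} b (γ β : Monomial k) → S.monomial (suc k) (b ∷ γ) (b ∷ β) ≡ S.monomial k γ β
  monomial-∷-≡ b γ β = lemma (≡-decℕ γ β)
    where
    lemma : Dec (γ ≡ β) → S.monomial _ (b ∷ γ) (b ∷ β) ≡ S.monomial _ γ β
    lemma (yes ≡.refl) = ≡.trans (monomial-≡ (b ∷ γ)) (≡.sym (monomial-≡ γ))
    lemma (no γ≢β)     = ≡.trans (monomial-≢ (b ∷ γ) (b ∷ β) (γ≢β ∘ Vec.∷-injectiveʳ)) (≡.sym (monomial-≢ γ β γ≢β))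

  -- As a sequence in the outermost variable the monomial is concentrated at `c`, with the monomial
  -- in the other variables as its entry; induction handles that entry.
  monomial-* : ∀ {k} (γ : Monomial k) (f : S.Series k) α →
               S._*_ k (S.monomial k γ) f (γ ⊕ α) ≡ f α
  monomial-* {zero}  []      f []      = ≡.trans (ℤ.+-identityʳ _) (ℤ.*-identityˡ (f []))
  monomial-* {suc k} (c ∷ γ) f (a ∷ α) = begin
    _ ≡⟨ *≡⊛ (S.monomial (suc k) (c ∷ γ)) f (c ℕ.+ a) (γ ⊕ α) ⟩
    _ ≡⟨ ⊛-concentrated {x = S.monomial k γ} (tails f) c (monomial-∷-≡ c γ)
           (λ i i≢c β → monomial-≢ (c ∷ γ) (i ∷ β) (i≢c ∘ ≡.sym ∘ Vec.∷-injectiveˡ)) a (γ ⊕ α) ⟩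
    _ ≡⟨ monomial-* γ (tails f a) α ⟩
    f (a ∷ α) ∎
    where
    open Step k (seriesIsCommutativeRing k)
    open CauchyProduct ring

  monomial-*-∤ : ∀ {k} (γ : Monomial k) (f : S.Series k) α → (∀ α′ → γ ⊕ α′ ≢ α) →
                 S._*_ k (S.monomial k γ) f α ≡ ℤ.0ℤ
  monomial-*-∤ {zero}  []      f []      γ∤α = ⊥-elim (γ∤α [] ≡.refl)
  monomial-*-∤ {suc k} (c ∷ γ) f (a ∷ α) γ∤α with ∸? c a
  ... | inj₁ (b , ≡.refl) = begin
    _ ≡⟨ *≡⊛ (S.monomial (suc k) (c ∷ γ)) f (c ℕ.+ b) α ⟩
    _ ≡⟨ ⊛-concentrated {x = S.monomial k γ} (tails f) c (monomial-∷-≡ c γ)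
           (λ i i≢c β → monomial-≢ (c ∷ γ) (i ∷ β) (i≢c ∘ ≡.sym ∘ Vec.∷-injectiveˡ)) b α ⟩
    _ ≡⟨ monomial-*-∤ γ (tails f b) α (λ α′ p → γ∤α (b ∷ α′) (cong (c ℕ.+ b ∷_) p)) ⟩
    ℤ.0ℤ ∎
    where
    open Step k (seriesIsCommutativeRing k)
    open CauchyProduct ring
  ... | inj₂ a<c = begin
    _ ≡⟨ *≡⊛ (S.monomial (suc k) (c ∷ γ)) f a α ⟩
    _ ≡⟨ ⊛-concentrated-< (tails f) c
           (λ i i≢c β → monomial-≢ (c ∷ γ) (i ∷ β) (i≢c ∘ ≡.sym ∘ Vec.∷-injectiveˡ)) a a<c α ⟩
    ℤ.0ℤ ∎
    where
    open Step k (seriesIsCommutativeRing k)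
    open CauchyProduct ring

  monomial-⊕ : ∀ {k} (γ δ : Monomial k) →
               S._≈_ k (S._*_ k (S.monomial k γ) (S.monomial k δ)) (S.monomial k (γ ⊕ δ))
  monomial-⊕ {k} γ δ α with divides? γ α
  ... | inj₂ γ∤α           = ≡.trans (monomial-*-∤ γ _ α γ∤α) (≡.sym (monomial-≢ (γ ⊕ δ) α (λ { ≡.refl → γ∤α δ ≡.refl })))
  ... | inj₁ (α′ , ≡.refl) = ≡.trans (monomial-* γ _ α′) (lemma (≡-decℕ δ α′))
    where
    lemma : Dec (δ ≡ α′) → S.monomial k δ α′ ≡ S.monomial k (γ ⊕ δ) (γ ⊕ α′)
    lemma (yes ≡.refl) = ≡.trans (monomial-≡ δ) (≡.sym (monomial-≡ (γ ⊕ δ)))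
    lemma (no p)       = ≡.trans (monomial-≢ δ α′ p) (≡.sym (monomial-≢ (γ ⊕ δ) (γ ⊕ α′) (p ∘ ⊕-cancelˡ γ)))

-- Inverses of power series with constant term 1

module Inverse (k : ℕ) where
  open SeriesProperties using (seriesCommutativeRing; sumL)
  open CommutativeRing (seriesCommutativeRing k) renaming (Carrier to Series)
  open IntegerSolver (seriesCommutativeRing k)
  open PowerSeries k using (splittings; inverse; _^_)

  -- f is divisible by the p-th power of the augmentation ideal.
  Order : ℕ → Series → Set
  Order p f = ∀ α → Vec.sum α ℕ.< p → f α ≡ ℤ.0ℤ

  splittings-degree : ∀ {l} (α : Monomial l) →
    All (λ (β , γ) → Vec.sum β ℕ.+ Vec.sum γ ≡ Vec.sum α) (splittings α)
  splittings-degree []      = ≡.refl ∷ []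
  splittings-degree (e ∷ α) =
    All.cartesianProductWith⁺ (≡.setoid _) (≡.setoid _) _ (List.upTo (suc e)) (splittings α)
      λ {b} {(β , γ)} b∈ βγ∈ → begin
        (b ℕ.+ Vec.sum β) ℕ.+ (e ℕ.∸ b ℕ.+ Vec.sum γ)  ≡⟨ interchange b _ _ _ ⟩
        (b ℕ.+ (e ℕ.∸ b)) ℕ.+ (Vec.sum β ℕ.+ Vec.sum γ)
          ≡⟨ cong₂ ℕ._+_ (ℕ.m+[n∸m]≡n (ℕ.≤-pred (∈-upTo⁻ b∈))) (All.lookup (splittings-degree α) βγ∈) ⟩
        e ℕ.+ Vec.sum α ∎
    where
    open ≡.≡-Reasoning
    open import Algebra.Properties.CommutativeSemigroup ℕ.+-commutativeSemigroup using (interchange)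
    open import Data.List.Membership.Propositional.Properties using (∈-upTo⁻)

  -- A coefficient of a product sees the factors only up to its own degree. This allows `inverse f`,
  -- cut off differently at each coefficient, to be exchanged for one partial sum.
  *-local : ∀ f {g h} α → (∀ γ → Vec.sum γ ℕ.≤ Vec.sum α → g γ ≡ h γ) → (f * g) α ≡ (f * h) α
  *-local f {g} {h} α p = cong sumL (List.map-cong-local (All.map
    (λ { {β , γ} q → cong (f β ℤ.*_) (p γ (ℕ.≤-trans (ℕ.m≤n+m _ (Vec.sum β)) (ℕ.≤-reflexive q))) })
    (splittings-degree α)))

  sumL-zero : ∀ {A : Set} {F : A → ℤ} {xs} → All (λ x → F x ≡ ℤ.0ℤ) xs → sumL (List.map F xs) ≡ ℤ.0ℤ
  sumL-zero []       = ≡.refl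
  sumL-zero (p ∷ ps) = cong₂ ℤ._+_ p (sumL-zero ps)

  order-* : ∀ {p q f g} → Order p f → Order q g → Order (p ℕ.+ q) (f * g)
  order-* {p} {q} {f} {g} of og α α<p+q = sumL-zero (All.map step (splittings-degree α))
    where
    step : ∀ {βγ} → Vec.sum (proj₁ βγ) ℕ.+ Vec.sum (proj₂ βγ) ≡ Vec.sum α →
           f (proj₁ βγ) ℤ.* g (proj₂ βγ) ≡ ℤ.0ℤ
    step {β , γ} e with Vec.sum β ℕ.<? p | Vec.sum γ ℕ.<? q
    ... | yes β<p | _       = ≡.trans (cong (ℤ._* g γ) (of β β<p)) (ℤ.*-zeroˡ (g γ))
    ... | no  _   | yes γ<q = ≡.trans (cong (f β ℤ.*_) (og γ γ<q)) (ℤ.*-zeroʳ (f β))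
    ... | no β≮p  | no γ≮q  = ⊥-elim (ℕ.<⇒≱ α<p+q
          (ℕ.≤-trans (ℕ.+-mono-≤ (ℕ.≮⇒≥ β≮p) (ℕ.≮⇒≥ γ≮q)) (ℕ.≤-reflexive e)))

  order-^ : ∀ {f} → Order 1 f → ∀ j → Order j (f ^ j)
  order-^ of zero    = λ α ()
  order-^ of (suc j) = order-* of (order-^ of j)

  geometric : Series → ℕ → Series
  geometric g zero    = 1#
  geometric g (suc N) = geometric g N + g ^ suc N

  geometric-telescope : ∀ g N → (1# - g) * geometric g N ≈ 1# - g ^ suc N
  geometric-telescope g zero    = solve 1 (λ g → (con ℤ.1ℤ :- g) :* con ℤ.1ℤ := con ℤ.1ℤ :- g :* con ℤ.1ℤ) refl g
  geometric-telescope g (suc N) = trans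
    (solve 3 (λ g s x → (con ℤ.1ℤ :- g) :* (s :+ x) := (con ℤ.1ℤ :- g) :* s :+ x :- g :* x) refl g (geometric g N) (g ^ suc N))
    (trans (+-congʳ { - (g * g ^ suc N)} (+-congʳ {g ^ suc N} (geometric-telescope g N)))
      (solve 2 (λ x y → con ℤ.1ℤ :- x :+ x :- y := con ℤ.1ℤ :- y) refl (g ^ suc N) (g ^ suc (suc N))))

  inverse-geometric : ∀ f α → inverse f α ≡ geometric (1# - f) (Vec.sum α) α
  inverse-geometric f α = lemma (Vec.sum α)
    where
    lemma : ∀ N → sumL (List.map (λ j → ((1# - f) ^ j) α) (List.upTo (suc N))) ≡ geometric (1# - f) N α
    lemma zero    = ℤ.+-identityʳ _
    lemma (suc N) = begin
      sumL (List.map F (List.upTo (suc (suc N))))   ≡⟨ cong (sumL ∘ List.map F) (List.upTo-∷ʳ (suc N)) ⟨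
      sumL (List.map F (List.upTo (suc N) List.∷ʳ suc N))  ≡⟨ cong sumL (List.map-++ F (List.upTo (suc N)) (suc N ∷ [])) ⟩
      sumL (List.map F (List.upTo (suc N)) ++ F (suc N) ∷ [])  ≡⟨ SeriesProperties.sumL-++ (List.map F (List.upTo (suc N))) _ ⟩
      sumL (List.map F (List.upTo (suc N))) ℤ.+ (F (suc N) ℤ.+ ℤ.0ℤ)  ≡⟨ cong₂ ℤ._+_ (lemma N) (ℤ.+-identityʳ _) ⟩
      geometric (1# - f) (suc N) α ∎
      where
      open ≡.≡-Reasoning
      F : ℕ → ℤ
      F j = ((1# - f) ^ j) α

  -- The summands past the degree of `α` have order larger than that degree.
  geometric-stable : ∀ {g} → Order 1 g → ∀ α N → Vec.sum α ℕ.≤ N → geometric g N α ≡ geometric g (Vec.sum α) α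
  geometric-stable og α zero    z≤ with Vec.sum α
  geometric-stable og α zero ℕ.z≤n | zero = ≡.refl
  geometric-stable {g} og α (suc N) l with ℕ.m≤n⇒m<n∨m≡n l
  ... | inj₂ e = cong (λ M → geometric g M α) (≡.sym e)
  ... | inj₁ (ℕ.s≤s l′) = ≡.trans (cong₂ ℤ._+_ (geometric-stable og α N l′) (order-^ og (suc N) α (ℕ.s≤s l′)))
                                  (ℤ.+-identityʳ _)

  -- Constant term 1, stated for the series `1# - f` whose powers make up the inverse.
  Unipotent : Series → Set
  Unipotent f = Order 1 (1# - f)

  -- With `α` fixed, `inverse f` may be replaced by the geometric sum up to the degree of `α`. That
  -- sum telescopes, and the error is a power of order too high to reach `α`.
  inverseʳ : ∀ {f} → Unipotent f → f * inverse f ≈ 1#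
  inverseʳ {f} u α = begin
    (f * inverse f) α
      ≡⟨ *-local f α (λ γ l → ≡.trans (inverse-geometric f γ) (≡.sym (geometric-stable u γ (Vec.sum α) l))) ⟩
    (f * geometric (1# - f) (Vec.sum α)) α
      ≡⟨ *-congʳ {geometric (1# - f) (Vec.sum α)} (solve 1 (λ f → f := con ℤ.1ℤ :- (con ℤ.1ℤ :- f)) refl f) α ⟩
    ((1# - (1# - f)) * geometric (1# - f) (Vec.sum α)) α
      ≡⟨ geometric-telescope (1# - f) (Vec.sum α) α ⟩
    1# α ℤ.- ((1# - f) ^ suc (Vec.sum α)) α
      ≡⟨ cong (λ z → 1# α ℤ.- z) (order-^ u (suc (Vec.sum α)) α ℕ.≤-refl) ⟩
    1# α ℤ.- ℤ.0ℤ ≡⟨ ℤ.+-identityʳ _ ⟩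
    1# α ∎
    where open ≡.≡-Reasoning

  open Relation.Binary.Reasoning.Setoid setoid

  inverse-unique : ∀ {f g h} → Unipotent f → f * g ≈ h → g ≈ inverse f * h
  inverse-unique {f} {g} {h} u p = begin
    g                     ≈⟨ *-identityˡ g ⟨
    1# * g                ≈⟨ *-congʳ {g} (inverseʳ u) ⟨
    f * inverse f * g     ≈⟨ solve 3 (λ f i g → f :* i :* g := i :* (f :* g)) refl f (inverse f) g ⟩
    inverse f * (f * g)   ≈⟨ *-congˡ {inverse f} p ⟩
    inverse f * h         ∎

  order-resp : ∀ {p f g} → f ≈ g → Order p f → Order p g
  order-resp p o α l = ≡.trans (≡.sym (p α)) (o α l)

  unipotent-1# : Unipotent 1#
  unipotent-1# = order-resp (sym (-‿inverseʳ 1#)) (λ α _ → ≡.refl)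

  unipotent-1- : ∀ {f} → Order 1 f → Unipotent (1# - f)
  unipotent-1- {f} = order-resp (solve 1 (λ f → f := con ℤ.1ℤ :- (con ℤ.1ℤ :- f)) refl f)

  unipotent-* : ∀ {f g} → Unipotent f → Unipotent g → Unipotent (f * g)
  unipotent-* {f} {g} uf ug = order-resp
    (solve 2 (λ f g → con ℤ.1ℤ :- f :+ f :* (con ℤ.1ℤ :- g) := con ℤ.1ℤ :- f :* g) refl f g)
    λ α l → cong₂ ℤ._+_ (uf α l) (order-* {0} {f = f} (λ _ ()) ug α l)

  order-monomial : ∀ γ → 0 ℕ.< Vec.sum γ → Order 1 (PowerSeries.monomial k γ)
  order-monomial γ l α (ℕ.s≤s z) = MonomialMultiplication.monomial-≢ γ α λ { ≡.refl → ℕ.<⇒≱ l z }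

  order-*ʳ : ∀ {f g} → Order 1 f → Order 1 (f * g)
  order-*ʳ {f} {g} o = order-* {1} {0} {f} {g} o λ _ ()

-- Deletion-contraction trees and their counting functions

sucHead : ∀ {n} → Vec ℕ (suc n) → Vec ℕ (suc n)
sucHead (e ∷ a) = suc e ∷ a

sucHead-injective : ∀ {n} {a b : Vec ℕ (suc n)} → sucHead a ≡ sucHead b → a ≡ b
sucHead-injective {a = _ ∷ _} {_ ∷ _} ≡.refl = ≡.refl

-- The tree of deletions and contractions of an arrangement whose hyperplanes are processed in order.
data Tree : ℕ → Set where
  leaf   : Tree 0
  loop   : ∀ {n} → Tree n → Tree (suc n)
  branch : ∀ {n} (deletion contraction : Tree n) → Tree (suc n)

-- Rank computed greedily: a chosen form that is not a loop adds one, and the later forms are then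
-- counted modulo it, that is, in the contraction.
rank : ∀ {n} → Tree n → Subset n → ℕ
rank leaf         []            = 0
rank (loop T)     (_ ∷ B)       = rank T B
rank (branch D C) (outside ∷ B) = rank D B
rank (branch D C) (inside ∷ B)  = suc (rank C B)

shiftℕ : (ℕ → ℕ) → ℕ → ℕ
shiftℕ f zero    = 0
shiftℕ f (suc d) = f d

-- In the last clause the contraction counts the products without the first form and so ignores `e`.
-- The shifted term counts the products divisible by it, whose quotients have degree one less.
basisCount : ∀ {n} → Tree n → ℕ → Vec ℕ n → ℕ
basisCount leaf         zero    []          = 1
basisCount leaf         (suc d) []          = 0
basisCount (loop T)     d       (_ ∷ a)     = basisCount T d a
basisCount (branch D C) d       (zero ∷ a)  = basisCount D d a
basisCount (branch D C) d       (suc e ∷ a) =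
  basisCount C d a ℕ.+ shiftℕ (λ d′ → basisCount (branch D C) d′ (e ∷ a)) d

-- Recursion for the multivariate Tutte polynomial

module TreeAlgebra (A : CommutativeRing 0ℓ 0ℓ) where
  open CommutativeRing A hiding (zero)
  open IntegerSolver A
  open RawSemiringDefinitions (RawRing.rawSemiring rawRing) using (product; _^_) public
  open Relation.Binary.Reasoning.Setoid setoid

  sumA : List Carrier → Carrier
  sumA = List.foldr _+_ 0#

  -- Here `q` already stands for the inverse of the Tutte variable. Over power series this unfolds
  -- to `Z̃`, so the identities below apply to it directly.
  Z : ∀ {n} → (Subset n → ℕ) → Carrier → (Fin n → Carrier) → Carrier
  Z {n} rk q v = sumA (List.map (λ B → q ^ rk B * product (λ e → if lookup B e then v e else 1#)) (subsets n))

  sumA-++ : ∀ xs ys → sumA (xs ++ ys) ≈ sumA xs + sumA ys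
  sumA-++ []       ys = sym (+-identityˡ _)
  sumA-++ (x ∷ xs) ys = trans (+-congˡ (sumA-++ xs ys)) (sym (+-assoc _ _ _))

  sumA-scale : ∀ {B : Set} {F G : B → Carrier} a → (∀ x → F x ≈ a * G x) → ∀ xs →
               sumA (List.map F xs) ≈ a * sumA (List.map G xs)
  sumA-scale a p []       = sym (zeroʳ a)
  sumA-scale a p (x ∷ xs) = trans (+-cong (p x) (sumA-scale a p xs)) (sym (distribˡ a _ _))

  -- The factors `a` and `b` absorb the effect of the first form on the rank: they are 1 where the
  -- rank stays and `q` where it grows by one.
  Z-split : ∀ {n} (rk : Subset (suc n) → ℕ) {rk₁ rk₂} q v a b →
            (∀ B → q ^ rk (outside ∷ B) ≈ a * q ^ rk₁ B) →
            (∀ B → q ^ rk (inside ∷ B) ≈ b * q ^ rk₂ B) →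
            Z rk q v ≈ a * Z rk₁ q (v ∘ suc) + b * v zero * Z rk₂ q (v ∘ suc)
  Z-split {n} rk {rk₁} {rk₂} q v a b p₁ p₂ = begin
    sumA (List.map F (List.map (outside ∷_) (subsets n) ++ List.map (inside ∷_) (subsets n)))
      ≡⟨ cong sumA (List.map-++ F (List.map (outside ∷_) (subsets n)) _) ⟩
    sumA (List.map F (List.map (outside ∷_) (subsets n)) ++ List.map F (List.map (inside ∷_) (subsets n)))
      ≈⟨ sumA-++ (List.map F (List.map (outside ∷_) (subsets n))) _ ⟩
    sumA (List.map F (List.map (outside ∷_) (subsets n))) + sumA (List.map F (List.map (inside ∷_) (subsets n)))
      ≡⟨ cong₂ (λ x y → sumA x + sumA y) (≡.sym (List.map-∘ (subsets n))) (≡.sym (List.map-∘ (subsets n))) ⟩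
    sumA (List.map (F ∘ (outside ∷_)) (subsets n)) + sumA (List.map (F ∘ (inside ∷_)) (subsets n))
      ≈⟨ +-cong
           (sumA-scale a (λ B → trans (*-cong (p₁ B) (*-identityˡ _)) (*-assoc _ _ _)) (subsets n))
           (sumA-scale (b * v zero) (λ B → trans (*-congʳ (p₂ B))
             (solve 4 (λ b x y z → b :* x :* (y :* z) := b :* y :* (x :* z)) refl b (q ^ rk₂ B) (v zero) _)) (subsets n)) ⟩
    _ ∎
    where
    F : Subset (suc n) → Carrier
    F B = q ^ rk B * product (λ e → if lookup B e then v e else 1#)

  Z-leaf : ∀ q v → Z (rank leaf) q v ≈ 1#
  Z-leaf q v = trans (+-identityʳ _) (*-identityˡ _)

  module _ {n} (S : Fin (suc n) → Carrier) (t q⁻¹ : Carrier) (u : Fin (suc n) → Carrier) (w P : Carrier)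
           (u-inverse : (1# - S zero) * u zero ≈ 1#) (w-inverse : (1# - S zero * t) * w ≈ 1#)
           (q-inverse : (1# - t) * q⁻¹ ≈ 1#) where
    private
      v : Fin (suc n) → Carrier
      v j = S j * (1# - t) * u j

      Z′ : Tree n → Carrier
      Z′ T = Z (rank T) q⁻¹ (v ∘ suc)

    -- A loop contributes the factor 1 + S(1 - t)/(1 - S) = (1 - St)/(1 - S), whose numerator
    -- cancels against `w`.
    Z-loop : ∀ T → (w * P) * Z (rank (loop T)) q⁻¹ v ≈ u zero * (P * Z′ T)
    Z-loop T = begin
      (w * P) * Z (rank (loop T)) q⁻¹ v
        ≈⟨ *-congˡ (Z-split (rank (loop T)) {rank T} {rank T} q⁻¹ v 1# 1# (λ B → sym (*-identityˡ _)) (λ B → sym (*-identityˡ _))) ⟩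
      (w * P) * (1# * Z′ T + 1# * (S zero * (1# - t) * u zero) * Z′ T)
        -- The solver does not know that `u` inverts 1 - S. The identity is therefore written with
        -- an error term that is a multiple of 1 - (1 - S)u, which vanishes in the next step.
        ≈⟨ solve 6 (λ w P z s t u → let 𝟙 = con ℤ.1ℤ in
             (w :* P) :* (𝟙 :* z :+ 𝟙 :* (s :* (𝟙 :- t) :* u) :* z) :=
             (u :* (𝟙 :- s :* t) :* w) :* (P :* z) :+ w :* P :* z :* (𝟙 :- (𝟙 :- s) :* u))
             refl w P (Z′ T) (S zero) t (u zero) ⟩
      (u zero * (1# - S zero * t) * w) * (P * Z′ T) + w * P * Z′ T * (1# - (1# - S zero) * u zero)
        ≈⟨ +-cong (*-congʳ (trans (*-assoc _ _ _) (trans (*-congˡ w-inverse) (*-identityʳ _))))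
                  (trans (*-congˡ (trans (+-congˡ (-‿cong u-inverse)) (-‿inverseʳ 1#))) (zeroʳ _)) ⟩
      u zero * (P * Z′ T) + 0#
        ≈⟨ +-identityʳ _ ⟩
      u zero * (P * Z′ T) ∎

    -- The factor `q⁻¹` that comes from the higher rank cancels the factor 1 - t in `v zero`.
    Z-branch : ∀ D C → (w * P) * Z (rank (branch D C)) q⁻¹ v ≈ w * (P * Z′ D + S zero * (u zero * (P * Z′ C)))
    Z-branch D C = begin
      (w * P) * Z (rank (branch D C)) q⁻¹ v
        ≈⟨ *-congˡ (Z-split (rank (branch D C)) {rank D} {rank C} q⁻¹ v 1# q⁻¹ (λ B → sym (*-identityˡ _)) (λ B → refl)) ⟩
      (w * P) * (1# * Z′ D + q⁻¹ * (S zero * (1# - t) * u zero) * Z′ C)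
        ≈⟨ solve 8 (λ w P d c s t u q → let 𝟙 = con ℤ.1ℤ in
             (w :* P) :* (𝟙 :* d :+ q :* (s :* (𝟙 :- t) :* u) :* c) :=
             w :* (P :* d :+ ((𝟙 :- t) :* q) :* (s :* (u :* (P :* c)))))
             refl w P (Z′ D) (Z′ C) (S zero) t (u zero) q⁻¹ ⟩
      w * (P * Z′ D + ((1# - t) * q⁻¹) * (S zero * (u zero * (P * Z′ C))))
        ≈⟨ *-congˡ (+-congˡ (trans (*-congʳ q-inverse) (*-identityˡ _))) ⟩
      w * (P * Z′ D + S zero * (u zero * (P * Z′ C))) ∎

-- Degree vectors H a and their finite fibres

module Exponents {m : ℕ} where

  infixr 7 _·_
  _·_ : ∀ {n} → (Fin m → Fin n → ℕ) → Vec ℕ n → Vec ℕ m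
  H · a = tabulate (λ i → Vec.sum (tabulate (λ j → H i j ℕ.* lookup a j)))

  column : ∀ {n} → (Fin m → Fin n → ℕ) → Fin n → Vec ℕ m
  column H j = tabulate (λ i → H i j)

  tailColumns : ∀ {n} → (Fin m → Fin (suc n) → ℕ) → Fin m → Fin n → ℕ
  tailColumns H i j = H i (suc j)

  tabulate-⊕ : ∀ {k} (f g : Fin k → ℕ) → tabulate f ⊕ tabulate g ≡ tabulate (λ i → f i ℕ.+ g i)
  tabulate-⊕ {zero}  f g = ≡.refl
  tabulate-⊕ {suc k} f g = cong (f zero ℕ.+ g zero ∷_) (tabulate-⊕ (f ∘ suc) (g ∘ suc))

  tabulate-const : ∀ {k} (x : ℕ) → tabulate {n = k} (λ _ → x) ≡ Vec.replicate k x
  tabulate-const {zero}  x = ≡.refl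
  tabulate-const {suc k} x = cong (x ∷_) (tabulate-const x)

  ·-[] : ∀ (H : Fin m → Fin 0 → ℕ) → H · [] ≡ Vec.replicate m 0
  ·-[] H = tabulate-const 0

  ·-zero∷ : ∀ {n} (H : Fin m → Fin (suc n) → ℕ) a → H · (0 ∷ a) ≡ tailColumns H · a
  ·-zero∷ H a = Vec.tabulate-cong (λ i → cong (ℕ._+ Vec.sum (tabulate (λ j → H i (suc j) ℕ.* lookup a j))) (ℕ.*-zeroʳ (H i zero)))

  ·-sucHead : ∀ {n} (H : Fin m → Fin (suc n) → ℕ) a → H · sucHead a ≡ column H zero ⊕ H · a
  ·-sucHead H (e ∷ a) = ≡.trans
    (Vec.tabulate-cong (λ i → ≡.trans (cong (ℕ._+ Vec.sum (tabulate (λ j → H i (suc j) ℕ.* lookup a j))) (ℕ.*-suc (H i zero) e)) (ℕ.+-assoc (H i zero) _ _)))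
    (≡.sym (tabulate-⊕ (λ i → H i zero) _))

  -- All a with H · a ≡ β.  The first argument is fuel, to be larger than |β|.
  module _ where
    mutual
      solutions : ℕ → ∀ {n} → (Fin m → Fin n → ℕ) → Vec ℕ m → List (Vec ℕ n)
      solutions f       {zero}  H β with ≡-decℕ (Vec.replicate m 0) β
      ... | yes _ = [] ∷ []
      ... | no _  = []
      solutions zero    {suc n} H β = []
      solutions (suc f) {suc n} H β =
        List.map (0 ∷_) (solutions (suc f) (tailColumns H) β) ++
        increments f H (divides? (column H zero) β)

      increments : ℕ → ∀ {n} (H : Fin m → Fin (suc n) → ℕ) {β : Vec ℕ m} →
                   (∃ λ β′ → column H zero ⊕ β′ ≡ β) ⊎ (∀ β′ → column H zero ⊕ β′ ≢ β) → List (Vec ℕ (suc n))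
      increments f H (inj₁ (β′ , _)) = List.map sucHead (solutions f H β′)
      increments f H (inj₂ _)        = []

  -- Raising an entry of `a` then raises the sum of `H · a`, which makes all fibres finite and the
  -- fuel sufficient.
  PositiveColumns : ∀ {n} → (Fin m → Fin n → ℕ) → Set
  PositiveColumns H = ∀ j → 0 ℕ.< Vec.sum (column H j)

  quotient-smaller : ∀ {n} (H : Fin m → Fin (suc n) → ℕ) → PositiveColumns H → ∀ {β β′ f} →
    column H zero ⊕ β′ ≡ β → Vec.sum β ℕ.< suc f → Vec.sum β′ ℕ.< f
  quotient-smaller H pos {β′ = β′} ≡.refl (ℕ.s≤s l) = ℕ.≤-trans
    (ℕ.+-monoˡ-≤ (Vec.sum β′) (pos zero))
    (ℕ.≤-trans (ℕ.≤-reflexive (≡.sym (sum-⊕ (column H zero) β′))) l)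

  solutions-sound : ∀ f {n} (H : Fin m → Fin n → ℕ) β {a} → a ∈ solutions f H β → H · a ≡ β
  solutions-sound f {zero} H β a∈ with ≡-decℕ (Vec.replicate m 0) β
  solutions-sound f {zero} H β {[]} (here _) | yes p = ≡.trans (·-[] H) p
  solutions-sound (suc f) {suc n} H β a∈ with ∈-++⁻ (List.map (0 ∷_) (solutions (suc f) (tailColumns H) β)) a∈
  ... | inj₁ a∈₁ with ∈-map⁻ (0 ∷_) a∈₁
  ...   | b , b∈ , ≡.refl = ≡.trans (·-zero∷ H b) (solutions-sound (suc f) (tailColumns H) β b∈)
  solutions-sound (suc f) {suc n} H β a∈ | inj₂ a∈₂ with divides? (column H zero) β
  ... | inj₁ (β′ , p) with ∈-map⁻ sucHead a∈₂
  ...   | b , b∈ , ≡.refl = ≡.trans (·-sucHead H b) (≡.trans (cong (column H zero ⊕_) (solutions-sound f H β′ b∈)) p)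

  solutions-complete : ∀ f {n} (H : Fin m → Fin n → ℕ) → PositiveColumns H → ∀ β → Vec.sum β ℕ.< f →
                       ∀ a → H · a ≡ β → a ∈ solutions f H β
  solutions-complete f {zero} H pos β l [] p with ≡-decℕ (Vec.replicate m 0) β
  ... | yes _ = here ≡.refl
  ... | no ¬q = ⊥-elim (¬q (≡.trans (≡.sym (·-[] H)) p))
  solutions-complete (suc f) {suc n} H pos β l (zero ∷ a) p =
    ∈-++⁺ˡ (∈-map⁺ (0 ∷_) (solutions-complete (suc f) (tailColumns H) (pos ∘ suc) β l a
      (≡.trans (≡.sym (·-zero∷ H a)) p)))
  solutions-complete (suc f) {suc n} H pos β l (suc e ∷ a) p =
    ∈-++⁺ʳ (List.map (0 ∷_) (solutions (suc f) (tailColumns H) β)) (lemma (divides? (column H zero) β))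
    where
    q : column H zero ⊕ H · (e ∷ a) ≡ β
    q = ≡.trans (≡.sym (·-sucHead H (e ∷ a))) p
    lemma : ∀ d → (suc e ∷ a) ∈ increments f H d
    lemma (inj₂ ¬d)       = ⊥-elim (¬d _ q)
    lemma (inj₁ (β′ , r)) = ∈-map⁺ sucHead (solutions-complete f H pos β′ (quotient-smaller H pos r l) (e ∷ a)
      (⊕-cancelˡ (column H zero) (≡.trans q (≡.sym r))))

  solutions-unique : ∀ f {n} (H : Fin m → Fin n → ℕ) β → Unique (solutions f H β)
  solutions-unique f {zero} H β with ≡-decℕ (Vec.replicate m 0) β
  ... | yes _ = [] ∷ []
  ... | no _  = []
  solutions-unique zero    {suc n} H β = []
  solutions-unique (suc f) {suc n} H β =
    Unique.++⁺ (Unique.map⁺ Vec.∷-injectiveʳ (solutions-unique (suc f) (tailColumns H) β))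
               (lemma (divides? (column H zero) β))
               (λ (x , y) → disjoint (divides? (column H zero) β) x y)
    where
    lemma : ∀ d → Unique (increments f H d)
    lemma (inj₁ (β′ , _)) = Unique.map⁺ sucHead-injective (solutions-unique f H β′)
    lemma (inj₂ _)        = []
    disjoint : ∀ d {a} → a ∈ List.map (0 ∷_) (solutions (suc f) (tailColumns H) β) → a ∈ increments f H d → _
    disjoint (inj₁ (β′ , _)) x y with ∈-map⁻ (0 ∷_) x | ∈-map⁻ sucHead y
    ... | b , _ , ≡.refl | (_ ∷ _) , _ , ()

  -- Each coefficient of `gf` starts with the least sufficient fuel, while the recursion may arrive
  -- at a quotient with more left. Both must list the same solutions, in the same order.
  solutions-stable : ∀ f f′ {n} (H : Fin m → Fin n → ℕ) → PositiveColumns H → ∀ β →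
                     Vec.sum β ℕ.< f → Vec.sum β ℕ.< f′ → solutions f H β ≡ solutions f′ H β
  solutions-stable f f′ {zero} H pos β l l′ with ≡-decℕ (Vec.replicate m 0) β
  ... | yes _ = ≡.refl
  ... | no _  = ≡.refl
  solutions-stable (suc f) (suc f′) {suc n} H pos β l l′ = cong₂ _++_
    (cong (List.map (0 ∷_)) (solutions-stable (suc f) (suc f′) (tailColumns H) (pos ∘ suc) β l l′))
    (lemma (divides? (column H zero) β))
    where
    lemma : ∀ d → increments f H d ≡ increments f′ H d
    lemma (inj₁ (β′ , p)) = cong (List.map sucHead)
      (solutions-stable f f′ H pos β′ (quotient-smaller H pos p l) (quotient-smaller H pos p l′))
    lemma (inj₂ _)        = ≡.refl

-- Generating functions of trees and the right-hand side

module TreeSeries {m : ℕ} where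
  open Exponents {m}
  open PowerSeries (suc m) using (Series; monomial; inverse)
  open SeriesProperties using (seriesCommutativeRing)
  open CommutativeRing (seriesCommutativeRing (suc m)) hiding (Carrier; zero)
  open IntegerSolver (seriesCommutativeRing (suc m))
  open MonomialMultiplication
  open Inverse (suc m)

  t : Series
  t = PowerSeries.variableₛ (suc m) zero

  -- The sum of c(d, a) t^d s^(H a) over all d and a, collected by monomials.
  gf : ∀ {n} → (Fin m → Fin n → ℕ) → (ℕ → Vec ℕ n → ℕ) → Series
  gf H c (d ∷ β) = ℤ.+ ℕ.sum (List.map (c d) (solutions (suc (Vec.sum β)) H β))

  sum-map-+ : ∀ {A : Set} (f g : A → ℕ) xs →
    ℕ.sum (List.map (λ x → f x ℕ.+ g x) xs) ≡ ℕ.sum (List.map f xs) ℕ.+ ℕ.sum (List.map g xs)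
  sum-map-+ f g []       = ≡.refl
  sum-map-+ f g (x ∷ xs) = ≡.trans (cong (λ z → f x ℕ.+ g x ℕ.+ z) (sum-map-+ f g xs)) (interchange (f x) _ _ _)
    where open import Algebra.Properties.CommutativeSemigroup ℕ.+-commutativeSemigroup using (interchange)

  gf-cong : ∀ {n} (H : Fin m → Fin n → ℕ) {c c′} → (∀ d a → c d a ≡ c′ d a) → gf H c ≈ gf H c′
  gf-cong H p (d ∷ β) = cong ((λ z → ℤ.+ z) ∘ ℕ.sum) (List.map-cong (p d) (solutions (suc (Vec.sum β)) H β))

  gf-+ : ∀ {n} (H : Fin m → Fin n → ℕ) c c′ → gf H (λ d a → c d a ℕ.+ c′ d a) ≈ gf H c + gf H c′
  gf-+ H c c′ (d ∷ β) = cong (λ z → ℤ.+ z) (sum-map-+ (c d) (c′ d) (solutions (suc (Vec.sum β)) H β))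

  gf-t : ∀ {n} (H : Fin m → Fin n → ℕ) c → gf H (λ d a → shiftℕ (λ d′ → c d′ a) d) ≈ t * gf H c
  gf-t H c (zero ∷ β) = ≡.trans (cong (λ z → ℤ.+ z) (zeros (solutions (suc (Vec.sum β)) H β)))
    (≡.sym (monomial-*-∤ (1 ∷ Vec.replicate m 0) (gf H c) (zero ∷ β) λ { (_ ∷ _) () }))
    where
    zeros : ∀ {A : Set} (xs : List A) → ℕ.sum (List.map (λ _ → 0) xs) ≡ 0
    zeros []       = ≡.refl
    zeros (_ ∷ xs) = zeros xs
  gf-t H c (suc d ∷ β) = ≡.sym (≡.trans
    (cong (λ β′ → (t * gf H c) (suc d ∷ β′)) (≡.sym (⊕-identityˡ β)))
    (monomial-* (1 ∷ Vec.replicate m 0) (gf H c) (d ∷ β)))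

  module _ {n} (H : Fin m → Fin (suc n) → ℕ) (pos : PositiveColumns H) where

    -- Either the first entry of a is 0, or lowering it by one takes the first column of `H` out of
    -- the degree. Recursions for `c` in that entry thus become equations between series.
    gf-split : ∀ c → gf H c ≈ gf (tailColumns H) (λ d a → c d (0 ∷ a)) +
                              monomial (0 ∷ column H zero) * gf H (λ d a → c d (sucHead a))
    gf-split c (d ∷ β) = begin
      ℤ.+ ℕ.sum (List.map (c d) (List.map (0 ∷_) xs ++ increments f H (divides? (column H zero) β)))
        ≡⟨ cong ((λ z → ℤ.+ z) ∘ ℕ.sum) (List.map-++ (c d) (List.map (0 ∷_) xs) _) ⟩
      ℤ.+ ℕ.sum (List.map (c d) (List.map (0 ∷_) xs) ++ List.map (c d) (increments f H (divides? (column H zero) β)))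
        ≡⟨ cong (λ z → ℤ.+ z) (ℕ.sum-++ (List.map (c d) (List.map (0 ∷_) xs)) _) ⟩
      ℤ.+ ℕ.sum (List.map (c d) (List.map (0 ∷_) xs)) ℤ.+
      ℤ.+ ℕ.sum (List.map (c d) (increments f H (divides? (column H zero) β)))
        ≡⟨ cong₂ ℤ._+_ (cong ((λ z → ℤ.+ z) ∘ ℕ.sum) (≡.sym (List.map-∘ xs))) (lemma (divides? (column H zero) β)) ⟩
      _ ∎
      where
      open ≡.≡-Reasoning
      f = Vec.sum β
      xs = solutions (suc f) (tailColumns H) β
      c′ : ℕ → Vec ℕ (suc n) → ℕ
      c′ d a = c d (sucHead a)
      lemma : ∀ D → ℤ.+ ℕ.sum (List.map (c d) (increments f H D)) ≡
                    (monomial (0 ∷ column H zero) * gf H c′) (d ∷ β)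
      lemma (inj₁ (β′ , ≡.refl)) = begin
        ℤ.+ ℕ.sum (List.map (c d) (List.map sucHead (solutions f H β′)))
          ≡⟨ cong ((λ z → ℤ.+ z) ∘ ℕ.sum) (≡.sym (List.map-∘ (solutions f H β′))) ⟩
        ℤ.+ ℕ.sum (List.map (c′ d) (solutions f H β′))
          ≡⟨ cong ((λ z → ℤ.+ z) ∘ ℕ.sum ∘ List.map (c′ d)) (solutions-stable f (suc (Vec.sum β′)) H pos β′
               (quotient-smaller H pos {β} ≡.refl ℕ.≤-refl) ℕ.≤-refl) ⟩
        gf H c′ (d ∷ β′)
          ≡⟨ monomial-* (0 ∷ column H zero) (gf H c′) (d ∷ β′) ⟨
        _ ∎
      lemma (inj₂ ¬d) = ≡.sym (monomial-*-∤ (0 ∷ column H zero) (gf H c′) (d ∷ β) λ { (_ ∷ α) ≡.refl → ¬d α ≡.refl })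

  gf-leaf : ∀ (H : Fin m → Fin 0 → ℕ) → gf H (basisCount leaf) ≈ 1#
  gf-leaf H (zero ∷ β) with ≡-decℕ (Vec.replicate m 0) β
  ... | yes _ = ≡.refl
  ... | no _  = ≡.refl
  gf-leaf H (suc d ∷ β) with ≡-decℕ (Vec.replicate m 0) β
  ... | yes _ = ≡.refl
  ... | no _  = ≡.refl

  module _ where
    open TreeAlgebra (seriesCommutativeRing (suc m))
    open Relation.Binary.Reasoning.Setoid setoid

    rhs : ∀ {n} → (Fin n → Series) → Tree n → Series
    rhs S T = inverse (product (λ i → 1# - S i * t)) *
              Z̃ (rank T) (1# - t) (λ j → S j * (1# - t) * inverse (1# - S j))

    order-t : Order 1 t
    order-t = order-monomial (1 ∷ Vec.replicate m 0) (ℕ.s≤s ℕ.z≤n)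

    unipotent-product : ∀ {n} (f : Fin n → Series) → (∀ i → Unipotent (f i)) → Unipotent (product f)
    unipotent-product {zero}  f u = unipotent-1#
    unipotent-product {suc n} f u = unipotent-* (u zero) (unipotent-product (f ∘ suc) (u ∘ suc))

    inverse-* : ∀ {f g} → Unipotent f → Unipotent g → inverse (f * g) ≈ inverse f * inverse g
    inverse-* {f} {g} uf ug = begin
      inverse (f * g)       ≈⟨ *-identityʳ (inverse (f * g)) ⟨
      inverse (f * g) * 1#  ≈⟨ inverse-unique {f * g} {inverse f * inverse g} (unipotent-* uf ug) lemma ⟨
      inverse f * inverse g ∎
      where
      lemma : (f * g) * (inverse f * inverse g) ≈ 1#
      lemma = begin
        (f * g) * (inverse f * inverse g)
          ≈⟨ solve 4 (λ f g x y → (f :* g) :* (x :* y) := (f :* x) :* (g :* y)) refl f g (inverse f) (inverse g) ⟩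
        (f * inverse f) * (g * inverse g) ≈⟨ *-cong (inverseʳ uf) (inverseʳ ug) ⟩
        1# * 1#                           ≈⟨ *-identityˡ 1# ⟩
        1#                                ∎

    inverse-1# : inverse 1# ≈ 1#
    inverse-1# = begin
      inverse 1#       ≈⟨ *-identityˡ (inverse 1#) ⟨
      1# * inverse 1#  ≈⟨ inverseʳ unipotent-1# ⟩
      1#               ∎

    module _ {n} (S : Fin (suc n) → Series) (order-S : ∀ j → Order 1 (S j)) where
      private
        S₀ = S zero
        P  = inverse (product (λ i → 1# - S (suc i) * t))
        W  = inverse (1# - S₀ * t)
        q⁻¹ = inverse (1# - t)
        u : Fin (suc n) → Series
        u j = inverse (1# - S j)

      unipotent-1-St : ∀ j → Unipotent (1# - S j * t)
      unipotent-1-St j = unipotent-1- (order-*ʳ {S j} {t} (order-S j))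

      private
        inverse-product : inverse (product (λ i → 1# - S i * t)) ≈ W * P
        inverse-product = inverse-* (unipotent-1-St zero) (unipotent-product _ (unipotent-1-St ∘ suc))

      rhs-loop : ∀ T → rhs S (loop T) ≈ inverse (1# - S₀) * rhs (S ∘ suc) T
      rhs-loop T = trans (*-congʳ {Z (rank (loop T)) q⁻¹ (λ j → S j * (1# - t) * u j)} inverse-product)
        (Z-loop S t q⁻¹ u W P (inverseʳ (unipotent-1- (order-S zero))) (inverseʳ (unipotent-1-St zero))
          (inverseʳ (unipotent-1- order-t)) T)

      rhs-branch : ∀ D C → rhs S (branch D C) ≈
                   W * (rhs (S ∘ suc) D + S₀ * (inverse (1# - S₀) * rhs (S ∘ suc) C))
      rhs-branch D C = trans (*-congʳ {Z (rank (branch D C)) q⁻¹ (λ j → S j * (1# - t) * u j)} inverse-product)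
        (Z-branch S t q⁻¹ u W P (inverseʳ (unipotent-1- (order-S zero))) (inverseʳ (unipotent-1-St zero))
          (inverseʳ (unipotent-1- order-t)) D C)

    fixpoint : ∀ {s f g} → Unipotent (1# - s) → f ≈ g + s * f → f ≈ inverse (1# - s) * g
    fixpoint {s} {f} {g} u p = inverse-unique {1# - s} {f} {g} u (begin
      (1# - s) * f        ≈⟨ solve 2 (λ s f → (con ℤ.1ℤ :- s) :* f := f :- s :* f) refl s f ⟩
      f - s * f           ≈⟨ +-congʳ { - (s * f)} p ⟩
      g + s * f - s * f   ≈⟨ solve 2 (λ g x → g :+ x :- x := g) refl g (s * f) ⟩
      g                   ∎)

    -- The series `S` are only assumed equal to monomials because the theorem gives them as products
    -- of variables. At each node both sides satisfy the same equation, which `fixpoint` solves.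
    gf-tree : ∀ {n} (T : Tree n) (H : Fin m → Fin n → ℕ) → PositiveColumns H →
              (S : Fin n → Series) → (∀ j → S j ≈ monomial (0 ∷ column H j)) →
              gf H (basisCount T) ≈ rhs S T
    gf-tree leaf H pos S S≈ = begin
      gf H (basisCount leaf)  ≈⟨ gf-leaf H ⟩
      1#                      ≈⟨ *-identityˡ 1# ⟨
      1# * 1#                 ≈⟨ *-cong (sym inverse-1#) (sym (Z-leaf (inverse (1# - t)) (λ ()))) ⟩
      inverse 1# * Z (rank leaf) (inverse (1# - t)) (λ ()) ∎
    gf-tree {suc n} (loop T) H pos S S≈ = begin
      F                                           ≈⟨ fixpoint {S zero} {F} {F₀} (unipotent-1- (order-S zero)) eq ⟩
      inverse (1# - S zero) * F₀                  ≈⟨ *-congˡ {inverse (1# - S zero)} (gf-tree T (tailColumns H) (pos ∘ suc) (S ∘ suc) (S≈ ∘ suc)) ⟩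
      inverse (1# - S zero) * rhs (S ∘ suc) T     ≈⟨ rhs-loop S order-S T ⟨
      rhs S (loop T)                              ∎
      where
      order-S : ∀ j → Order 1 (S j)
      order-S j = order-resp {1} (sym (S≈ j)) (order-monomial (0 ∷ column H j) (pos j))
      F = gf H (basisCount (loop T))
      F₀ = gf (tailColumns H) (basisCount T)
      eq : F ≈ F₀ + S zero * F
      eq = begin
        F  ≈⟨ gf-split H pos (basisCount (loop T)) ⟩
        F₀ + monomial (0 ∷ column H zero) * gf H (λ d a → basisCount (loop T) d (sucHead a))
          ≈⟨ +-congˡ {F₀} (*-cong (sym (S≈ zero)) (gf-cong H λ { d (_ ∷ _) → ≡.refl })) ⟩
        F₀ + S zero * F ∎
    gf-tree {suc n} (branch D C) H pos S S≈ = begin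
      F ≈⟨ fixpoint {S zero * t} {F} {FD + S zero * G} (unipotent-1-St S order-S zero) eqF ⟩
      W * (FD + S zero * G)
        ≈⟨ *-congˡ {W} (+-congˡ {FD} (*-congˡ {S zero} (fixpoint {S zero} {G} {FC} (unipotent-1- (order-S zero)) eqG))) ⟩
      W * (FD + S zero * (inverse (1# - S zero) * FC))
        ≈⟨ *-congˡ {W} (+-cong (gf-tree D (tailColumns H) (pos ∘ suc) (S ∘ suc) (S≈ ∘ suc))
             (*-congˡ {S zero} (*-congˡ {inverse (1# - S zero)} (gf-tree C (tailColumns H) (pos ∘ suc) (S ∘ suc) (S≈ ∘ suc))))) ⟩
      W * (rhs (S ∘ suc) D + S zero * (inverse (1# - S zero) * rhs (S ∘ suc) C))
        ≈⟨ rhs-branch S order-S D C ⟨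
      rhs S (branch D C) ∎
      where
      order-S : ∀ j → Order 1 (S j)
      order-S j = order-resp {1} (sym (S≈ j)) (order-monomial (0 ∷ column H j) (pos j))
      -- The contraction does not see the first entry, so its series `G` satisfies the equation of a
      -- loop; this yields the factor 1/(1 - S).
      c : ℕ → Vec ℕ (suc n) → ℕ
      c d (_ ∷ a) = basisCount C d a
      b = basisCount (branch D C)
      F = gf H b
      G = gf H c
      FD = gf (tailColumns H) (basisCount D)
      FC = gf (tailColumns H) (basisCount C)
      W = inverse (1# - S zero * t)
      eqG : G ≈ FC + S zero * G
      eqG = begin
        G  ≈⟨ gf-split H pos c ⟩
        FC + monomial (0 ∷ column H zero) * gf H (λ d a → c d (sucHead a))
          ≈⟨ +-congˡ {FC} (*-cong (sym (S≈ zero)) (gf-cong H λ { d (_ ∷ _) → ≡.refl })) ⟩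
        FC + S zero * G ∎
      -- With a positive first entry the count is that of the contraction plus a count shifted in
      -- degree, so the second part of `gf-split` is S (G + t F).
      eqF : F ≈ FD + S zero * G + S zero * t * F
      eqF = begin
        F ≈⟨ gf-split H pos b ⟩
        FD + monomial (0 ∷ column H zero) * gf H (λ d a → b d (sucHead a))
          ≈⟨ +-congˡ {FD} (*-cong (sym (S≈ zero))
               (trans (gf-cong H λ { d (_ ∷ _) → ≡.refl })
               (trans (gf-+ H c (λ d a → shiftℕ (λ d′ → b d′ a) d)) (+-congˡ {G} (gf-t H b))))) ⟩
        FD + S zero * (G + t * F)
          ≈⟨ solve 5 (λ d s g t f → d :+ s :* (g :+ t :* f) := d :+ s :* g :+ s :* t :* f) refl FD (S zero) G t F ⟩
        FD + S zero * G + S zero * t * F ∎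

-- From generating functions to Hilbert series

module HilbertSeries {m : ℕ} where
  open Exponents {m}
  open TreeSeries {m}
  open PowerSeries (suc m) using (Series; monomial; IsSumOfMonomials; product; variableₛ)

  gf-isSumOfMonomials : ∀ {n} (H : Fin m → Fin n → ℕ) → PositiveColumns H → ∀ c →
    IsSumOfMonomials (λ (d , a) → c d a) (λ (d , a) → d ∷ H · a) (gf H c)
  gf-isSumOfMonomials H pos c (d ∷ β) = List.map (d ,_) as
    , Unique.map⁺ (λ { ≡.refl → ≡.refl }) (solutions-unique f H β)
    , (λ i → mk⇔ (to i) (from i))
    , cong (λ z → ℤ.+ ℕ.sum z) (List.map-∘ as)
    where
    f = suc (Vec.sum β)
    as = solutions f H β
    to : ∀ i → i ∈ List.map (d ,_) as → proj₁ i ∷ H · proj₂ i ≡ d ∷ β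
    to i i∈ with ∈-map⁻ (d ,_) i∈
    ... | a , a∈ , ≡.refl = cong (d ∷_) (solutions-sound f H β a∈)
    from : ∀ i → proj₁ i ∷ H · proj₂ i ≡ d ∷ β → i ∈ List.map (d ,_) as
    from (d′ , a) p with Vec.∷-injectiveˡ p
    ... | ≡.refl = ∈-map⁺ (d ,_) (solutions-complete f H pos β ℕ.≤-refl a (Vec.∷-injectiveʳ p))

  open CommutativeRing (SeriesProperties.seriesCommutativeRing (suc m)) hiding (zero)
  open Relation.Binary.Reasoning.Setoid setoid

  private
    unit : ∀ {k} → Fin k → Vec ℕ k
    unit {k} i = Vec.updateAt (Vec.replicate k 0) i suc

    exponent : ∀ {k l} → (Fin l → Fin k) → (Fin l → Bool) → Vec ℕ k
    exponent {k} {zero}  ι b = Vec.replicate k 0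
    exponent {k} {suc l} ι b = (if b zero then Vec.replicate k 0 else unit (ι zero)) ⊕ exponent (ι ∘ suc) (b ∘ suc)

    exponent-suc : ∀ {k l} (ι : Fin l → Fin k) b → exponent (λ i → Fin.suc (ι i)) b ≡ 0 ∷ exponent ι b
    exponent-suc {l = zero}  ι b = ≡.refl
    exponent-suc {l = suc l} ι b rewrite exponent-suc (ι ∘ suc) (b ∘ suc) with b zero
    ... | true  = ≡.refl
    ... | false = ≡.refl

    exponent-id : ∀ {k} (b : Fin k → Bool) → exponent id b ≡ tabulate (λ i → if b i then 0 else 1)
    exponent-id {zero}  b = ≡.refl
    exponent-id {suc k} b rewrite exponent-suc (λ (i : Fin k) → i) (b ∘ suc) with b zero
    ... | true  = cong (0 ∷_) (≡.trans (⊕-identityˡ _) (exponent-id (b ∘ suc)))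
    ... | false = cong (1 ∷_) (≡.trans (⊕-identityˡ _) (exponent-id (b ∘ suc)))

    -- The induction shortens the product but must keep the ambient variables, hence the map `ι`
    -- from factors to variables.
    product-exponent : ∀ {l} (ι : Fin l → Fin m) b →
      product (λ i → if b i then 1# else variableₛ (suc (ι i))) ≈ monomial (0 ∷ exponent ι b)
    product-exponent {zero}  ι b = refl
    product-exponent {suc l} ι b with b zero
    ... | true  = begin
      1# * product (λ i → if b (suc i) then 1# else variableₛ (suc (ι (suc i)))) ≈⟨ *-identityˡ _ ⟩
      product (λ i → if b (suc i) then 1# else variableₛ (suc (ι (suc i)))) ≈⟨ product-exponent (ι ∘ suc) (b ∘ suc) ⟩
      monomial (0 ∷ exponent (ι ∘ suc) (b ∘ suc)) ≡⟨ cong (λ z → monomial (0 ∷ z)) (⊕-identityˡ _) ⟨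
      monomial (0 ∷ (Vec.replicate m 0 ⊕ exponent (ι ∘ suc) (b ∘ suc))) ∎
    ... | false = begin
      variableₛ (suc (ι zero)) * product (λ i → if b (suc i) then 1# else variableₛ (suc (ι (suc i))))
        ≈⟨ *-congˡ {variableₛ (suc (ι zero))} (product-exponent (ι ∘ suc) (b ∘ suc)) ⟩
      variableₛ (suc (ι zero)) * monomial (0 ∷ exponent (ι ∘ suc) (b ∘ suc))
        ≈⟨ MonomialMultiplication.monomial-⊕ (0 ∷ unit (ι zero)) (0 ∷ exponent (ι ∘ suc) (b ∘ suc)) ⟩
      monomial (0 ∷ (unit (ι zero) ⊕ exponent (ι ∘ suc) (b ∘ suc))) ∎

  product-variables : ∀ (b : Fin m → Bool) →
    product (λ i → if b i then 1# else variableₛ (suc i)) ≈ monomial (0 ∷ tabulate (λ i → if b i then 0 else 1))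
  product-variables b = trans (product-exponent id b) (reflexive (cong (λ z → monomial (0 ∷ z)) (exponent-id b)))

-- Polynomial functions over a field of characteristic zero

record CharacteristicZeroField : Set₁ where
  field
    commutativeRing : CommutativeRing 0ℓ 0ℓ
  open CommutativeRing commutativeRing public
  open Algebra.Properties.Semiring.Mult semiring public using () renaming (_×_ to _×ₙ_)
  field
    _≟_        : ∀ x y → Dec (x ≈ y)
    invertible : ∀ x → ¬ x ≈ 0# → ∃ λ y → x * y ≈ 1#
    suc×1≉0    : ∀ n → ¬ suc n ×ₙ 1# ≈ 0#

module PolynomialFunctions (K : CharacteristicZeroField) where
  open CharacteristicZeroField K hiding (zero) public
  open IntegerSolver commutativeRing public
  open Algebra.Properties.Ring ring public using (-0#≈0#)
  open Algebra.Properties.Semiring.Mult semiring public using (×-homo-+)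
  open Relation.Binary.Reasoning.Setoid setoid public
  open RawSemiringDefinitions (RawRing.rawSemiring rawRing) public using (_^_)
  open RawMonoidDefinitions (CommutativeRing.+-rawMonoid commutativeRing) public using (sum)
  open Arrangements rawRing _≟_ public using () renaming (⟨_,_⟩ to infix 5 _∙_)

  cancelˡ : ∀ {x y} → ¬ x ≈ 0# → x * y ≈ 0# → y ≈ 0#
  cancelˡ {x} {y} x≉0 p with invertible x x≉0
  ... | x⁻¹ , q = begin
    y               ≈⟨ *-identityˡ y ⟨
    1# * y          ≈⟨ *-congʳ q ⟨
    x * x⁻¹ * y     ≈⟨ solve 3 (λ x i y → x :* i :* y := i :* (x :* y)) refl x x⁻¹ y ⟩
    x⁻¹ * (x * y)   ≈⟨ *-congˡ p ⟩
    x⁻¹ * 0#        ≈⟨ zeroʳ x⁻¹ ⟩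
    0#              ∎

  x-y≈0⇒x≈y : ∀ {x y} → x - y ≈ 0# → x ≈ y
  x-y≈0⇒x≈y {x} {y} p = begin
    x           ≈⟨ solve 2 (λ x y → x := x :- y :+ y) refl x y ⟩
    x - y + y   ≈⟨ +-congʳ p ⟩
    0# + y      ≈⟨ +-identityˡ y ⟩
    y           ∎

  x≈y⇒x-y≈0 : ∀ {x y} → x ≈ y → x - y ≈ 0#
  x≈y⇒x-y≈0 {x} {y} p = trans (+-congʳ p) (-‿inverseʳ y)

  -- Univariate polynomials

  horner : List Carrier → Carrier → Carrier
  horner []       x = 0#
  horner (c ∷ cs) x = c + x * horner cs x

  addP : List Carrier → List Carrier → List Carrier
  addP []       ds       = ds
  addP (c ∷ cs) []       = c ∷ cs
  addP (c ∷ cs) (d ∷ ds) = (c + d) ∷ addP cs ds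

  mulP : List Carrier → List Carrier → List Carrier
  mulP []       ds = []
  mulP (c ∷ cs) ds = addP (List.map (c *_) ds) (0# ∷ mulP cs ds)

  horner-add : ∀ cs ds x → horner (addP cs ds) x ≈ horner cs x + horner ds x
  horner-add []       ds       x = sym (+-identityˡ _)
  horner-add (c ∷ cs) []       x = sym (+-identityʳ _)
  horner-add (c ∷ cs) (d ∷ ds) x = trans (+-congˡ (*-congˡ (horner-add cs ds x)))
    (solve 5 (λ c d x y z → c :+ d :+ x :* (y :+ z) := c :+ x :* y :+ (d :+ x :* z)) refl c d x _ _)

  horner-scale : ∀ c ds x → horner (List.map (c *_) ds) x ≈ c * horner ds x
  horner-scale c []       x = sym (zeroʳ c)
  horner-scale c (d ∷ ds) x = trans (+-congˡ (*-congˡ (horner-scale c ds x)))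
    (solve 4 (λ c d x y → c :* d :+ x :* (c :* y) := c :* (d :+ x :* y)) refl c d x _)

  horner-mul : ∀ cs ds x → horner (mulP cs ds) x ≈ horner cs x * horner ds x
  horner-mul []       ds x = sym (zeroˡ _)
  horner-mul (c ∷ cs) ds x = begin
    horner (addP (List.map (c *_) ds) (0# ∷ mulP cs ds)) x   ≈⟨ horner-add (List.map (c *_) ds) _ x ⟩
    horner (List.map (c *_) ds) x + (0# + x * horner (mulP cs ds) x)
      ≈⟨ +-cong (horner-scale c ds x) (+-congˡ (*-congˡ (horner-mul cs ds x))) ⟩
    c * horner ds x + (0# + x * (horner cs x * horner ds x))
      ≈⟨ solve 4 (λ c d x y → c :* d :+ (𝟘 :+ x :* (y :* d)) := (c :+ x :* y) :* d) refl c _ x _ ⟩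
    (c + x * horner cs x) * horner ds x ∎

  horner-zero : ∀ {cs} → All (_≈ 0#) cs → ∀ x → horner cs x ≈ 0#
  horner-zero []       x = refl
  horner-zero (p ∷ ps) x = trans (+-cong p (trans (*-congˡ (horner-zero ps x)) (zeroʳ x))) (+-identityˡ 0#)

  -- Synthetic division by x - a, whose remainder is `horner cs a`.
  quotientP : List Carrier → Carrier → List Carrier
  quotientP []            a = []
  quotientP (c ∷ [])      a = []
  quotientP (c ∷ d ∷ cs)  a = horner (d ∷ cs) a ∷ quotientP (d ∷ cs) a

  length-quotientP : ∀ c cs a → List.length (quotientP (c ∷ cs) a) ≡ List.length cs
  length-quotientP c []       a = ≡.refl
  length-quotientP c (d ∷ cs) a = cong suc (length-quotientP d cs a)

  horner-quotientP : ∀ cs a x → horner cs x ≈ horner cs a + (x - a) * horner (quotientP cs a) x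
  horner-quotientP []           a x = sym (trans (+-identityˡ _) (zeroʳ _))
  horner-quotientP (c ∷ [])     a x =
    solve 3 (λ c a x → c :+ x :* 𝟘 := c :+ a :* 𝟘 :+ (x :- a) :* 𝟘) refl c a x
  horner-quotientP (c ∷ d ∷ cs) a x = trans (+-congˡ (*-congˡ (horner-quotientP (d ∷ cs) a x)))
    (solve 5 (λ c x a p q → c :+ x :* (p :+ (x :- a) :* q) := c :+ a :* p :+ (x :- a) :* (p :+ x :* q))
       refl c x a (horner (d ∷ cs) a) (horner (quotientP (d ∷ cs) a) x))

  quotientP-zero : ∀ cs a → All (_≈ 0#) (quotientP cs a) → horner cs a ≈ 0# → All (_≈ 0#) cs
  quotientP-zero []           a zs       p = []
  quotientP-zero (c ∷ [])     a zs       p = trans (solve 2 (λ c a → c := c :+ a :* 𝟘) refl c a) p ∷ []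
  quotientP-zero (c ∷ d ∷ cs) a (z ∷ zs) p =
    trans (sym (trans (+-congˡ (trans (*-congˡ z) (zeroʳ a))) (+-identityʳ c))) p ∷ quotientP-zero (d ∷ cs) a zs z

  Separated : (ℕ → Carrier) → Set
  Separated x = ∀ i j → i ℕ.< j → ¬ x j - x i ≈ 0#

  -- Dividing by x - `x 0` leaves a shorter list that vanishes at all later points. An infinite
  -- sequence of points saves comparing the number of roots with the degree.
  roots⇒zero : ∀ cs x → Separated x → (∀ i → horner cs (x i) ≈ 0#) → All (_≈ 0#) cs
  roots⇒zero cs = lemma (List.length cs) cs ≡.refl
    where
    lemma : ∀ n cs → List.length cs ≡ n → ∀ x → Separated x → (∀ i → horner cs (x i) ≈ 0#) → All (_≈ 0#) cs
    lemma n       []       e x s p = []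
    lemma (suc n) (c ∷ cs) e x s p = quotientP-zero (c ∷ cs) (x 0)
      (lemma n (quotientP (c ∷ cs) (x 0)) (≡.trans (length-quotientP c cs (x 0)) (ℕ.suc-injective e)) (x ∘ suc)
        (λ i j i<j → s (suc i) (suc j) (ℕ.s≤s i<j))
        λ i → cancelˡ (s 0 (suc i) (ℕ.s≤s ℕ.z≤n)) (begin
          (x (suc i) - x 0) * horner (quotientP (c ∷ cs) (x 0)) (x (suc i))         ≈⟨ +-identityˡ _ ⟨
          0# + (x (suc i) - x 0) * horner (quotientP (c ∷ cs) (x 0)) (x (suc i))    ≈⟨ +-congʳ (p 0) ⟨
          horner (c ∷ cs) (x 0) + (x (suc i) - x 0) * horner (quotientP (c ∷ cs) (x 0)) (x (suc i))
            ≈⟨ horner-quotientP (c ∷ cs) (x 0) (x (suc i)) ⟨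
          horner (c ∷ cs) (x (suc i))  ≈⟨ p (suc i) ⟩
          0# ∎))
      (p 0)

  ι : ℕ → Carrier
  ι n = n ×ₙ 1#

  ι-separated : Separated ι
  ι-separated i j i<j p with ℕ.m≤n⇒∃[o]m+o≡n i<j
  ... | d , ≡.refl = suc×1≉0 d (begin
    ι (suc d)                   ≈⟨ solve 2 (λ a b → b := a :+ b :- a) refl (ι i) (ι (suc d)) ⟩
    ι i + ι (suc d) - ι i       ≈⟨ +-congʳ (×-homo-+ 1# i (suc d)) ⟨
    ι (i ℕ.+ suc d) - ι i       ≡⟨ cong (λ z → ι z - ι i) (ℕ.+-suc i d) ⟩
    ι (suc i ℕ.+ d) - ι i       ≈⟨ p ⟩
    0#                          ∎)

  -- Starting from 1 leaves out the point `c` itself, at which the linear form in `cancel-linear` is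
  -- zero.
  translate-separated : ∀ c → Separated (λ i → c + ι (suc i))
  translate-separated c i j i<j p = ι-separated (suc i) (suc j) (ℕ.s≤s i<j)
    (trans (solve 3 (λ c a b → a :- b := c :+ a :- (c :+ b)) refl c (ι (suc j)) (ι (suc i))) p)

  -- Points and linear forms

  Point : ℕ → Set
  Point k = Fin k → Carrier

  infix 4 _≋_
  _≋_ : ∀ {k} → Point k → Point k → Set
  v ≋ w = ∀ i → v i ≈ w i

  infixl 6 _+[_]_
  -- The single operation through which linearity is expressed; it contains both addition and,
  -- starting from the origin, scaling.
  _+[_]_ : ∀ {k} → Point k → Carrier → Point k → Point k
  (v +[ c ] w) i = v i + c * w i

  +[]-cong : ∀ {k} {v v′ : Point k} {c c′ w w′} → v ≋ v′ → c ≈ c′ → w ≋ w′ → v +[ c ] w ≋ v′ +[ c′ ] w′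
  +[]-cong p q r i = +-cong (p i) (*-cong q (r i))

  sum-cong : ∀ {k} {f g : Fin k → Carrier} → (∀ i → f i ≈ g i) → sum f ≈ sum g
  sum-cong {zero}  p = refl
  sum-cong {suc k} p = +-cong (p zero) (sum-cong (p ∘ suc))

  sum-zero : ∀ {k} {f : Fin k → Carrier} → (∀ i → f i ≈ 0#) → sum f ≈ 0#
  sum-zero {zero}  p = refl
  sum-zero {suc k} p = trans (+-cong (p zero) (sum-zero (p ∘ suc))) (+-identityˡ 0#)

  sum-+* : ∀ {k} c (f g : Fin k → Carrier) → sum (λ i → f i + c * g i) ≈ sum f + c * sum g
  sum-+* {zero}  c f g = solve 1 (λ c → 𝟘 := 𝟘 :+ c :* 𝟘) refl c
  sum-+* {suc k} c f g = trans (+-congˡ (sum-+* c (f ∘ suc) (g ∘ suc)))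
    (solve 5 (λ a b c x y → a :+ c :* b :+ (x :+ c :* y) := a :+ x :+ c :* (b :+ y)) refl (f zero) (g zero) c _ _)

  sum-*ˡ : ∀ {k} c (f : Fin k → Carrier) → sum (λ i → c * f i) ≈ c * sum f
  sum-*ˡ {zero}  c f = sym (zeroʳ c)
  sum-*ˡ {suc k} c f = trans (+-congˡ (sum-*ˡ c (f ∘ suc))) (sym (distribˡ c _ _))

  ∙-cong : ∀ {k} {l l′ v v′ : Point k} → l ≋ l′ → v ≋ v′ → (l ∙ v) ≈ (l′ ∙ v′)
  ∙-cong p q = sum-cong (λ i → *-cong (p i) (q i))

  ∙-+[] : ∀ {k} (l v w : Point k) c → (l ∙ v +[ c ] w) ≈ (l ∙ v) + c * (l ∙ w)
  ∙-+[] l v w c = trans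
    (sum-cong (λ i → solve 4 (λ l v c w → l :* (v :+ c :* w) := l :* v :+ c :* (l :* w)) refl (l i) (v i) c (w i)))
    (sum-+* c (λ i → l i * v i) (λ i → l i * w i))

  ∙-comm : ∀ {k} (l v : Point k) → (l ∙ v) ≈ (v ∙ l)
  ∙-comm l v = sum-cong (λ i → *-comm (l i) (v i))

  -- Polynomial functions

  data IsPolynomial {k} : (Point k → Carrier) → Set where
    constant : ∀ c → IsPolynomial (λ _ → c)
    linear   : ∀ l → IsPolynomial (λ v → (l ∙ v))
    _⊞_      : ∀ {f g} → IsPolynomial f → IsPolynomial g → IsPolynomial (λ v → f v + g v)
    _⊠_      : ∀ {f g} → IsPolynomial f → IsPolynomial g → IsPolynomial (λ v → f v * g v)
    respects : ∀ {f g} → (∀ v → f v ≈ g v) → IsPolynomial f → IsPolynomial g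

  module _ {k : ℕ} where

    polynomial-cong : ∀ {f : Point k → Carrier} → IsPolynomial f → ∀ {v w} → v ≋ w → f v ≈ f w
    polynomial-cong (constant c)   p = refl
    polynomial-cong (linear l)     p = ∙-cong (λ _ → refl) p
    polynomial-cong (F ⊞ G)        p = +-cong (polynomial-cong F p) (polynomial-cong G p)
    polynomial-cong (F ⊠ G)        p = *-cong (polynomial-cong F p) (polynomial-cong G p)
    polynomial-cong (respects e F) p = trans (sym (e _)) (trans (polynomial-cong F p) (e _))

    along-line : ∀ {f : Point k → Carrier} → IsPolynomial f → ∀ v w →
                 ∃ λ cs → ∀ τ → f (v +[ τ ] w) ≈ horner cs τ
    along-line (constant c)   v w = c ∷ [] , λ τ → solve 2 (λ c τ → c := c :+ τ :* 𝟘) refl c τ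
    along-line (linear l)     v w = (l ∙ v) ∷ (l ∙ w) ∷ [] , λ τ → trans (∙-+[] l v w τ)
      (solve 3 (λ a b τ → a :+ τ :* b := a :+ τ :* (b :+ τ :* 𝟘)) refl (l ∙ v) (l ∙ w) τ)
    along-line (F ⊞ G)        v w with along-line F v w | along-line G v w
    ... | cs , p | ds , q = addP cs ds , λ τ → trans (+-cong (p τ) (q τ)) (sym (horner-add cs ds τ))
    along-line (F ⊠ G)        v w with along-line F v w | along-line G v w
    ... | cs , p | ds , q = mulP cs ds , λ τ → trans (*-cong (p τ) (q τ)) (sym (horner-mul cs ds τ))
    along-line (respects e F) v w with along-line F v w
    ... | cs , p = cs , λ τ → trans (sym (e _)) (p τ)

    -- On a line a polynomial function is given by one list of coefficients, to which `roots⇒zero`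
    -- applies.
    vanishing-on-line : ∀ {f : Point k → Carrier} → IsPolynomial f → ∀ v w x → Separated x →
                        (∀ i → f (v +[ x i ] w) ≈ 0#) → ∀ τ → f (v +[ τ ] w) ≈ 0#
    vanishing-on-line F v w x s p τ with along-line F v w
    ... | cs , q = trans (q τ) (horner-zero (roots⇒zero cs x s (λ i → trans (sym (q (x i))) (p i))) τ)

    polynomial-shift : ∀ {f : Point k → Carrier} → IsPolynomial f → ∀ c w → IsPolynomial (λ v → f (v +[ c ] w))
    polynomial-shift (constant a)   c w = constant a
    polynomial-shift (linear l)     c w = respects (λ v → sym (∙-+[] l v w c)) (linear l ⊞ constant (c * (l ∙ w)))
    polynomial-shift (F ⊞ G)        c w = polynomial-shift F c w ⊞ polynomial-shift G c w
    polynomial-shift (F ⊠ G)        c w = polynomial-shift F c w ⊠ polynomial-shift G c w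
    polynomial-shift (respects e F) c w = respects (λ v → e _) (polynomial-shift F c w)

    infixl 6 _⊟_
    _⊟_ : ∀ {f g : Point k → Carrier} → IsPolynomial f → IsPolynomial g → IsPolynomial (λ v → f v - g v)
    _⊟_ {f} {g} F G = respects
      (λ v → solve 2 (λ x y → x :+ :- 𝟙 :* y := x :- y) refl (f v) (g v)) (F ⊞ (constant (- 1#) ⊠ G))

    -- The projection onto the kernel of `l` along `w`, whenever `l ∙ w` is 1.
    project : (l w v : Point k) → Point k
    project l w v = v +[ - (l ∙ v) ] w

    polynomial-project : ∀ {f : Point k → Carrier} → IsPolynomial f → ∀ l w → IsPolynomial (f ∘ project l w)
    polynomial-project (constant a)   l w = constant a
    polynomial-project (linear l′)    l w = respects
      (λ v → trans (solve 3 (λ x y z → x :+ (:- y) :* z := x :+ (:- z) :* y) refl (l′ ∙ v) (l′ ∙ w) (l ∙ v))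
                    (sym (∙-+[] l′ v w (- (l ∙ v)))))
      (linear l′ ⊞ (constant (- (l′ ∙ w)) ⊠ linear l))
    polynomial-project (F ⊞ G)        l w = polynomial-project F l w ⊞ polynomial-project G l w
    polynomial-project (F ⊠ G)        l w = polynomial-project F l w ⊠ polynomial-project G l w
    polynomial-project (respects e F) l w = respects (λ v → e _) (polynomial-project F l w)

    -- Division by a linear form: the product rule for difference quotients makes
    -- f - f ∘ project l w divisible by l for every polynomial function f.
    divide : ∀ {f : Point k → Carrier} → IsPolynomial f → ∀ l w →
             ∃ λ q → IsPolynomial q × (∀ v → f v ≈ f (project l w v) + (l ∙ v) * q v)
    divide (constant c) l w = (λ _ → 0#) , constant 0# , λ v → solve 2 (λ c x → c := c :+ x :* 𝟘) refl c (l ∙ v)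
    divide (linear l′)  l w = (λ _ → (l′ ∙ w)) , constant _ , λ v → begin
      (l′ ∙ v)
        ≈⟨ solve 3 (λ x y z → x := x :+ (:- y) :* z :+ y :* z) refl (l′ ∙ v) (l ∙ v) (l′ ∙ w) ⟩
      (l′ ∙ v) + - (l ∙ v) * (l′ ∙ w) + (l ∙ v) * (l′ ∙ w)
        ≈⟨ +-congʳ (∙-+[] l′ v w (- (l ∙ v))) ⟨
      (l′ ∙ project l w v) + (l ∙ v) * (l′ ∙ w) ∎
    divide (_⊞_ {f} {g} F G) l w with divide F l w | divide G l w
    ... | q , Q , p | q′ , Q′ , p′ = (λ v → q v + q′ v) , Q ⊞ Q′ , λ v → trans (+-cong (p v) (p′ v))
      (solve 5 (λ a b x y z → a :+ x :* y :+ (b :+ x :* z) := a :+ b :+ x :* (y :+ z))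
        refl (f (project l w v)) (g (project l w v)) (l ∙ v) (q v) (q′ v))
    divide (_⊠_ {g} {h} F G) l w with divide F l w | divide G l w
    ... | q , Q , p | q′ , Q′ , p′ =
      (λ v → g v * q′ v + q v * h (project l w v)) , (F ⊠ Q′) ⊞ (Q ⊠ polynomial-project G l w) , λ v → begin
        g v * h v
          ≈⟨ *-congˡ (p′ v) ⟩
        g v * (h (project l w v) + (l ∙ v) * q′ v)
          ≈⟨ solve 4 (λ g h x q → g :* (h :+ x :* q) := g :* h :+ x :* (g :* q)) refl (g v) (h (project l w v)) (l ∙ v) (q′ v) ⟩
        g v * h (project l w v) + (l ∙ v) * (g v * q′ v)
          ≈⟨ +-congʳ (*-congʳ (p v)) ⟩
        (g (project l w v) + (l ∙ v) * q v) * h (project l w v) + (l ∙ v) * (g v * q′ v)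
          ≈⟨ solve 5 (λ g x q h z → (g :+ x :* q) :* h :+ x :* z := g :* h :+ x :* (z :+ q :* h))
               refl (g (project l w v)) (l ∙ v) (q v) (h (project l w v)) (g v * q′ v) ⟩
        g (project l w v) * h (project l w v) + (l ∙ v) * (g v * q′ v + q v * h (project l w v)) ∎
    divide (respects e F) l w with divide F l w
    ... | q , Q , p = q , Q , λ v → trans (sym (e v)) (trans (p v) (+-congʳ (e _)))

-- Subspaces as images of projectors, and degrees along directions

module Subspaces (K : CharacteristicZeroField) where
  open PolynomialFunctions K public

  origin : ∀ {k} → Point k
  origin _ = 0#

  cons : ∀ {k} → Carrier → Point k → Point (suc k)
  cons x v zero    = x
  cons x v (suc i) = v i

  unit : ∀ {k} → Fin k → Point k
  unit zero    = cons 1# origin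
  unit (suc i) = cons 0# (unit i)

  linear-expansion : ∀ {k} (F : Point k → Carrier) → (∀ {v w} → v ≋ w → F v ≈ F w) →
    (∀ v c w → F (v +[ c ] w) ≈ F v + c * F w) → ∀ v → F v ≈ sum (λ i → v i * F (unit i))
  linear-expansion {zero} F F-cong F-linear v = begin
    -- In dimension 0 any two points agree, so `v` may be replaced by v - v.
    F v                 ≈⟨ F-cong (λ ()) ⟩
    F (v +[ - 1# ] v)   ≈⟨ F-linear v (- 1#) v ⟩
    F v + - 1# * F v    ≈⟨ solve 1 (λ x → x :+ :- 𝟙 :* x := 𝟘) refl (F v) ⟩
    0#                  ∎
  linear-expansion {suc k} F F-cong F-linear v = begin
    F v
      ≈⟨ F-cong (λ { zero → solve 1 (λ x → x := 𝟘 :+ x :* 𝟙) refl (v zero)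
                   ; (suc i) → solve 2 (λ x y → y := y :+ x :* 𝟘) refl (v zero) (v (suc i)) }) ⟩
    F (cons 0# (v ∘ suc) +[ v zero ] unit zero)
      ≈⟨ F-linear _ (v zero) _ ⟩
    F (cons 0# (v ∘ suc)) + v zero * F (unit zero)
      ≈⟨ +-congʳ (linear-expansion (F ∘ cons 0#) (λ p → F-cong λ { zero → refl ; (suc i) → p i })
           (λ v c w → trans (F-cong λ { zero → solve 1 (λ c → 𝟘 := 𝟘 :+ c :* 𝟘) refl c ; (suc i) → refl })
                            (F-linear (cons 0# v) c (cons 0# w))) (v ∘ suc)) ⟩
    sum (λ i → v (suc i) * F (unit (suc i))) + v zero * F (unit zero)
      ≈⟨ +-comm _ _ ⟩
    v zero * F (unit zero) + sum (λ i → v (suc i) * F (unit (suc i))) ∎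

  -- A subspace is represented by an idempotent linear map onto it. Intersecting with a kernel is
  -- then an explicit formula, and no basis has to be carried along.
  record Projector (k : ℕ) : Set where
    no-eta-equality
    field
      π        : Point k → Point k
      π-cong   : ∀ {v w} → v ≋ w → π v ≋ π w
      π-linear : ∀ v c w → π (v +[ c ] w) ≋ π v +[ c ] π w
      π-idem   : ∀ v → π (π v) ≋ π v

  open Projector

  infix 4 _∈ᴾ_
  record _∈ᴾ_ {k} (v : Point k) (P : Projector k) : Set where
    constructor fixed
    field
      image : π P v ≋ v

  open _∈ᴾ_

  identity : ∀ {k} → Projector k
  π        identity = λ v → v
  π-cong   identity = λ p → p
  π-linear identity = λ v c w i → refl
  π-idem   identity = λ v i → refl

  module _ {k} (P : Projector k) where

    ∈ᴾ-+[] : ∀ {v w} c → v ∈ᴾ P → w ∈ᴾ P → (v +[ c ] w) ∈ᴾ P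
    ∈ᴾ-+[] {v} {w} c (fixed p) (fixed q) = fixed λ i → trans (π-linear P v c w i) (+[]-cong p refl q i)

    ∈ᴾ-resp : ∀ {v w} → v ≋ w → v ∈ᴾ P → w ∈ᴾ P
    ∈ᴾ-resp p (fixed q) = fixed λ i → trans (sym (π-cong P p i)) (trans (q i) (p i))

    ∈ᴾ-origin : origin ∈ᴾ P
    ∈ᴾ-origin = fixed λ i → begin
      π P origin i
        ≈⟨ π-cong P (λ j → solve 1 (λ x → 𝟘 := 𝟘 :+ x :* 𝟘) refl (- 1#)) i ⟩
      π P (origin +[ - 1# ] origin) i
        ≈⟨ π-linear P origin (- 1#) origin i ⟩
      π P origin i + - 1# * π P origin i
        ≈⟨ solve 1 (λ x → x :+ :- 𝟙 :* x := 𝟘) refl (π P origin i) ⟩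
      0# ∎

    -- Because `w` lies in the subspace, projecting along it does not leave the subspace; the
    -- composite projects onto the intersection with the kernel of `l`.
    restrict : (l w : Point k) → w ∈ᴾ P → (l ∙ w) ≈ 1# → Projector k
    π        (restrict l w w∈P lw≈1) = λ v → project l w (π P v)
    π-cong   (restrict l w w∈P lw≈1) = λ p → +[]-cong (π-cong P p) (-‿cong (∙-cong (λ _ → refl) (π-cong P p))) (λ _ → refl)
    π-linear (restrict l w w∈P lw≈1) = λ u c v i → begin
          π P (u +[ c ] v) i + - (l ∙ π P (u +[ c ] v)) * w i
            ≈⟨ +[]-cong {w = w} {w} (π-linear P u c v)
                 (-‿cong (trans (∙-cong (λ _ → refl) (π-linear P u c v)) (∙-+[] l (π P u) (π P v) c))) (λ _ → refl) i ⟩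
          (π P u i + c * π P v i) + - ((l ∙ π P u) + c * (l ∙ π P v)) * w i
            ≈⟨ solve 6 (λ a c b x y w → (a :+ c :* b) :+ (:- (x :+ c :* y)) :* w := (a :+ (:- x) :* w) :+ c :* (b :+ (:- y) :* w))
                 refl (π P u i) c (π P v i) (l ∙ π P u) (l ∙ π P v) (w i) ⟩
          (π P u i + - (l ∙ π P u) * w i) + c * (π P v i + - (l ∙ π P v) * w i) ∎
    π-idem   (restrict l w w∈P lw≈1) = λ v i → let u = π P v ; x = (l ∙ u) in begin
          π P (project l w u) i + - (l ∙ π P (project l w u)) * w i
            ≈⟨ +[]-cong {w = w} {w} (stable v) (-‿cong (trans (∙-cong (λ _ → refl) (stable v)) (killed u))) (λ _ → refl) i ⟩
          project l w u i + - 0# * w i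
            ≈⟨ solve 2 (λ x w → x :+ (:- 𝟘) :* w := x) refl (project l w u i) (w i) ⟩
          project l w u i ∎
      where
      killed : ∀ u → (l ∙ project l w u) ≈ 0#
      killed u = begin
        (l ∙ project l w u)                ≈⟨ ∙-+[] l u w (- (l ∙ u)) ⟩
        (l ∙ u) + - (l ∙ u) * (l ∙ w)   ≈⟨ +-congˡ (*-congˡ lw≈1) ⟩
        (l ∙ u) + - (l ∙ u) * 1#          ≈⟨ solve 1 (λ x → x :+ (:- x) :* 𝟙 := 𝟘) refl (l ∙ u) ⟩
        0# ∎
      stable : ∀ v → π P (project l w (π P v)) ≋ project l w (π P v)
      stable v = image (∈ᴾ-+[] _ (fixed (π-idem P v)) w∈P)

    module _ {l w : Point k} {w∈P : w ∈ᴾ P} {lw≈1 : (l ∙ w) ≈ 1#} where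

      ∈-restrict⁺ : ∀ {v} → v ∈ᴾ P → (l ∙ v) ≈ 0# → v ∈ᴾ restrict l w w∈P lw≈1
      ∈-restrict⁺ {v} (fixed v∈P) lv≈0 = fixed λ i → begin
        π P v i + - (l ∙ π P v) * w i
          ≈⟨ +[]-cong {w = w} {w} v∈P (-‿cong (trans (∙-cong (λ _ → refl) v∈P) lv≈0)) (λ _ → refl) i ⟩
        v i + - 0# * w i   ≈⟨ solve 2 (λ x w → x :+ (:- 𝟘) :* w := x) refl (v i) (w i) ⟩
        v i                ∎

      project-∈-restrict : ∀ {v} → v ∈ᴾ P → project l w v ∈ᴾ restrict l w w∈P lw≈1
      project-∈-restrict {v} v∈P = ∈-restrict⁺ (∈ᴾ-+[] _ v∈P w∈P) (begin
        (l ∙ project l w v)                ≈⟨ ∙-+[] l v w (- (l ∙ v)) ⟩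
        (l ∙ v) + - (l ∙ v) * (l ∙ w)   ≈⟨ +-congˡ (*-congˡ lw≈1) ⟩
        (l ∙ v) + - (l ∙ v) * 1#          ≈⟨ solve 1 (λ x → x :+ (:- x) :* 𝟙 := 𝟘) refl (l ∙ v) ⟩
        0# ∎)

      ∈-restrict⁻₁ : ∀ {v} → v ∈ᴾ restrict l w w∈P lw≈1 → v ∈ᴾ P
      ∈-restrict⁻₁ {v} (fixed p) = ∈ᴾ-resp p (∈ᴾ-+[] _ (fixed (π-idem P v)) w∈P)

      ∈-restrict⁻₂ : ∀ {v} → v ∈ᴾ restrict l w w∈P lw≈1 → (l ∙ v) ≈ 0#
      ∈-restrict⁻₂ {v} (fixed p) = begin
        (l ∙ v)                           ≈⟨ ∙-cong (λ _ → refl) p ⟨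
        (l ∙ project l w (π P v))         ≈⟨ ∙-+[] l (π P v) w (- (l ∙ π P v)) ⟩
        (l ∙ π P v) + - (l ∙ π P v) * (l ∙ w)   ≈⟨ +-congˡ (*-congˡ lw≈1) ⟩
        (l ∙ π P v) + - (l ∙ π P v) * 1#  ≈⟨ solve 1 (λ x → x :+ (:- x) :* 𝟙 := 𝟘) refl (l ∙ π P v) ⟩
        0# ∎

    -- The images of the unit vectors span the subspace, so finitely many values of `l` decide; one
    -- that is not zero is scaled to 1.
    vanishes? : ∀ l → (∀ v → v ∈ᴾ P → (l ∙ v) ≈ 0#) ⊎ (∃ λ w → w ∈ᴾ P × (l ∙ w) ≈ 1#)
    vanishes? l with Fin.all? (λ i → (l ∙ π P (unit i)) ≟ 0#)
    ... | yes p = inj₁ λ { v (fixed v∈P) → begin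
      (l ∙ v)       ≈⟨ ∙-cong (λ _ → refl) v∈P ⟨
      (l ∙ π P v)
        ≈⟨ linear-expansion (λ v → (l ∙ π P v)) (λ q → ∙-cong (λ _ → refl) (π-cong P q))
             (λ v c w → trans (∙-cong (λ _ → refl) (π-linear P v c w)) (∙-+[] l (π P v) (π P w) c)) v ⟩
      sum (λ i → v i * (l ∙ π P (unit i)))
        ≈⟨ sum-zero (λ i → trans (*-congˡ (p i)) (zeroʳ (v i))) ⟩
      0# ∎ }
    ... | no ¬p with Fin.¬∀⟶∃¬ k _ (λ i → (l ∙ π P (unit i)) ≟ 0#) ¬p
    ...   | i , q with invertible _ q
    ...     | x , r = inj₂ (origin +[ x ] π P (unit i) , ∈ᴾ-+[] x ∈ᴾ-origin (fixed (π-idem P (unit i))) , (begin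
      (l ∙ origin +[ x ] π P (unit i))             ≈⟨ ∙-+[] l origin (π P (unit i)) x ⟩
      (l ∙ origin) + x * (l ∙ π P (unit i))      ≈⟨ +-cong (sum-zero (λ j → zeroʳ (l j))) (trans (*-comm _ _) r) ⟩
      0# + 1#                                        ≈⟨ +-identityˡ 1# ⟩
      1#                                             ∎))

    -- Where `l` is zero nothing can be cancelled pointwise. On the line through `v` in the
    -- direction `w`, however, `l` has a single zero, so `X` vanishes at infinitely many points and
    -- hence on the whole line.
    cancel-linear : ∀ {X : Point k → Carrier} → IsPolynomial X → ∀ {l w} → w ∈ᴾ P → (l ∙ w) ≈ 1# →
                    (∀ v → v ∈ᴾ P → (l ∙ v) * X v ≈ 0#) → ∀ v → v ∈ᴾ P → X v ≈ 0#
    cancel-linear {X} X-poly {l} {w} w∈P lw≈1 p v v∈P = begin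
      X v              ≈⟨ polynomial-cong X-poly (λ i → solve 2 (λ v w → v := v :+ 𝟘 :* w) refl (v i) (w i)) ⟩
      X (v +[ 0# ] w)
        ≈⟨ vanishing-on-line X-poly v w (λ i → - (l ∙ v) + ι (suc i)) (translate-separated _)
             (λ i → cancelˡ (suc×1≉0 i) (begin
               ι (suc i) * X (v +[ - (l ∙ v) + ι (suc i) ] w)
                 ≈⟨ *-congʳ (begin
                      ι (suc i)
                        ≈⟨ solve 2 (λ x n → n := x :+ (:- x :+ n) :* 𝟙) refl (l ∙ v) (ι (suc i)) ⟩
                      (l ∙ v) + (- (l ∙ v) + ι (suc i)) * 1#
                        ≈⟨ +-congˡ (*-congˡ lw≈1) ⟨
                      (l ∙ v) + (- (l ∙ v) + ι (suc i)) * (l ∙ w)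
                        ≈⟨ ∙-+[] l v w _ ⟨
                      (l ∙ v +[ - (l ∙ v) + ι (suc i) ] w) ∎) ⟩
               (l ∙ v +[ - (l ∙ v) + ι (suc i) ] w) * X (v +[ - (l ∙ v) + ι (suc i) ] w)
                 ≈⟨ p _ (∈ᴾ-+[] _ v∈P w∈P) ⟩
               0# ∎)) 0# ⟩
      0# ∎

  -- Finite differences.  In characteristic zero, Degree< P h N f says that f has
  -- degree less than N in the direction h on the subspace P.
  module _ {k : ℕ} where

    Δ : Point k → (Point k → Carrier) → Point k → Carrier
    Δ h f v = f (v +[ 1# ] h) - f v

    Δ^ : ℕ → Point k → (Point k → Carrier) → Point k → Carrier
    Δ^ zero    h f = f
    Δ^ (suc N) h f = Δ^ N h (Δ h f)

    Δ^-cong : ∀ N h {f g : Point k → Carrier} → (∀ v → f v ≈ g v) → ∀ v → Δ^ N h f v ≈ Δ^ N h g v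
    Δ^-cong zero    h p v = p v
    Δ^-cong (suc N) h p v = Δ^-cong N h (λ u → +-cong (p _) (-‿cong (p u))) v

    Δ^-shift : ∀ N h (f : Point k → Carrier) v → Δ^ N h (λ u → f (u +[ 1# ] h)) v ≡ Δ^ N h f (v +[ 1# ] h)
    Δ^-shift zero    h f v = ≡.refl
    Δ^-shift (suc N) h f v = Δ^-shift N h (Δ h f) v

    Δ^-+* : ∀ N h (f g : Point k → Carrier) c v →
            Δ^ N h (λ u → f u + c * g u) v ≈ Δ^ N h f v + c * Δ^ N h g v
    Δ^-+* zero    h f g c v = refl
    Δ^-+* (suc N) h f g c v = trans
      (Δ^-cong N h (λ u → solve 5 (λ a b c x y → a :+ c :* b :- (x :+ c :* y) := a :- x :+ c :* (b :- y))
        refl (f (u +[ 1# ] h)) (g (u +[ 1# ] h)) c (f u) (g u)) v)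
      (Δ^-+* N h (Δ h f) (Δ h g) c v)

    Δ^-poly : ∀ N h {f : Point k → Carrier} → IsPolynomial f → IsPolynomial (Δ^ N h f)
    Δ^-poly zero    h F = F
    Δ^-poly (suc N) h F = Δ^-poly N h (polynomial-shift F 1# h ⊟ F)

    -- Leibniz rule: second differences of a linear factor vanish, so only two terms remain. The
    -- factor `ι (suc N)` is the one that must be cancelled in `degree-quotient`.
    Δ^-linear-* : ∀ N l h (q : Point k → Carrier) v → Δ^ (suc N) h (λ u → (l ∙ u) * q u) v ≈
                  (l ∙ v) * Δ^ (suc N) h q v + ι (suc N) * (l ∙ h) * Δ^ N h q (v +[ 1# ] h)
    Δ^-linear-* zero l h q v = trans (+-congʳ (*-congʳ (∙-+[] l v h 1#)))
      (solve 4 (λ x y a b → (x :+ 𝟙 :* y) :* a :- x :* b := x :* (a :- b) :+ (𝟙 :+ 𝟘) :* y :* a)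
        refl (l ∙ v) (l ∙ h) (q (v +[ 1# ] h)) (q v))
    Δ^-linear-* (suc N) l h q v = begin
      Δ^ (suc N) h (Δ h (λ u → (l ∙ u) * q u)) v
        ≈⟨ Δ^-cong (suc N) h (λ u → trans (+-congʳ (*-congʳ (∙-+[] l u h 1#)))
             (solve 4 (λ x y a b → (x :+ 𝟙 :* y) :* a :- x :* b := x :* (a :- b) :+ y :* a)
               refl (l ∙ u) (l ∙ h) (q (u +[ 1# ] h)) (q u))) v ⟩
      Δ^ (suc N) h (λ u → (l ∙ u) * Δ h q u + (l ∙ h) * q (u +[ 1# ] h)) v
        ≈⟨ Δ^-+* (suc N) h (λ u → (l ∙ u) * Δ h q u) (λ u → q (u +[ 1# ] h)) (l ∙ h) v ⟩
      Δ^ (suc N) h (λ u → (l ∙ u) * Δ h q u) v + (l ∙ h) * Δ^ (suc N) h (λ u → q (u +[ 1# ] h)) v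
        ≈⟨ +-cong (Δ^-linear-* N l h (Δ h q) v) (*-congˡ (reflexive (Δ^-shift (suc N) h q v))) ⟩
      (l ∙ v) * X + ι (suc N) * (l ∙ h) * Y + (l ∙ h) * Y
        ≈⟨ solve 5 (λ x X n y Y → x :* X :+ n :* y :* Y :+ y :* Y := x :* X :+ (𝟙 :+ n) :* y :* Y)
             refl (l ∙ v) X (ι (suc N)) (l ∙ h) Y ⟩
      (l ∙ v) * X + ι (suc (suc N)) * (l ∙ h) * Y ∎
      where
      X = Δ^ (suc (suc N)) h q v
      Y = Δ^ (suc N) h q (v +[ 1# ] h)

    record Degree< (P : Projector k) (h : Point k) (N : ℕ) (f : Point k → Carrier) : Set where
      constructor degree<
      field
        Δ^≈0 : ∀ v → v ∈ᴾ P → Δ^ N h f v ≈ 0#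

    open Degree< public

    raise : ∀ {P h N f} → Degree< P h N (Δ h f) → Degree< P h (suc N) f
    raise (degree< d) = degree< d

    lower : ∀ {P h N f} → Degree< P h (suc N) f → Degree< P h N (Δ h f)
    lower (degree< d) = degree< d

  module _ {k} {P : Projector k} {h : Point k} (h∈P : h ∈ᴾ P) where
    private
      D : ℕ → (Point k → Carrier) → Set
      D = Degree< P h

    shift-∈ : ∀ {v} → v ∈ᴾ P → (v +[ 1# ] h) ∈ᴾ P
    shift-∈ v∈P = ∈ᴾ-+[] P 1# v∈P h∈P

    degree-resp : ∀ {N f g} → (∀ v → v ∈ᴾ P → f v ≈ g v) → D N f → D N g
    degree-resp {zero}  p (degree< d) = degree< λ v v∈P → trans (sym (p v v∈P)) (d v v∈P)
    degree-resp {suc N} p d = raise (degree-resp (λ v v∈P → +-cong (p _ (shift-∈ v∈P)) (-‿cong (p v v∈P))) (lower d))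

    degree-zero : ∀ N {f} → (∀ v → v ∈ᴾ P → f v ≈ 0#) → D N f
    degree-zero zero    p = degree< p
    degree-zero (suc N) p =
      raise (degree-zero N λ v v∈P → trans (+-cong (p _ (shift-∈ v∈P)) (-‿cong (p v v∈P))) (-‿inverseʳ 0#))

    degree-mono : ∀ {M N f} → M ℕ.≤ N → D M f → D N f
    degree-mono {N = N} ℕ.z≤n     (degree< d) = degree-zero N d
    degree-mono         (ℕ.s≤s l) d           = raise (degree-mono l (lower d))

    degree-+* : ∀ {N f g} c → D N f → D N g → D N (λ v → f v + c * g v)
    degree-+* {N} {f} {g} c (degree< d) (degree< e) = degree< λ v v∈P → trans (Δ^-+* N h f g c v)
      (trans (+-cong (d v v∈P) (trans (*-congˡ (e v v∈P)) (zeroʳ c))) (+-identityˡ 0#))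

    degree-shift : ∀ {N f} → D N f → D N (λ v → f (v +[ 1# ] h))
    degree-shift {N} {f} (degree< d) = degree< λ v v∈P → trans (reflexive (Δ^-shift N h f v)) (d _ (shift-∈ v∈P))

    -- Strict bounds M and N mean degrees at most M - 1 and N - 1, hence `pred` of the sum. The
    -- induction uses that the difference of f g is the difference of f times the shifted g, plus f
    -- times the difference of g.
    degree-* : ∀ {M N f g} → D M f → D N g → D (ℕ.pred (M ℕ.+ N)) (λ v → f v * g v)
    degree-* {zero}  {N}     (degree< d) e = degree-zero (ℕ.pred N) λ v v∈P → trans (*-congʳ (d v v∈P)) (zeroˡ _)
    degree-* {suc M} {zero}  d (degree< e) = degree-zero (M ℕ.+ 0) λ v v∈P → trans (*-congˡ (e v v∈P)) (zeroʳ _)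
    degree-* {suc M} {suc N} {f} {g} d e = subst (λ z → D z (λ v → f v * g v)) (≡.sym (ℕ.+-suc M N))
      (raise (degree-resp
        (λ v _ → solve 4 (λ a b x y → (a :- x) :* b :+ 𝟙 :* (x :* (b :- y)) := a :* b :- x :* y)
          refl (f (v +[ 1# ] h)) (g (v +[ 1# ] h)) (f v) (g v))
        (degree-+* 1#
          (subst (λ z → D (ℕ.pred z) (λ v → Δ h f v * g (v +[ 1# ] h))) (ℕ.+-suc M N)
            (degree-* (lower d) (degree-shift e)))
          (degree-* d (lower e)))))

    degree-constant : ∀ c → D 1 (λ _ → c)
    degree-constant c = degree< λ v _ → -‿inverseʳ c

    degree-linear : ∀ l → D 2 (λ v → (l ∙ v))
    degree-linear l = degree< λ v _ → let u = v +[ 1# ] h in begin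
      (l ∙ u +[ 1# ] h) - (l ∙ u) - ((l ∙ u) - (l ∙ v))
        ≈⟨ +-cong (+-congʳ (∙-+[] l u h 1#)) (-‿cong (+-congʳ (∙-+[] l v h 1#))) ⟩
      (l ∙ u) + 1# * (l ∙ h) - (l ∙ u) - ((l ∙ v) + 1# * (l ∙ h) - (l ∙ v))
        ≈⟨ solve 3 (λ x y z → (x :+ 𝟙 :* y :- x) :- (z :+ 𝟙 :* y :- z) := 𝟘) refl (l ∙ u) (l ∙ h) (l ∙ v) ⟩
      0# ∎

    degree-linear-0 : ∀ {l} → (l ∙ h) ≈ 0# → D 1 (λ v → (l ∙ v))
    degree-linear-0 {l} p = degree< λ v _ → trans (+-congʳ (trans (∙-+[] l v h 1#) (+-congˡ (*-congˡ p))))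
      (solve 1 (λ x → x :+ 𝟙 :* 𝟘 :- x := 𝟘) refl (l ∙ v))

    degree-finite : ∀ {f} → IsPolynomial f → ∃ λ N → D N f
    degree-finite (constant c)   = 1 , degree-constant c
    degree-finite (linear l)     = 2 , degree-linear l
    degree-finite (_⊞_ {f} {g} F G) with degree-finite F | degree-finite G
    ... | M , d | N , e = M ℕ.+ N , degree-resp (λ v _ → +-congˡ (*-identityˡ (g v)))
      (degree-+* 1# (degree-mono (ℕ.m≤m+n M N) d) (degree-mono (ℕ.m≤n+m N M) e))
    degree-finite (F ⊠ G) with degree-finite F | degree-finite G
    ... | M , d | N , e = ℕ.pred (M ℕ.+ N) , degree-* d e
    degree-finite (respects p F) with degree-finite F
    ... | N , d = N , degree-resp (λ v _ → p v) d

    Δ^-cong-≋ : ∀ N {f : Point k → Carrier} → IsPolynomial f → ∀ {v w} → v ≋ w → Δ^ N h f v ≈ Δ^ N h f w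
    Δ^-cong-≋ N F = polynomial-cong (Δ^-poly N h F)

    -- If `q` has degree below N + 1, the N + 1-st difference of l q is (N + 1)(l ∙ h) times the
    -- N-th difference of `q`. When the former vanishes, so does the latter, and a bound on `q`
    -- drops by one. Any finite bound can thus be lowered to `M`.
    degree-quotient : ∀ M {l q} → IsPolynomial q → ¬ (l ∙ h) ≈ 0# →
                      D (suc M) (λ v → (l ∙ v) * q v) → D M q
    degree-quotient M {l} {q} Q lh≉0 d with degree-finite Q
    ... | N , e = descend N (degree-mono (ℕ.m≤m+n N M) e)
      where
      descend : ∀ j → D (j ℕ.+ M) q → D M q
      descend zero    e = e
      -- The Leibniz rule speaks about a point shifted by `h`; it is applied at v - h to reach `v`.
      descend (suc j) e = descend j (degree< λ v v∈P → let u = v +[ - 1# ] h ; u∈P = ∈ᴾ-+[] P (- 1#) v∈P h∈P in begin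
        Δ^ (j ℕ.+ M) h q v
          ≈⟨ Δ^-cong-≋ (j ℕ.+ M) Q (λ i → solve 2 (λ v h → v := v :+ (:- 𝟙) :* h :+ 𝟙 :* h) refl (v i) (h i)) ⟩
        Δ^ (j ℕ.+ M) h q (u +[ 1# ] h)
          ≈⟨ cancelˡ lh≉0 (cancelˡ (suc×1≉0 (j ℕ.+ M)) (begin
               ι (suc (j ℕ.+ M)) * ((l ∙ h) * Δ^ (j ℕ.+ M) h q (u +[ 1# ] h))
                 ≈⟨ solve 4 (λ n x y z → n :* (x :* y) := z :* 𝟘 :+ n :* x :* y) refl
                      (ι (suc (j ℕ.+ M))) (l ∙ h) (Δ^ (j ℕ.+ M) h q (u +[ 1# ] h)) (l ∙ u) ⟩
               (l ∙ u) * 0# + ι (suc (j ℕ.+ M)) * (l ∙ h) * Δ^ (j ℕ.+ M) h q (u +[ 1# ] h)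
                 ≈⟨ +-congʳ (*-congˡ (Δ^≈0 e u u∈P)) ⟨
               (l ∙ u) * Δ^ (suc j ℕ.+ M) h q u + ι (suc (j ℕ.+ M)) * (l ∙ h) * Δ^ (j ℕ.+ M) h q (u +[ 1# ] h)
                 ≈⟨ Δ^-linear-* (j ℕ.+ M) l h q u ⟨
               Δ^ (suc (j ℕ.+ M)) h (λ v → (l ∙ v) * q v) u
                 ≈⟨ Δ^≈0 (degree-mono (ℕ.s≤s (ℕ.m≤n+m M j)) d) u u∈P ⟩
               0# ∎)) ⟩
        0# ∎)

    -- For `l` constant along `h` differences commute with multiplication by `l`, which can be
    -- cancelled because `l` is not zero on the subspace.
    degree-quotient-0 : ∀ M {l q w} → IsPolynomial q → w ∈ᴾ P → (l ∙ w) ≈ 1# → (l ∙ h) ≈ 0# →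
                        D M (λ v → (l ∙ v) * q v) → D M q
    degree-quotient-0 zero    Q w∈P lw≈1 lh≈0 (degree< d) = degree< (cancel-linear P Q w∈P lw≈1 d)
    degree-quotient-0 (suc M) {l} {q} Q w∈P lw≈1 lh≈0 (degree< d) =
      degree< (cancel-linear P (Δ^-poly (suc M) h Q) w∈P lw≈1 λ v v∈P → begin
        (l ∙ v) * Δ^ (suc M) h q v
          ≈⟨ solve 4 (λ x y n z → x :* y := x :* y :+ n :* 𝟘 :* z) refl (l ∙ v) (Δ^ (suc M) h q v) (ι (suc M)) (Δ^ M h q (v +[ 1# ] h)) ⟩
        (l ∙ v) * Δ^ (suc M) h q v + ι (suc M) * 0# * Δ^ M h q (v +[ 1# ] h)
          ≈⟨ +-congˡ (*-congʳ (*-congˡ lh≈0)) ⟨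
        (l ∙ v) * Δ^ (suc M) h q v + ι (suc M) * (l ∙ h) * Δ^ M h q (v +[ 1# ] h)
          ≈⟨ Δ^-linear-* M l h q v ⟨
        Δ^ (suc M) h (λ v → (l ∙ v) * q v) v
          ≈⟨ d v v∈P ⟩
        0# ∎)

    -- A difference vanishing at all integers vanishes, f being polynomial along h.
    constant-along : ∀ {f} → IsPolynomial f → D 1 f → ∀ v → v ∈ᴾ P → ∀ τ → f (v +[ τ ] h) ≈ f v
    constant-along {f} F (degree< d) v v∈P τ = x-y≈0⇒x≈y
      (vanishing-on-line (F ⊟ constant (f v)) v h ι ι-separated (λ i → x≈y⇒x-y≈0 (integral i)) τ)
      where
      integral : ∀ i → f (v +[ ι i ] h) ≈ f v
      integral zero    = polynomial-cong F (λ j → solve 2 (λ x y → x :+ 𝟘 :* y := x) refl (v j) (h j))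
      integral (suc i) = begin
        f (v +[ ι (suc i) ] h)
          ≈⟨ polynomial-cong F (λ j → solve 3 (λ x n y → x :+ (𝟙 :+ n) :* y := x :+ n :* y :+ 𝟙 :* y) refl (v j) (ι i) (h j)) ⟩
        f ((v +[ ι i ] h) +[ 1# ] h)  ≈⟨ x-y≈0⇒x≈y (d _ (∈ᴾ-+[] P (ι i) v∈P h∈P)) ⟩
        f (v +[ ι i ] h)              ≈⟨ integral i ⟩
        f v                           ∎

-- Exponent vectors of the products of forms that make up the basis for multiplicities a.
basis : ∀ {n} → Tree n → Vec ℕ n → List (Vec ℕ n)
basis leaf         []          = [] ∷ []
basis (loop T)     (_ ∷ a)     = List.map (0 ∷_) (basis T a)
basis (branch D C) (zero ∷ a)  = List.map (0 ∷_) (basis D a)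
basis (branch D C) (suc e ∷ a) =
  List.map (0 ∷_) (basis C a) ++ List.map sucHead (basis (branch D C) (e ∷ a))

infix 4 _≼_
_≼_ : ∀ {n} → Vec ℕ n → Vec ℕ n → Set
b ≼ a = ∀ j → lookup b j ℕ.≤ lookup a j

basis-≼ : ∀ {n} (T : Tree n) a → All (_≼ a) (basis T a)
basis-≼ leaf         []          = (λ ()) ∷ []
basis-≼ (loop T)     (e ∷ a)     = All.map⁺ (All.map (λ { p zero → ℕ.z≤n ; p (suc j) → p j }) (basis-≼ T a))
basis-≼ (branch D C) (zero ∷ a)  = All.map⁺ (All.map (λ { p zero → ℕ.z≤n ; p (suc j) → p j }) (basis-≼ D a))
basis-≼ (branch D C) (suc e ∷ a) = All.++⁺
  (All.map⁺ (All.map (λ { p zero → ℕ.z≤n ; p (suc j) → p j }) (basis-≼ C a)))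
  (All.map⁺ (All.map (λ { {_ ∷ _} p zero → ℕ.s≤s (p zero) ; {_ ∷ _} p (suc j) → p (suc j) }) (basis-≼ (branch D C) (e ∷ a))))

basis-unique : ∀ {n} (T : Tree n) a → Unique (basis T a)
basis-unique leaf         []          = [] ∷ []
basis-unique (loop T)     (e ∷ a)     = Unique.map⁺ Vec.∷-injectiveʳ (basis-unique T a)
basis-unique (branch D C) (zero ∷ a)  = Unique.map⁺ Vec.∷-injectiveʳ (basis-unique D a)
basis-unique (branch D C) (suc e ∷ a) = Unique.++⁺
  (Unique.map⁺ Vec.∷-injectiveʳ (basis-unique C a))
  (Unique.map⁺ sucHead-injective (basis-unique (branch D C) (e ∷ a)))
  λ (p , q) → disjoint p q
  where
  disjoint : ∀ {b} → b ∈ List.map (0 ∷_) (basis C a) → b ∈ List.map sucHead (basis (branch D C) (e ∷ a)) → _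
  disjoint p q with ∈-map⁻ (0 ∷_) p | ∈-map⁻ sucHead q
  ... | _ , _ , ≡.refl | (_ ∷ _) , _ , ()

basisOfDegree : ∀ {n} → Tree n → ℕ → Vec ℕ n → List (Vec ℕ n)
basisOfDegree T d a = List.filter (λ b → Vec.sum b ℕ.≟ d) (basis T a)

private
  filter-map : ∀ {A B : Set} {P : B → Set} {Q : A → Set} (P? : ∀ b → Dec (P b)) (Q? : ∀ a → Dec (Q a)) (f : A → B) →
               (∀ a → Q a → P (f a)) → (∀ a → P (f a) → Q a) → ∀ xs →
               List.length (List.filter P? (List.map f xs)) ≡ List.length (List.filter Q? xs)
  filter-map P? Q? f p q []       = ≡.refl
  filter-map P? Q? f p q (x ∷ xs) with P? (f x) | Q? x
  ... | yes _ | yes _ = cong suc (filter-map P? Q? f p q xs)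
  ... | no _  | no _  = filter-map P? Q? f p q xs
  ... | yes a | no ¬b = ⊥-elim (¬b (q x a))
  ... | no ¬a | yes b = ⊥-elim (¬a (p x b))

length-basisOfDegree : ∀ {n} (T : Tree n) d a → List.length (basisOfDegree T d a) ≡ basisCount T d a
length-basisOfDegree leaf zero    [] = ≡.refl
length-basisOfDegree leaf (suc d) [] = ≡.refl
length-basisOfDegree (loop T) d (e ∷ a) =
  ≡.trans (filter-map _ _ (0 ∷_) (λ _ p → p) (λ _ p → p) (basis T a)) (length-basisOfDegree T d a)
length-basisOfDegree (branch D C) d (zero ∷ a) =
  ≡.trans (filter-map _ _ (0 ∷_) (λ _ p → p) (λ _ p → p) (basis D a)) (length-basisOfDegree D d a)
length-basisOfDegree (branch D C) d (suc e ∷ a) = ≡.trans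
  (cong List.length (List.filter-++ (λ b → Vec.sum b ℕ.≟ d) (List.map (0 ∷_) (basis C a)) (List.map sucHead bs)))
  (≡.trans (List.length-++ (List.filter _ (List.map (0 ∷_) (basis C a))))
    (cong₂ ℕ._+_ (≡.trans (filter-map _ _ (0 ∷_) (λ _ p → p) (λ _ p → p) (basis C a)) (length-basisOfDegree C d a)) (lemma d)))
  where
  bs = basis (branch D C) (e ∷ a)
  lemma : ∀ d → List.length (List.filter (λ b → Vec.sum b ℕ.≟ d) (List.map sucHead bs)) ≡
                shiftℕ (λ d′ → basisCount (branch D C) d′ (e ∷ a)) d
  lemma zero = none bs
    where
    none : ∀ bs → List.length (List.filter (λ b → Vec.sum b ℕ.≟ 0) (List.map sucHead bs)) ≡ 0
    none []             = ≡.refl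
    none ((x ∷ b) ∷ bs) = none bs
  lemma (suc d) = ≡.trans
    (filter-map _ _ sucHead (λ { (_ ∷ _) p → cong suc p }) (λ { (_ ∷ _) p → ℕ.suc-injective p }) bs)
    (length-basisOfDegree (branch D C) d (e ∷ a))

-- Products of forms: independence, spanning and ranks

module ProductsOfForms (K : CharacteristicZeroField) where
  open Subspaces K public

  monomial : ∀ {k n} → (Fin n → Point k) → Vec ℕ n → Point k → Carrier
  monomial φ []      v = 1#
  monomial φ (e ∷ b) v = (φ zero ∙ v) ^ e * monomial (φ ∘ suc) b v

  power-polynomial : ∀ {k} (l : Point k) e → IsPolynomial (λ v → (l ∙ v) ^ e)
  power-polynomial l zero    = constant 1#
  power-polynomial l (suc e) = linear l ⊠ power-polynomial l e

  monomial-polynomial : ∀ {k n} (φ : Fin n → Point k) b → IsPolynomial (monomial φ b)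
  monomial-polynomial φ []      = constant 1#
  monomial-polynomial φ (e ∷ b) = power-polynomial (φ zero) e ⊠ monomial-polynomial (φ ∘ suc) b

  Σᴸ : ∀ {A : Set} → List A → (A → Carrier) → Carrier
  Σᴸ []       f = 0#
  Σᴸ (x ∷ xs) f = f x + Σᴸ xs f

  Σᴸ-cong : ∀ {A : Set} xs {f g : A → Carrier} → (∀ x → f x ≈ g x) → Σᴸ xs f ≈ Σᴸ xs g
  Σᴸ-cong []       p = refl
  Σᴸ-cong (x ∷ xs) p = +-cong (p x) (Σᴸ-cong xs p)

  Σᴸ-++ : ∀ {A : Set} xs ys (f : A → Carrier) → Σᴸ (xs ++ ys) f ≈ Σᴸ xs f + Σᴸ ys f
  Σᴸ-++ []       ys f = sym (+-identityˡ _)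
  Σᴸ-++ (x ∷ xs) ys f = trans (+-congˡ (Σᴸ-++ xs ys f)) (sym (+-assoc _ _ _))

  Σᴸ-map : ∀ {A B : Set} (g : A → B) xs (f : B → Carrier) → Σᴸ (List.map g xs) f ≡ Σᴸ xs (f ∘ g)
  Σᴸ-map g []       f = ≡.refl
  Σᴸ-map g (x ∷ xs) f = cong (λ z → f (g x) + z) (Σᴸ-map g xs f)

  Σᴸ-*ˡ : ∀ {A : Set} xs c (f : A → Carrier) → Σᴸ xs (λ x → c * f x) ≈ c * Σᴸ xs f
  Σᴸ-*ˡ []       c f = sym (zeroʳ c)
  Σᴸ-*ˡ (x ∷ xs) c f = trans (+-congˡ (Σᴸ-*ˡ xs c f)) (sym (distribˡ c _ _))

  -- Coefficients are indexed by exponent vectors, not by positions in the list, so that appending,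
  -- mapping and filtering lists requires no reindexing of positions.
  combine : ∀ {k n} → (Fin n → Point k) → List (Vec ℕ n) → (Vec ℕ n → Carrier) → Point k → Carrier
  combine φ L c v = Σᴸ L (λ b → c b * monomial φ b v)

  combine-polynomial : ∀ {k n} (φ : Fin n → Point k) L c → IsPolynomial (combine φ L c)
  combine-polynomial φ []      c = constant 0#
  combine-polynomial φ (b ∷ L) c = (constant (c b) ⊠ monomial-polynomial φ b) ⊞ combine-polynomial φ L c

  combine-0∷ : ∀ {k n} (φ : Fin (suc n) → Point k) L c v →
               combine φ (List.map (0 ∷_) L) c v ≈ combine (φ ∘ suc) L (c ∘ (0 ∷_)) v
  combine-0∷ φ L c v = trans (reflexive (Σᴸ-map (0 ∷_) L _)) (Σᴸ-cong L (λ b → *-congˡ (*-identityˡ _)))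

  combine-sucHead : ∀ {k n} (φ : Fin (suc n) → Point k) L c v →
                    combine φ (List.map sucHead L) c v ≈ (φ zero ∙ v) * combine φ L (c ∘ sucHead) v
  combine-sucHead φ L c v = trans (reflexive (Σᴸ-map sucHead L _)) (trans
    (Σᴸ-cong L (λ { b@(_ ∷ _) → solve 4 (λ c x y z → c :* (x :* y :* z) := x :* (c :* (y :* z)))
                              refl (c (sucHead b)) (φ zero ∙ v) ((φ zero ∙ v) ^ Vec.head b) (monomial (φ ∘ suc) (Vec.tail b) v) }))
    (Σᴸ-*ˡ L (φ zero ∙ v) _))

  nonzero : Carrier → ℕ
  nonzero x = if does (x ≟ 0#) then 0 else 1

  nonzero-0 : ∀ {x} → x ≈ 0# → nonzero x ≡ 0
  nonzero-0 {x} p rewrite dec-true (x ≟ 0#) p = ≡.refl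

  nonzero-1 : ∀ {x} → ¬ x ≈ 0# → nonzero x ≡ 1
  nonzero-1 {x} p rewrite dec-false (x ≟ 0#) p = ≡.refl

  nonzero-cong : ∀ {x y} → x ≈ y → nonzero x ≡ nonzero y
  nonzero-cong {x} {y} p = lemma (y ≟ 0#)
    where
    lemma : Dec (y ≈ 0#) → nonzero x ≡ nonzero y
    lemma (yes q) = ≡.trans (nonzero-0 (trans p q)) (≡.sym (nonzero-0 q))
    lemma (no ¬q) = ≡.trans (nonzero-1 (¬q ∘ trans (sym p))) (≡.sym (nonzero-1 ¬q))

  -- The number of factors, counted with the multiplicities `a`, that are not constant along `h`. In
  -- the direction of a line this is the corresponding entry of H a.
  weight : ∀ {k n} → (Fin n → Point k) → Vec ℕ n → Point k → ℕ
  weight φ a h = Vec.sum (tabulate (λ j → nonzero (φ j ∙ h) ℕ.* lookup a j))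

  weight-mono : ∀ {k n} (φ : Fin n → Point k) a b h → b ≼ a → weight φ b h ℕ.≤ weight φ a h
  weight-mono φ []      []      h p = ℕ.z≤n
  weight-mono φ (e ∷ a) (f ∷ b) h p =
    ℕ.+-mono-≤ (ℕ.*-monoʳ-≤ (nonzero (φ zero ∙ h)) (p zero)) (weight-mono (φ ∘ suc) a b h (p ∘ suc))

  weight-loop : ∀ {k n} (φ : Fin (suc n) → Point k) e a h → (φ zero ∙ h) ≈ 0# →
                weight φ (e ∷ a) h ≡ weight (φ ∘ suc) a h
  weight-loop φ e a h p = cong (λ z → z ℕ.* e ℕ.+ weight (φ ∘ suc) a h) (nonzero-0 p)

  weight-0∷ : ∀ {k n} (φ : Fin (suc n) → Point k) a h → weight φ (0 ∷ a) h ≡ weight (φ ∘ suc) a h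
  weight-0∷ φ a h = cong (ℕ._+ weight (φ ∘ suc) a h) (ℕ.*-zeroʳ (nonzero (φ zero ∙ h)))

  weight-suc : ∀ {k n} (φ : Fin (suc n) → Point k) e a h →
               weight φ (suc e ∷ a) h ≡ nonzero (φ zero ∙ h) ℕ.+ weight φ (e ∷ a) h
  weight-suc φ e a h = ≡.trans (cong (ℕ._+ weight (φ ∘ suc) a h) (ℕ.*-suc (nonzero (φ zero ∙ h)) e))
    (ℕ.+-assoc (nonzero (φ zero ∙ h)) _ _)

  module _ {k} {P : Projector k} {h : Point k} (h∈P : h ∈ᴾ P) where

    degree-power : ∀ l e → Degree< P h (suc (nonzero (l ∙ h) ℕ.* e)) (λ v → (l ∙ v) ^ e)
    degree-power l zero    = degree-mono h∈P (ℕ.s≤s ℕ.z≤n) (degree-constant h∈P 1#)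
    degree-power l (suc e) = subst (λ z → Degree< P h z (λ v → (l ∙ v) ^ suc e))
      (≡.trans (ℕ.+-suc (nonzero (l ∙ h)) _) (cong suc (≡.sym (ℕ.*-suc (nonzero (l ∙ h)) e))))
      (degree-* h∈P (base ((l ∙ h) ≟ 0#)) (degree-power l e))
      where
      base : Dec ((l ∙ h) ≈ 0#) → Degree< P h (suc (nonzero (l ∙ h))) (λ v → l ∙ v)
      base (yes p) = degree-mono h∈P (ℕ.s≤s ℕ.z≤n) (degree-linear-0 h∈P {l} p)
      base (no ¬p) = subst (λ z → Degree< P h z (λ v → l ∙ v)) (cong suc (≡.sym (nonzero-1 ¬p))) (degree-linear h∈P l)

    degree-monomial : ∀ {n} (φ : Fin n → Point k) b → Degree< P h (suc (weight φ b h)) (monomial φ b)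
    degree-monomial φ []      = degree-constant h∈P 1#
    degree-monomial φ (e ∷ b) = subst (λ z → Degree< P h z (monomial φ (e ∷ b))) (ℕ.+-suc (nonzero (φ zero ∙ h) ℕ.* e) _)
      (degree-* h∈P (degree-power (φ zero) e) (degree-monomial (φ ∘ suc) b))

    degree-combine : ∀ {n} (φ : Fin n → Point k) {L a} c → All (_≼ a) L →
                     Degree< P h (suc (weight φ a h)) (combine φ L c)
    degree-combine φ {[]}    {a} c []       = degree-zero h∈P (suc (weight φ a h)) (λ _ _ → refl)
    degree-combine φ {b ∷ L} {a} c (p ∷ ps) = degree-resp h∈P (λ v _ → +-comm _ _)
      (degree-+* h∈P (c b) (degree-combine φ {L} {a} c ps)
        (degree-mono h∈P (ℕ.s≤s (weight-mono φ a b h p)) (degree-monomial φ b)))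

  -- A tree computed from the forms φ on the subspace P: loops are forms vanishing on P, and
  -- contracting a form restricts P to its kernel.
  data Resolution {k} : Projector k → ∀ {n} → (Fin n → Point k) → Tree n → Set where
    leaf   : ∀ {P φ} → Resolution P {0} φ leaf
    loop   : ∀ {P n T} {φ : Fin (suc n) → Point k} →
             (∀ v → v ∈ᴾ P → (φ zero ∙ v) ≈ 0#) → Resolution P (φ ∘ suc) T → Resolution P φ (loop T)
    branch : ∀ {P n D C} {φ : Fin (suc n) → Point k} w (w∈P : w ∈ᴾ P) (φw≈1 : (φ zero ∙ w) ≈ 1#) →
             Resolution P (φ ∘ suc) D → Resolution (restrict P (φ zero) w w∈P φw≈1) (φ ∘ suc) C →
             Resolution P φ (branch D C)

  resolve : ∀ {k} P {n} (φ : Fin n → Point k) → ∃ (Resolution P φ)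
  resolve P {zero}  φ = leaf , leaf
  resolve P {suc n} φ with vanishes? P (φ zero)
  ... | inj₁ p with resolve P (φ ∘ suc)
  ...   | T , R = loop T , loop p R
  resolve P {suc n} φ | inj₂ (w , w∈P , p) with resolve P (φ ∘ suc) | resolve (restrict P (φ zero) w w∈P p) (φ ∘ suc)
  ...   | D , R | C , R′ = branch D C , branch w w∈P p R R′

  -- On the kernel of the first form all products containing it vanish, so the contraction shows
  -- that the other coefficients are 0. What is left is a multiple of the first form, which
  -- `cancel-linear` removes.
  combine-independent : ∀ {k P n T} {φ : Fin n → Point k} → Resolution P φ T → ∀ a c →
    (∀ v → v ∈ᴾ P → combine φ (basis T a) c v ≈ 0#) → All (λ b → c b ≈ 0#) (basis T a)
  combine-independent {P = P} leaf [] c p = trans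
    (solve 1 (λ x → x := x :* 𝟙 :+ 𝟘) refl (c [])) (p origin (∈ᴾ-origin P)) ∷ []
  combine-independent {φ = φ} (loop {T = T} _ R) (e ∷ a) c p = All.map⁺ (combine-independent R a (c ∘ (0 ∷_))
    λ v v∈P → trans (sym (combine-0∷ φ (basis T a) c v)) (p v v∈P))
  combine-independent {φ = φ} (branch {D = D} _ _ _ R _) (zero ∷ a) c p = All.map⁺ (combine-independent R a (c ∘ (0 ∷_))
    λ v v∈P → trans (sym (combine-0∷ φ (basis D a) c v)) (p v v∈P))
  combine-independent {k} {P} {φ = φ} R@(branch {D = D} {C} w w∈P φw≈1 _ R′) (suc e ∷ a) c p =
    All.++⁺ (All.map⁺ c₀≈0) (All.map⁺ (combine-independent R (e ∷ a) (c ∘ sucHead)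
      (cancel-linear P (combine-polynomial φ L₁ (c ∘ sucHead)) w∈P φw≈1 λ v v∈P → begin
        (φ zero ∙ v) * combine φ L₁ (c ∘ sucHead) v                        ≈⟨ +-identityˡ _ ⟨
        0# + (φ zero ∙ v) * combine φ L₁ (c ∘ sucHead) v                   ≈⟨ +-congʳ (vanishes c₀≈0 v) ⟨
        combine (φ ∘ suc) L₀ (c ∘ (0 ∷_)) v + (φ zero ∙ v) * combine φ L₁ (c ∘ sucHead) v  ≈⟨ split v ⟨
        combine φ (basis (branch D C) (suc e ∷ a)) c v                     ≈⟨ p v v∈P ⟩
        0# ∎)))
    where
    L₀ = basis C a
    L₁ = basis (branch D C) (e ∷ a)
    split : ∀ v → combine φ (basis (branch D C) (suc e ∷ a)) c v ≈
                  combine (φ ∘ suc) L₀ (c ∘ (0 ∷_)) v + (φ zero ∙ v) * combine φ L₁ (c ∘ sucHead) v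
    split v = trans (Σᴸ-++ (List.map (0 ∷_) L₀) _ _) (+-cong (combine-0∷ φ L₀ c v) (combine-sucHead φ L₁ c v))
    vanishes : ∀ {n} {φ : Fin n → Point k} {L c} → All (λ b → c b ≈ 0#) L → ∀ v → combine φ L c v ≈ 0#
    vanishes []       v = refl
    vanishes (q ∷ qs) v = trans (+-cong (trans (*-congʳ q) (zeroˡ _)) (vanishes qs v)) (+-identityˡ 0#)
    c₀≈0 : All (λ b → c (0 ∷ b) ≈ 0#) L₀
    c₀≈0 = combine-independent R′ a (c ∘ (0 ∷_)) λ v v∈P′ → begin
      combine (φ ∘ suc) L₀ (c ∘ (0 ∷_)) v
        ≈⟨ solve 2 (λ x y → x := x :+ 𝟘 :* y) refl (combine (φ ∘ suc) L₀ (c ∘ (0 ∷_)) v) (combine φ L₁ (c ∘ sucHead) v) ⟩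
      combine (φ ∘ suc) L₀ (c ∘ (0 ∷_)) v + 0# * combine φ L₁ (c ∘ sucHead) v
        ≈⟨ +-congˡ (*-congʳ (∈-restrict⁻₂ P v∈P′)) ⟨
      combine (φ ∘ suc) L₀ (c ∘ (0 ∷_)) v + (φ zero ∙ v) * combine φ L₁ (c ∘ sucHead) v
        ≈⟨ split v ⟨
      combine φ (basis (branch D C) (suc e ∷ a)) c v
        ≈⟨ p v (∈-restrict⁻₁ P v∈P′) ⟩
      0# ∎

  module Spanning {k : ℕ} (Dir : Point k → Set) where

    -- What is needed at a leaf: without forms every weight is 0. Only this property depends on
    -- which directions are given, so it is isolated as a hypothesis, for a class of subspaces
    -- closed under the restrictions of the recursion.
    ConstantIfFlat : Projector k → Set
    ConstantIfFlat P = ∀ {g} → IsPolynomial g → (∀ h → Dir h → h ∈ᴾ P → Degree< P h 1 g) →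
                       ∀ v → v ∈ᴾ P → g v ≈ g origin

    module _ (Good : Projector k → Set) (base : ∀ P → Good P → ConstantIfFlat P) where

      RestrictsGood : ∀ {n} → (Fin n → Point k) → Set
      RestrictsGood φ = ∀ P j w (w∈P : w ∈ᴾ P) (φw≈1 : (φ j ∙ w) ≈ 1#) → Good P → Good (restrict P (φ j) w w∈P φw≈1)

      combine-spans : ∀ {P n T} {φ : Fin n → Point k} → Resolution P φ T → RestrictsGood φ → Good P →
        ∀ a {g} → IsPolynomial g → (∀ h → Dir h → h ∈ᴾ P → Degree< P h (suc (weight φ a h)) g) →
        ∃ λ c → ∀ v → v ∈ᴾ P → g v ≈ combine φ (basis T a) c v
      combine-spans {P} leaf step good [] {g} G deg = (λ _ → g origin) , λ v v∈P →
        trans (base P good G deg v v∈P) (solve 1 (λ x → x := x :* 𝟙 :+ 𝟘) refl (g origin))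
      combine-spans {P} {φ = φ} (loop {T = T} φ≈0 R) step good (e ∷ a) {g} G deg =
        let c , p = combine-spans {φ = φ ∘ suc} R (λ P j → step P (suc j)) good a {g} G
              (λ h h∈D h∈P → subst (λ z → Degree< P h z g) (cong suc (weight-loop φ e a h (φ≈0 h h∈P))) (deg h h∈D h∈P))
        in c ∘ Vec.tail , λ v v∈P → trans (p v v∈P) (sym (combine-0∷ φ (basis T a) (c ∘ Vec.tail) v))
      combine-spans {P} {φ = φ} (branch {D = D} _ _ _ R _) step good (zero ∷ a) {g} G deg =
        let c , p = combine-spans {φ = φ ∘ suc} R (λ P j → step P (suc j)) good a {g} G
              (λ h h∈D h∈P → subst (λ z → Degree< P h z g) (cong suc (weight-0∷ φ a h)) (deg h h∈D h∈P))
        in c ∘ Vec.tail , λ v v∈P → trans (p v v∈P) (sym (combine-0∷ φ (basis D a) (c ∘ Vec.tail) v))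
      combine-spans {P} {φ = φ} R@(branch {D = D} {C} w w∈P φw≈1 _ R′) step good (suc e ∷ a) {g} G deg =
        correct (λ Q d → combine-spans {φ = φ} R step good (e ∷ a) Q d) (combine-spans {φ = φ ∘ suc} R′ (λ P j → step P (suc j)) (step P zero w w∈P φw≈1 good) a G
          -- For a direction inside the kernel the first form has no weight, whatever its
          -- multiplicity; the given bound is already the one for the contraction.
          (λ h h∈D h∈P′ → degree< λ v v∈P′ → Δ^≈0 (subst (λ z → Degree< P h (suc z) g)
            (weight-loop φ (suc e) a h (∈-restrict⁻₂ P h∈P′)) (deg h h∈D (∈-restrict⁻₁ P h∈P′))) v (∈-restrict⁻₁ P v∈P′)))
        where
        l  = φ zero
        L₀ = basis C a
        L₁ = basis (branch D C) (e ∷ a)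

        module _ (c₀ : Vec ℕ _ → Carrier)
                 (p₀ : ∀ v → v ∈ᴾ restrict P l w w∈P φw≈1 → g v ≈ combine (φ ∘ suc) L₀ c₀ v)
                 {q : Point k → Carrier} (Q : IsPolynomial q)
                 (r : ∀ v → g v - combine (φ ∘ suc) L₀ c₀ v ≈
                            g (project l w v) - combine (φ ∘ suc) L₀ c₀ (project l w v) + (l ∙ v) * q v) where
          g₀ : Point k → Carrier
          g₀ = combine (φ ∘ suc) L₀ c₀

          -- The remainder of the division is the value at the projected point. That point lies in
          -- the kernel of `l`, where `g₀` was chosen to agree with `g`.
          g-g₀≈lq : ∀ v → v ∈ᴾ P → g v - g₀ v ≈ (l ∙ v) * q v
          g-g₀≈lq v v∈P = begin
            g v - g₀ v                                                            ≈⟨ r v ⟩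
            (g (project l w v) - g₀ (project l w v)) + (l ∙ v) * q v
              ≈⟨ +-congʳ (x≈y⇒x-y≈0 (p₀ _ (project-∈-restrict P v∈P))) ⟩
            0# + (l ∙ v) * q v                                                    ≈⟨ +-identityˡ _ ⟩
            (l ∙ v) * q v                                                         ∎
          degree-lq : ∀ h → Dir h → h ∈ᴾ P → Degree< P h (suc (weight φ (suc e ∷ a) h)) (λ v → (l ∙ v) * q v)
          degree-lq h h∈D h∈P = degree-resp h∈P
            (λ v v∈P → trans (solve 2 (λ x y → x :+ (:- 𝟙) :* y := x :- y) refl (g v) (g₀ v)) (g-g₀≈lq v v∈P))
            (degree-+* h∈P (- 1#) (deg h h∈D h∈P)
              (degree-mono h∈P (ℕ.s≤s (ℕ.m≤n+m (weight (φ ∘ suc) a h) (nonzero (l ∙ h) ℕ.* suc e)))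
                (degree-combine h∈P (φ ∘ suc) {L₀} {a} c₀ (basis-≼ C a))))
          -- Division by `l` lowers the bound exactly when `l` is not constant along `h`, and so
          -- does removing one copy of `l` from the weight.
          degree-q : ∀ h → Dir h → h ∈ᴾ P → Degree< P h (suc (weight φ (e ∷ a) h)) q
          degree-q h h∈D h∈P = cases ((l ∙ h) ≟ 0#)
            where
            cases : Dec ((l ∙ h) ≈ 0#) → Degree< P h (suc (weight φ (e ∷ a) h)) q
            cases (yes lh≈0) = degree-quotient-0 h∈P (suc (weight φ (e ∷ a) h)) Q w∈P φw≈1 lh≈0
              (subst (λ z → Degree< P h z (λ v → (l ∙ v) * q v)) (cong suc
                (≡.trans (weight-loop φ (suc e) a h lh≈0) (≡.sym (weight-loop φ e a h lh≈0)))) (degree-lq h h∈D h∈P))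
            cases (no lh≉0) = degree-quotient h∈P (suc (weight φ (e ∷ a) h)) Q lh≉0
              (subst (λ z → Degree< P h z (λ v → (l ∙ v) * q v)) (cong suc
                (≡.trans (weight-suc φ e a h) (cong (ℕ._+ weight φ (e ∷ a) h) (nonzero-1 lh≉0)))) (degree-lq h h∈D h∈P))
          split : (∃ λ c₁ → ∀ v → v ∈ᴾ P → q v ≈ combine φ L₁ c₁ v) →
                  ∃ λ c → ∀ v → v ∈ᴾ P → g v ≈ combine φ (basis (branch D C) (suc e ∷ a)) c v
          split (c₁ , p₁) = c , λ v v∈P → begin
            g v
              ≈⟨ solve 2 (λ x y → x := y :+ (x :- y)) refl (g v) (g₀ v) ⟩
            g₀ v + (g v - g₀ v)
              ≈⟨ +-congˡ (trans (g-g₀≈lq v v∈P) (*-congˡ (p₁ v v∈P))) ⟩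
            g₀ v + (l ∙ v) * combine φ L₁ c₁ v
              ≈⟨ +-cong (combine-0∷ φ L₀ c v) (trans (combine-sucHead φ L₁ c v)
                   (*-congˡ (Σᴸ-cong L₁ (λ { (_ ∷ _) → refl })))) ⟨
            combine φ (List.map (0 ∷_) L₀) c v + combine φ (List.map sucHead L₁) c v
              ≈⟨ Σᴸ-++ (List.map (0 ∷_) L₀) (List.map sucHead L₁) _ ⟨
            combine φ (basis (branch D C) (suc e ∷ a)) c v ∎
            where
            c : Vec ℕ _ → Carrier
            c (zero ∷ b)  = c₀ b
            c (suc x ∷ b) = c₁ (x ∷ b)

        correct : (∀ {q} → IsPolynomial q → (∀ h → Dir h → h ∈ᴾ P → Degree< P h (suc (weight φ (e ∷ a) h)) q) →
                    ∃ λ c → ∀ v → v ∈ᴾ P → q v ≈ combine φ L₁ c v) →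
                  (∃ λ c₀ → ∀ v → v ∈ᴾ restrict P l w w∈P φw≈1 → g v ≈ combine (φ ∘ suc) L₀ c₀ v) →
                  ∃ λ c → ∀ v → v ∈ᴾ P → g v ≈ combine φ (basis (branch D C) (suc e ∷ a)) c v
        correct recurse (c₀ , p₀) = quotient (divide (G ⊟ combine-polynomial (φ ∘ suc) L₀ c₀) l w)
          where
          f₀ = combine (φ ∘ suc) L₀ c₀
          quotient : (∃ λ q → IsPolynomial q ×
                       (∀ v → g v - f₀ v ≈ g (project l w v) - f₀ (project l w v) + (l ∙ v) * q v)) → _
          quotient (q , Q , r) = split c₀ p₀ Q r (recurse Q (degree-q c₀ p₀ Q r))

  -- A selection of forms from `B` that is a basis of their span as functions on `P`. Relations are
  -- tested on `P` alone because a contraction changes the subspace and not the forms.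
  record IndependentForms {k n} (P : Projector k) (φ : Fin n → Point k) (B : Subset n) (r : ℕ) : Set where
    field
      index       : Fin r → Fin n
      index∈      : ∀ i → index i Subset.∈ B
      independent : ∀ (c : Fin r → Carrier) → (∀ v → v ∈ᴾ P → sum (λ i → c i * (φ (index i) ∙ v)) ≈ 0#) →
                    ∀ i → c i ≈ 0#
      spanning    : ∀ j → j Subset.∈ B → ∃ λ (c : Fin r → Carrier) →
                    ∀ v → v ∈ᴾ P → (φ j ∙ v) ≈ sum (λ i → c i * (φ (index i) ∙ v))

  independentForms : ∀ {k P n T} {φ : Fin n → Point k} → Resolution P φ T → ∀ B → IndependentForms P φ B (rank T B)
  independentForms leaf [] = record { index = λ () ; index∈ = λ () ; independent = λ _ _ () ; spanning = λ () }
  independentForms {φ = φ} (loop φ≈0 R) (x ∷ B) = record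
    { index       = suc ∘ index
    ; index∈      = Vec.there ∘ index∈
    ; independent = independent
    ; spanning    = λ { zero _ → (λ _ → 0#) , λ v v∈P → trans (φ≈0 v v∈P) (sym (sum-zero (λ i → zeroˡ (φ (suc (index i)) ∙ v))))
                      ; (suc j) (Vec.there j∈B) → spanning j j∈B }
    }
    where
    open IndependentForms (independentForms {φ = φ ∘ suc} R B)
  independentForms {φ = φ} (branch w w∈P φw≈1 R R′) (outside ∷ B) = record
    { index       = suc ∘ index
    ; index∈      = Vec.there ∘ index∈
    ; independent = independent
    ; spanning    = λ { (suc j) (Vec.there j∈B) → spanning j j∈B }
    }
    where
    open IndependentForms (independentForms {φ = φ ∘ suc} R B)
  independentForms {k} {P} {φ = φ} (branch {C = C} w w∈P φw≈1 R R′) (inside ∷ B) = record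
    { index       = index′
    ; index∈      = λ { zero → Vec.here ; (suc i) → Vec.there (index∈ i) }
    ; independent = independent′
    ; spanning    = λ { zero _ → unit zero , λ v v∈P → begin
                          φ zero ∙ v          ≈⟨ solve 1 (λ x → x := 𝟙 :* x :+ 𝟘) refl (φ zero ∙ v) ⟩
                          1# * (φ zero ∙ v) + 0#   ≈⟨ +-congˡ (sum-zero {rank C B} {λ i → 0# * (φ (suc (index i)) ∙ v)} (λ i → zeroˡ _)) ⟨
                          1# * (φ zero ∙ v) + sum (λ i → 0# * (φ (suc (index i)) ∙ v)) ∎
                      ; (suc j) (Vec.there j∈B) → spanning′ j (spanning j j∈B) }
    }
    where
    open IndependentForms (independentForms {φ = φ ∘ suc} R′ B)
    index′ : Fin (suc (rank C B)) → Fin _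
    index′ zero    = zero
    index′ (suc i) = suc (index i)
    independent′ : ∀ (c : Fin (suc (rank C B)) → Carrier) → (∀ v → v ∈ᴾ P → sum (λ i → c i * (φ (index′ i) ∙ v)) ≈ 0#) → ∀ i → c i ≈ 0#
    independent′ c p = λ { zero → c₀≈0 ; (suc i) → c₊≈0 i }
      where
      c₊≈0 : ∀ i → c (suc i) ≈ 0#
      c₊≈0 = independent (c ∘ suc) λ v v∈P′ → begin
        sum (λ i → c (suc i) * (φ (suc (index i)) ∙ v))
          ≈⟨ solve 2 (λ x y → x := y :* 𝟘 :+ x) refl (sum (λ i → c (suc i) * (φ (suc (index i)) ∙ v))) (c zero) ⟩
        c zero * 0# + sum (λ i → c (suc i) * (φ (suc (index i)) ∙ v))
          ≈⟨ +-congʳ (*-congˡ (∈-restrict⁻₂ P v∈P′)) ⟨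
        c zero * (φ zero ∙ v) + sum (λ i → c (suc i) * (φ (suc (index i)) ∙ v))
          ≈⟨ p v (∈-restrict⁻₁ P v∈P′) ⟩
        0# ∎
      c₀≈0 : c zero ≈ 0#
      c₀≈0 = begin
        c zero          ≈⟨ solve 1 (λ x → x := x :* 𝟙 :+ 𝟘) refl (c zero) ⟩
        c zero * 1# + 0#
          ≈⟨ +-cong (*-congˡ φw≈1) (sum-zero {rank C B} {λ i → c (suc i) * (φ (suc (index i)) ∙ w)} (λ i → trans (*-congʳ (c₊≈0 i)) (zeroˡ _))) ⟨
        c zero * (φ zero ∙ w) + sum (λ i → c (suc i) * (φ (suc (index i)) ∙ w))  ≈⟨ p w w∈P ⟩
        0# ∎
    spanning′ : ∀ j → (∃ λ (c : Fin (rank C B) → Carrier) → ∀ v → v ∈ᴾ restrict P (φ zero) w w∈P φw≈1 → (φ (suc j) ∙ v) ≈ sum (λ i → c i * (φ (suc (index i)) ∙ v))) →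
                ∃ λ (c : Fin (suc (rank C B)) → Carrier) → ∀ v → v ∈ᴾ P → (φ (suc j) ∙ v) ≈ sum (λ i → c i * (φ (index′ i) ∙ v))
    -- The form and its expansion agree on the kernel of `φ zero`, so they differ by a multiple of
    -- `φ zero`. Evaluation at `w`, where `φ zero` is 1, gives the factor.
    spanning′ j (c , p) = cons ((φ (suc j) ∙ w) - s w) c , λ v v∈P → let x = φ zero ∙ v in begin
      φ (suc j) ∙ v
        ≈⟨ solve 3 (λ y x z → y := y :+ (:- x) :* z :+ x :* z) refl (φ (suc j) ∙ v) x (φ (suc j) ∙ w) ⟩
      (φ (suc j) ∙ v) + - x * (φ (suc j) ∙ w) + x * (φ (suc j) ∙ w)
        ≈⟨ +-congʳ (begin
             (φ (suc j) ∙ v) + - x * (φ (suc j) ∙ w)   ≈⟨ ∙-+[] (φ (suc j)) v w (- x) ⟨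
             φ (suc j) ∙ project (φ zero) w v          ≈⟨ p _ (project-∈-restrict P v∈P) ⟩
             s (project (φ zero) w v)
               ≈⟨ sum-cong {rank C B} {λ i → c i * (φ (suc (index i)) ∙ project (φ zero) w v)}
                    {λ i → c i * (φ (suc (index i)) ∙ v) + - x * (c i * (φ (suc (index i)) ∙ w))}
                    (λ i → trans (*-congˡ (∙-+[] (φ (suc (index i))) v w (- x)))
                    (solve 4 (λ c y x z → c :* (y :+ (:- x) :* z) := c :* y :+ (:- x) :* (c :* z)) refl
                      (c i) (φ (suc (index i)) ∙ v) x (φ (suc (index i)) ∙ w))) ⟩
             sum (λ i → c i * (φ (suc (index i)) ∙ v) + - x * (c i * (φ (suc (index i)) ∙ w)))
               ≈⟨ sum-+* (- x) (λ i → c i * (φ (suc (index i)) ∙ v)) (λ i → c i * (φ (suc (index i)) ∙ w)) ⟩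
             s v + - x * s w ∎) ⟩
      s v + - x * s w + x * (φ (suc j) ∙ w)
        ≈⟨ solve 4 (λ a x b z → a :+ (:- x) :* b :+ x :* z := (z :- b) :* x :+ a) refl (s v) x (s w) (φ (suc j) ∙ w) ⟩
      ((φ (suc j) ∙ w) - s w) * x + s v ∎
      where
      s : Point k → Carrier
      s v = sum (λ i → c i * (φ (suc (index i)) ∙ v))

-- Flats of an essential arrangement are spanned by their lines

module ArrangementGeometry (K : CharacteristicZeroField) where
  open ProductsOfForms K public
  open Arrangements rawRing _≟_ using (Arrangement; Lines; line; module V; coordinateSpace) public

  1≉0 : ¬ 1# ≈ 0#
  1≉0 p = suc×1≉0 0 (trans (+-identityʳ 1#) p)

  sum-unit : ∀ {k} (i : Fin k) (f : Fin k → Carrier) → sum (λ j → unit i j * f j) ≈ f i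
  sum-unit {suc k} zero    f = trans (+-cong (*-identityˡ _) (sum-zero {k} {λ j → 0# * f (suc j)} (λ j → zeroˡ _)))
    (+-identityʳ _)
  sum-unit {suc k} (suc i) f = trans (+-cong (zeroˡ _) (sum-unit i (f ∘ suc))) (+-identityˡ _)

  unit-≢ : ∀ {k} {i j : Fin k} → i ≢ j → unit i j ≈ 0#
  unit-≢ {i = zero}  {zero}  p = ⊥-elim (p ≡.refl)
  unit-≢ {i = zero}  {suc j} p = refl
  unit-≢ {i = suc i} {zero}  p = refl
  unit-≢ {i = suc i} {suc j} p = unit-≢ (p ∘ cong suc)

  ∙-origin : ∀ {k} (l : Point k) → (l ∙ origin) ≈ 0#
  ∙-origin l = sum-zero {f = λ i → l i * 0#} (λ i → zeroʳ (l i))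

  combination-apply : ∀ {r k} (c : Fin k → Carrier) (v : Fin k → Point r) p →
                      V.combination r c v p ≈ sum (λ i → c i * v i p)
  combination-apply {k = zero}  c v p = refl
  combination-apply {k = suc k} c v p = +-congˡ (combination-apply (c ∘ suc) (v ∘ suc) p)

  ∙-combination : ∀ {r k} (l : Point r) (c : Fin k → Carrier) (v : Fin k → Point r) →
                  (l ∙ V.combination r c v) ≈ sum (λ i → c i * (l ∙ v i))
  ∙-combination {k = zero}  l c v = ∙-origin l
  ∙-combination {k = suc k} l c v = begin
    l ∙ V.combination _ c v
      ≈⟨ ∙-cong (λ _ → refl) (λ p → +-comm (c zero * v zero p) _) ⟩
    l ∙ (V.combination _ (c ∘ suc) (v ∘ suc) +[ c zero ] v zero)
      ≈⟨ ∙-+[] l _ (v zero) (c zero) ⟩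
    (l ∙ V.combination _ (c ∘ suc) (v ∘ suc)) + c zero * (l ∙ v zero)
      ≈⟨ +-comm _ _ ⟩
    c zero * (l ∙ v zero) + (l ∙ V.combination _ (c ∘ suc) (v ∘ suc))
      ≈⟨ +-congˡ (∙-combination l (c ∘ suc) (v ∘ suc)) ⟩
    c zero * (l ∙ v zero) + sum (λ i → c (suc i) * (l ∙ v (suc i))) ∎

  -- The linear map that sends the coordinate vectors to the vectors on the lines; its kernel is G.
  Φ : ∀ {r m} → (Fin m → Point r) → Point m → Point r
  Φ h x p = sum (λ i → x i * h i p)

  module _ {r m} (h : Fin m → Point r) where

    Φ-+[] : ∀ x c y → Φ h (x +[ c ] y) ≋ Φ h x +[ c ] Φ h y
    Φ-+[] x c y p = trans
      (sum-cong {f = λ i → (x i + c * y i) * h i p} {λ i → x i * h i p + c * (y i * h i p)}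
        (λ i → solve 4 (λ x c y h → (x :+ c :* y) :* h := x :* h :+ c :* (y :* h)) refl (x i) c (y i) (h i p)))
      (sum-+* c (λ i → x i * h i p) (λ i → y i * h i p))

    Φ-cong : ∀ {x y} → x ≋ y → Φ h x ≋ Φ h y
    Φ-cong {x} {y} q p = sum-cong {f = λ i → x i * h i p} {λ i → y i * h i p} (λ i → *-congʳ (q i))

    Φ-unit : ∀ i → Φ h (unit i) ≋ h i
    Φ-unit i p = sum-unit i (λ j → h j p)

    pullback : Point r → Point m
    pullback l i = l ∙ h i

    pullback-∙ : ∀ l x → (pullback l ∙ x) ≈ (l ∙ Φ h x)
    pullback-∙ l x = sym (trans
      (linear-expansion (λ x → l ∙ Φ h x) (λ q → ∙-cong (λ _ → refl) (Φ-cong q))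
        (λ x c y → trans (∙-cong (λ _ → refl) (Φ-+[] x c y)) (∙-+[] l (Φ h x) (Φ h y) c)) x)
      (sum-cong {f = λ i → x i * (l ∙ Φ h (unit i))} {λ i → (l ∙ h i) * x i}
        (λ i → trans (*-comm _ _) (*-congʳ (∙-cong (λ _ → refl) (Φ-unit i))))))

  module _ {r n m} (A : Arrangement r n) (essential : Arrangement.Essential A) (L : Lines A m) where
    open Arrangement A hiding (nonzero)
    open Lines L using (h; complete)
    open V r using (HasDimension)

    -- By essentiality every coordinate is a combination of the forms.
    nondegenerate : ∀ v → (∀ k → (form k ∙ v) ≈ 0#) → v ≋ origin
    nondegenerate v p i with essential (unit i)
    ... | k , ι , c , q = begin
      v i                                      ≈⟨ sum-unit i v ⟨
      unit i ∙ v                               ≈⟨ ∙-cong q (λ _ → refl) ⟩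
      V.combination r c (form ∘ ι) ∙ v         ≈⟨ ∙-comm _ v ⟩
      v ∙ V.combination r c (form ∘ ι)         ≈⟨ ∙-combination v c (form ∘ ι) ⟩
      sum (λ j → c j * (v ∙ form (ι j)))
        ≈⟨ sum-zero {f = λ j → c j * (v ∙ form (ι j))}
             (λ j → trans (*-congˡ (trans (∙-comm v (form (ι j))) (p (ι j)))) (zeroʳ (c j))) ⟩
      0# ∎

    -- The index set is what `complete` asks for, the projector is what the recursion computes with;
    -- a flat keeps both.
    record Flat : Set where
      field
        subset   : Subset n
        subspace : Projector r
        sound    : ∀ {v} → v ∈ᴾ subspace → ⋂H subset v
        exact    : ∀ {v} → ⋂H subset v → v ∈ᴾ subspace

    open Flat

    whole : Flat
    whole = record
      { subset = Subset.⊥ ; subspace = identity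
      ; sound = λ _ j j∈⊥ → ⊥-elim (Subset.∉⊥ j∈⊥) ; exact = λ _ → fixed λ i → refl }

    meet : (F : Flat) (j : Fin n) {w : Point r} → w ∈ᴾ subspace F → (form j ∙ w) ≈ 1# → Flat
    meet F j {w} w∈F p = record
      { subset   = subset F Subset.∪ Subset.⁅ j ⁆
      ; subspace = restrict (subspace F) (form j) w w∈F p
      ; sound    = λ {v} v∈ k k∈ → [ sound F (∈-restrict⁻₁ (subspace F) v∈) k
                                  , (λ k∈j → subst (λ z → (form z ∙ v) ≈ 0#) (≡.sym (Subset.x∈⁅y⁆⇒x≡y j k∈j))
                                               (∈-restrict⁻₂ (subspace F) v∈)) ]′
                                 (Subset.x∈p∪q⁻ (subset F) Subset.⁅ j ⁆ k∈)
      ; exact    = λ v∈ → ∈-restrict⁺ (subspace F)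
                     (exact F (λ k k∈ → v∈ k (Subset.p⊆p∪q Subset.⁅ j ⁆ k∈)))
                     (v∈ j (Subset.q⊆p∪q (subset F) Subset.⁅ j ⁆ (Subset.x∈⁅x⁆ j)))
      }

    _⊆ᶠ_ : Flat → Flat → Set
    F ⊆ᶠ G = ∀ {v} → v ∈ᴾ subspace F → v ∈ᴾ subspace G

    module _ (j : Fin n) where

      -- As soon as `form j` is not zero on the flat, this says that `form k` is a multiple of it
      -- there. In terms of zeros the property passes at once to smaller flats.
      Multiple : Flat → Fin n → Set
      Multiple F k = (∀ v → v ∈ᴾ subspace F → (form k ∙ v) ≈ 0#) ⊎
                     (∀ v → v ∈ᴾ subspace F → (form k ∙ v) ≈ 0# → (form j ∙ v) ≈ 0#)

      multiple-⊆ : ∀ {F G} → F ⊆ᶠ G → ∀ {k} → Multiple G k → Multiple F k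
      multiple-⊆ s (inj₁ p) = inj₁ λ v v∈ → p v (s v∈)
      multiple-⊆ s (inj₂ p) = inj₂ λ v v∈ → p v (s v∈)

      record Shrunk (F : Flat) (ks : List (Fin n)) : Set where
        field
          flat      : Flat
          ⊆F        : flat ⊆ᶠ F
          w         : Point r
          w∈        : w ∈ᴾ subspace flat
          form-w    : (form j ∙ w) ≈ 1#
          multiples : All (Multiple flat) ks

      -- Greedily intersect with every hyperplane that keeps the flat outside of H_j:
      -- all forms then restrict to multiples of form j, so that a line is left.
      shrink : ∀ ks F {w} → w ∈ᴾ subspace F → (form j ∙ w) ≈ 1# → Shrunk F ks
      shrink []       F {w} w∈ p = record { flat = F ; ⊆F = λ v∈ → v∈ ; w = w ; w∈ = w∈ ; form-w = p ; multiples = [] }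
      shrink (k ∷ ks) F {w} w∈ p = case-k (vanishes? (subspace F) (form k))
        where
        keep : Multiple F k → Shrunk F (k ∷ ks)
        keep q = record
          { flat = flat ; ⊆F = ⊆F ; w = Shrunk.w rest ; w∈ = w∈′ ; form-w = form-w
          ; multiples = multiple-⊆ {flat} {F} ⊆F q ∷ multiples }
          where
          rest = shrink ks F w∈ p
          open Shrunk rest hiding (w) renaming (w∈ to w∈′)
        case-k : (∀ v → v ∈ᴾ subspace F → (form k ∙ v) ≈ 0#) ⊎ (∃ λ u → u ∈ᴾ subspace F × (form k ∙ u) ≈ 1#) →
                 Shrunk F (k ∷ ks)
        case-k (inj₁ q) = keep (inj₁ q)
        case-k (inj₂ (u , u∈ , q)) = case-j (vanishes? (subspace (meet F k u∈ q)) (form j))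
          where
          case-j : _ → Shrunk F (k ∷ ks)
          case-j (inj₁ z) = keep (inj₂ λ v v∈ kv≈0 → z v (∈-restrict⁺ (subspace F) v∈ kv≈0))
          case-j (inj₂ (x , x∈ , jx≈1)) = record
            { flat = flat ; ⊆F = λ v∈ → ∈-restrict⁻₁ (subspace F) (⊆F v∈) ; w = Shrunk.w rest ; w∈ = w∈′ ; form-w = form-w
            ; multiples = inj₁ (λ v v∈ → ∈-restrict⁻₂ (subspace F) (⊆F v∈)) ∷ multiples }
            where
            rest = shrink ks (meet F k u∈ q) x∈ jx≈1
            open Shrunk rest hiding (w) renaming (w∈ to w∈′)

      -- On the shrunken flat all forms are multiples of `form j`, so a vector killed by `form j` is
      -- killed by all of them and is 0. The flat is thus the line of `w`, and `complete` finds it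
      -- in the list.
      line-off : ∀ F {w} → w ∈ᴾ subspace F → (form j ∙ w) ≈ 1# →
                 ∃ λ i → h i ∈ᴾ subspace F × ¬ (form j ∙ h i) ≈ 0#
      line-off F w∈F p = i , ⊆F (exact flat (proj₂ equal hi∈line)) , λ q → 1≉0 (begin
        1#                                          ≈⟨ form-w ⟨
        form j ∙ w                                  ≈⟨ ∙-cong (λ _ → refl) (proj₂ (proj₂ (proj₂ w∈line))) ⟩
        form j ∙ V.combination r c (λ _ → h i)      ≈⟨ ∙-combination (form j) c (λ _ → h i) ⟩
        sum (λ j′ → c j′ * (form j ∙ h i))
          ≈⟨ sum-zero {f = λ j′ → c j′ * (form j ∙ h i)} (λ j′ → trans (*-congˡ q) (zeroʳ (c j′))) ⟩
        0#                                          ∎)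
        where
        open Shrunk (shrink (List.allFin n) F w∈F p)
        proportional : ∀ {v} → v ∈ᴾ subspace flat → v ≋ origin +[ form j ∙ v ] w
        proportional {v} v∈ p = begin
          v p
            ≈⟨ solve 3 (λ v x w → v := v :+ (:- x) :* w :+ x :* w) refl (v p) (form j ∙ v) (w p) ⟩
          v′ p + (form j ∙ v) * w p
            ≈⟨ +-congʳ (nondegenerate v′ (λ k → vanish k (All.lookup multiples (∈-allFin k))) p) ⟩
          0# + (form j ∙ v) * w p ∎
          where
          v′ = project (form j) w v
          v′∈ = project-∈-restrict (subspace flat) {w∈P = w∈} {form-w} v∈
          jv′≈0 = ∈-restrict⁻₂ (subspace flat) v′∈
          vanish : ∀ k → Multiple flat k → (form k ∙ v′) ≈ 0#
          vanish k (inj₁ z) = z v′ (∈-restrict⁻₁ (subspace flat) v′∈)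
          vanish k (inj₂ z) with (form k ∙ v′) ≟ 0#
          ... | yes e = e
          -- If `form k` is not zero at `v′`, some w + x v′ is a zero of it, while `form j` still
          -- takes the value 1 there. This contradicts the inclusion of kernels.
          ... | no ne with invertible _ ne
          ...   | y , e = ⊥-elim (1≉0 (begin
            1#
              ≈⟨ solve 1 (λ x → 𝟙 := 𝟙 :+ x :* 𝟘) refl x ⟩
            1# + x * 0#
              ≈⟨ +-cong form-w (*-congˡ jv′≈0) ⟨
            (form j ∙ w) + x * (form j ∙ v′)
              ≈⟨ ∙-+[] (form j) w v′ x ⟨
            form j ∙ (w +[ x ] v′)
              ≈⟨ z _ (∈ᴾ-+[] (subspace flat) x w∈ (∈-restrict⁻₁ (subspace flat) v′∈)) (begin
                   form k ∙ (w +[ x ] v′)              ≈⟨ ∙-+[] (form k) w v′ x ⟩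
                   (form k ∙ w) + x * (form k ∙ v′)
                     ≈⟨ solve 3 (λ a b y → a :+ (:- (a :* y)) :* b := a :* (𝟙 :- b :* y)) refl (form k ∙ w) (form k ∙ v′) y ⟩
                   (form k ∙ w) * (1# - (form k ∙ v′) * y)   ≈⟨ *-congˡ (trans (+-congˡ (-‿cong e)) (-‿inverseʳ 1#)) ⟩
                   (form k ∙ w) * 0#                         ≈⟨ zeroʳ _ ⟩
                   0# ∎) ⟩
            0# ∎))
            where x = - ((form k ∙ w) * y)
        one-dimensional : HasDimension (⋂H (subset flat)) 1
        one-dimensional = record
          { basis       = λ _ → w
          ; basis∈P     = λ _ → sound flat w∈
          ; independent = λ { c q zero → begin
              c zero                                ≈⟨ solve 1 (λ x → x := x :* 𝟙 :+ 𝟘) refl (c zero) ⟩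
              c zero * 1# + 0#                      ≈⟨ +-congʳ (*-congˡ form-w) ⟨
              c zero * (form j ∙ w) + 0#            ≈⟨ ∙-combination (form j) c (λ _ → w) ⟨
              form j ∙ V.combination r c (λ _ → w)  ≈⟨ ∙-cong (λ _ → refl) q ⟩
              form j ∙ origin                       ≈⟨ ∙-origin (form j) ⟩
              0# ∎ }
          ; spanning    = λ v v∈ → 1 , (λ i → i) , (λ _ → form j ∙ v) , λ p →
              trans (proportional (exact flat v∈) p) (trans (+-identityˡ _) (sym (+-identityʳ _)))
          }
        found = complete (subset flat) one-dimensional
        i = proj₁ found
        equal = proj₂ found
        hi∈line : line (h i) (h i)
        hi∈line = 1 , _ , (λ _ → 1#) , λ p → solve 1 (λ x → x := 𝟙 :* x :+ 𝟘) refl (h i p)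
        w∈line = proj₁ equal (sound flat w∈)
        c = proj₁ (proj₂ (proj₂ w∈line))

    LineCombination : Flat → Point r → Set
    LineCombination F v = ∃ λ x → v ≋ Φ h x × (∀ i → x i ≈ 0# ⊎ h i ∈ᴾ subspace F)

    -- If some form is not zero on the flat, `line-off` gives a line of the flat outside its
    -- hyperplane. Subtracting a multiple of that line moves `v` into the hyperplane, and the
    -- smaller flat is treated in the same way until all forms vanish.
    lines-span : ∀ F {v} → v ∈ᴾ subspace F → LineCombination F v
    lines-span F = scan (List.allFin n) F (λ k → inj₁ (∈-allFin k))
      where
      scan : ∀ ks F → (∀ k → k ∈ ks ⊎ (∀ v → v ∈ᴾ subspace F → (form k ∙ v) ≈ 0#)) →
             ∀ {v} → v ∈ᴾ subspace F → LineCombination F v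
      scan [] F done {v} v∈ = origin
        , (λ p → trans (nondegenerate v (λ k → [ (λ ()) , (λ z → z v v∈) ]′ (done k)) p)
                       (sym (sum-zero {f = λ i → 0# * h i p} (λ i → zeroˡ (h i p)))))
        , λ i → inj₁ refl
      scan (k ∷ ks) F done {v} v∈ = cases (vanishes? (subspace F) (form k))
        where
        cases : _ → LineCombination F v
        cases (inj₁ p) = scan ks F (λ k′ → [ (λ { (here ≡.refl) → inj₂ p ; (there q) → inj₁ q }) , inj₂ ]′ (done k′)) v∈
        cases (inj₂ (w , w∈ , p)) = normalise (line-off k F w∈ p)
          where
          module _ {i} (hi∈F : h i ∈ᴾ subspace F) {y} (e : (form k ∙ h i) * y ≈ 1#) where
            u : Point r
            u = origin +[ y ] h i
            u∈F : u ∈ᴾ subspace F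
            u∈F = ∈ᴾ-+[] (subspace F) y (∈ᴾ-origin (subspace F)) hi∈F
            ku≈1 : (form k ∙ u) ≈ 1#
            ku≈1 = begin
              form k ∙ u                                ≈⟨ ∙-+[] (form k) origin (h i) y ⟩
              (form k ∙ origin) + y * (form k ∙ h i)    ≈⟨ +-cong (∙-origin (form k)) (trans (*-comm _ _) e) ⟩
              0# + 1#                                   ≈⟨ +-identityˡ 1# ⟩
              1#                                        ∎
            done′ : ∀ k′ → k′ ∈ ks ⊎ (∀ v → v ∈ᴾ subspace (meet F k u∈F ku≈1) → (form k′ ∙ v) ≈ 0#)
            done′ k′ = [ (λ { (here ≡.refl) → inj₂ (λ v v∈′ → ∈-restrict⁻₂ (subspace F) v∈′) ; (there q) → inj₁ q })
                       , (λ z → inj₂ λ v v∈′ → z v (∈-restrict⁻₁ (subspace F) v∈′)) ]′ (done k′)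
            extend : LineCombination (meet F k u∈F ku≈1) (project (form k) u v) → LineCombination F v
            extend (x , r , s) = (x +[ z ] unit i) , sums , λ i′ → decide i′ (i Fin.≟ i′) (s i′)
              where
              z = (form k ∙ v) * y
              sums : v ≋ Φ h (x +[ z ] unit i)
              sums p = begin
                v p
                  ≈⟨ solve 4 (λ v a y h → v := v :+ (:- a) :* (𝟘 :+ y :* h) :+ a :* y :* h) refl (v p) (form k ∙ v) y (h i p) ⟩
                project (form k) u v p + z * h i p
                  ≈⟨ +-cong (r p) (*-congˡ (sym (Φ-unit h i p))) ⟩
                Φ h x p + z * Φ h (unit i) p
                  ≈⟨ Φ-+[] h x z (unit i) p ⟨
                Φ h (x +[ z ] unit i) p ∎
              decide : ∀ i′ → Dec (i ≡ i′) → x i′ ≈ 0# ⊎ h i′ ∈ᴾ subspace (meet F k u∈F ku≈1) →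
                       x i′ + z * unit i i′ ≈ 0# ⊎ h i′ ∈ᴾ subspace F
              decide i′ (yes ≡.refl) _        = inj₂ hi∈F
              decide i′ (no i≢i′)    (inj₁ p) = inj₁ (trans (+-cong p (*-congˡ (unit-≢ i≢i′)))
                (solve 1 (λ z → 𝟘 :+ z :* 𝟘 := 𝟘) refl z))
              decide i′ (no i≢i′)    (inj₂ p) = inj₂ (∈-restrict⁻₁ (subspace F) p)
            result : LineCombination F v
            result = extend (scan ks (meet F k u∈F ku≈1) done′ (project-∈-restrict (subspace F) v∈))
          normalise : (∃ λ i → h i ∈ᴾ subspace F × ¬ (form k ∙ h i) ≈ 0#) → LineCombination F v
          normalise (i , hi∈F , q) = result hi∈F (proj₂ (invertible _ q))

    lift : ∀ v → ∃ λ x → Φ h x ≋ v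
    lift v = let x , p , _ = lines-span whole {v} (fixed λ i → refl) in x , λ p′ → sym (p p′)

    line-off-hyperplane : ∀ j → ∃ λ i → ¬ (form j ∙ h i) ≈ 0#
    line-off-hyperplane j = cases (vanishes? identity (form j))
      where
      cases : _ → ∃ λ i → ¬ (form j ∙ h i) ≈ 0#
      cases (inj₁ p) = ⊥-elim (Arrangement.nonzero A j λ i → trans (sym (sum-unit i (form j)))
                         (trans (∙-comm (unit i) (form j)) (p (unit i) (fixed λ _ → refl))))
      cases (inj₂ (w , w∈ , p)) = let i , _ , q = line-off j whole w∈ p in i , q

-- Polynomials and their values

module PolynomialEvaluation (K : CharacteristicZeroField) where
  open ArrangementGeometry K public
  open Polynomials rawRing using (Poly; coeff; _•_; polyRing; var; substitute) public

  private
    module PolyRing (k : ℕ) = RawRing (polyRing k)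

  power : ∀ {k} → Monomial k → Point k → Carrier
  power []      x = 1#
  power (e ∷ α) x = x zero ^ e * power α (x ∘ suc)

  eval : ∀ {k} → Poly k → Point k → Carrier
  eval []            x = 0#
  eval ((c , α) ∷ p) x = c * power α x + eval p x

  ^-cong : ∀ e {x y} → x ≈ y → x ^ e ≈ y ^ e
  ^-cong zero    p = refl
  ^-cong (suc e) p = *-cong p (^-cong e p)

  ^-+ : ∀ x d e → x ^ (d ℕ.+ e) ≈ x ^ d * x ^ e
  ^-+ x zero    e = sym (*-identityˡ _)
  ^-+ x (suc d) e = trans (*-congˡ (^-+ x d e)) (sym (*-assoc _ _ _))

  ^-* : ∀ x y e → (x * y) ^ e ≈ x ^ e * y ^ e
  ^-* x y zero    = sym (*-identityˡ 1#)
  ^-* x y (suc e) = trans (*-congˡ (^-* x y e))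
    (solve 4 (λ x y a b → x :* y :* (a :* b) := x :* a :* (y :* b)) refl x y (x ^ e) (y ^ e))

  power-cong : ∀ {k} (α : Monomial k) {x y} → x ≋ y → power α x ≈ power α y
  power-cong []      p = refl
  power-cong (e ∷ α) p = *-cong (^-cong e (p zero)) (power-cong α (p ∘ suc))

  power-⊕ : ∀ {k} (α β : Monomial k) x → power (α ⊕ β) x ≈ power α x * power β x
  power-⊕ []      []      x = sym (*-identityˡ 1#)
  power-⊕ (d ∷ α) (e ∷ β) x = trans (*-cong (^-+ (x zero) d e) (power-⊕ α β (x ∘ suc)))
    (solve 4 (λ a b c d → a :* b :* (c :* d) := a :* c :* (b :* d)) refl
      (x zero ^ d) (x zero ^ e) (power α (x ∘ suc)) (power β (x ∘ suc)))

  power-* : ∀ {k} (α : Monomial k) x y → power α (λ i → x i * y i) ≈ power α x * power α y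
  power-* []      x y = sym (*-identityˡ 1#)
  power-* (e ∷ α) x y = trans (*-cong (^-* (x zero) (y zero) e) (power-* α (x ∘ suc) (y ∘ suc)))
    (solve 4 (λ a b c d → a :* b :* (c :* d) := a :* c :* (b :* d)) refl
      (x zero ^ e) (y zero ^ e) (power α (x ∘ suc)) (power α (y ∘ suc)))

  power-0 : ∀ {k} (x : Point k) → power (Vec.replicate k 0) x ≈ 1#
  power-0 {zero}  x = refl
  power-0 {suc k} x = trans (*-identityˡ _) (power-0 (x ∘ suc))

  power-1 : ∀ {k} (α : Monomial k) → power α (λ _ → 1#) ≈ 1#
  power-1 []      = refl
  power-1 (e ∷ α) = trans (*-cong (one e) (power-1 α)) (*-identityˡ 1#)
    where
    one : ∀ e → 1# ^ e ≈ 1#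
    one zero    = refl
    one (suc e) = trans (*-identityˡ _) (one e)

  power-unit : ∀ {k} (i : Fin k) x → power (Vec.updateAt (Vec.replicate k 0) i suc) x ≈ x i
  power-unit zero    x = trans (*-congˡ (power-0 (x ∘ suc))) (trans (*-identityʳ _) (*-identityʳ _))
  power-unit (suc i) x = trans (*-identityˡ _) (power-unit i (x ∘ suc))

  power-scale : ∀ {k} (α : Monomial k) τ x → power α (λ i → τ * x i) ≈ τ ^ Vec.sum α * power α x
  power-scale []      τ x = sym (*-identityˡ 1#)
  power-scale (e ∷ α) τ x = begin
    (τ * x zero) ^ e * power α (λ i → τ * x (suc i))
      ≈⟨ *-cong (^-* τ (x zero) e) (power-scale α τ (x ∘ suc)) ⟩
    τ ^ e * x zero ^ e * (τ ^ Vec.sum α * power α (x ∘ suc))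
      ≈⟨ solve 4 (λ a b c d → a :* b :* (c :* d) := a :* c :* (b :* d)) refl
           (τ ^ e) (x zero ^ e) (τ ^ Vec.sum α) (power α (x ∘ suc)) ⟩
    τ ^ e * τ ^ Vec.sum α * (x zero ^ e * power α (x ∘ suc))
      ≈⟨ *-congʳ (^-+ τ e (Vec.sum α)) ⟨
    τ ^ (e ℕ.+ Vec.sum α) * (x zero ^ e * power α (x ∘ suc)) ∎

  module _ {k : ℕ} where

    eval-≋ : ∀ (p : Poly k) {x y} → x ≋ y → eval p x ≈ eval p y
    eval-≋ []            q = refl
    eval-≋ ((c , α) ∷ p) q = +-cong (*-congˡ (power-cong α q)) (eval-≋ p q)

    eval-++ : ∀ (p q : Poly k) x → eval (p ++ q) x ≈ eval p x + eval q x
    eval-++ []      q x = sym (+-identityˡ _)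
    eval-++ (t ∷ p) q x = trans (+-congˡ (eval-++ p q x)) (sym (+-assoc _ _ _))

    eval-• : ∀ a (p : Poly k) x → eval (a • p) x ≈ a * eval p x
    eval-• a []            x = sym (zeroʳ a)
    eval-• a ((c , α) ∷ p) x = trans (+-cong (*-assoc _ _ _) (eval-• a p x)) (sym (distribˡ a _ _))

    eval-1 : ∀ x → eval (PolyRing.1# k) x ≈ 1#
    eval-1 x = trans (+-identityʳ _) (trans (*-identityˡ _) (power-0 x))

    eval-* : ∀ (p q : Poly k) x → eval (PolyRing._*_ k p q) x ≈ eval p x * eval q x
    eval-* []            q x = sym (zeroˡ _)
    eval-* ((c , α) ∷ p) q x = begin
      eval (List.map (λ (b , β) → (c * b , α ⊕ β)) q ++ PolyRing._*_ k p q) x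
        ≈⟨ eval-++ (List.map (λ (b , β) → (c * b , α ⊕ β)) q) _ x ⟩
      eval (List.map (λ (b , β) → (c * b , α ⊕ β)) q) x + eval (PolyRing._*_ k p q) x
        ≈⟨ +-cong (row q) (eval-* p q x) ⟩
      c * power α x * eval q x + eval p x * eval q x
        ≈⟨ distribʳ _ _ _ ⟨
      (c * power α x + eval p x) * eval q x ∎
      where
      row : ∀ q → eval (List.map (λ (b , β) → (c * b , α ⊕ β)) q) x ≈ c * power α x * eval q x
      row []            = sym (zeroʳ _)
      row ((b , β) ∷ q) = trans (+-cong (*-congˡ (power-⊕ α β x)) (row q))
        (solve 5 (λ c b y z w → c :* b :* (y :* z) :+ c :* y :* w := c :* y :* (b :* z :+ w)) refl
          c b (power α x) (power β x) (eval q x))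

    eval-var : ∀ i (x : Point k) → eval (var i) x ≈ x i
    eval-var i x = trans (+-identityʳ _) (trans (*-identityˡ _) (power-unit i x))

    module PolyOps = RawSemiringDefinitions (RawRing.rawSemiring (polyRing k))

    eval-^ : ∀ (p : Poly k) e x → eval (p PolyOps.^ e) x ≈ eval p x ^ e
    eval-^ p zero    x = eval-1 x
    eval-^ p (suc e) x = trans (eval-* p (p PolyOps.^ e) x) (*-congˡ (eval-^ p e x))

    eval-monomial-product : ∀ {j} (σ : Fin j → Poly k) (α : Monomial j) x →
      eval (PolyOps.product (λ i → σ i PolyOps.^ lookup α i)) x ≈ power α (λ i → eval (σ i) x)
    eval-monomial-product σ []      x = eval-1 x
    eval-monomial-product σ (e ∷ α) x = trans
      (eval-* (σ zero PolyOps.^ e) (PolyOps.product (λ i → σ (suc i) PolyOps.^ lookup α i)) x)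
      (*-cong (eval-^ (σ zero) e x) (eval-monomial-product (σ ∘ suc) α x))

    eval-substitute : ∀ {j} (σ : Fin j → Poly k) (p : Poly j) x →
                      eval (substitute σ p) x ≈ eval p (λ i → eval (σ i) x)
    eval-substitute σ []            x = refl
    eval-substitute σ ((c , α) ∷ p) x = begin
      eval (c • PolyOps.product (λ i → σ i PolyOps.^ lookup α i) ++ substitute σ p) x
        ≈⟨ eval-++ (c • PolyOps.product (λ i → σ i PolyOps.^ lookup α i)) _ x ⟩
      eval (c • PolyOps.product (λ i → σ i PolyOps.^ lookup α i)) x + eval (substitute σ p) x
        ≈⟨ +-cong (trans (eval-• c (PolyOps.product (λ i → σ i PolyOps.^ lookup α i)) x)
                         (*-congˡ (eval-monomial-product σ α x)))
                  (eval-substitute σ p x) ⟩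
      c * power α (λ i → eval (σ i) x) + eval p (λ i → eval (σ i) x) ∎

    eval-combination : ∀ {j} (c : Fin j → Carrier) (p : Fin j → Poly k) x →
      eval (LinearAlgebra.combination rawRing (Polynomials.polyModule rawRing k) c p) x ≈ sum (λ i → c i * eval (p i) x)
    eval-combination {zero}  c p x = refl
    eval-combination {suc j} c p x = trans (eval-++ (c zero • p zero) _ x)
      (+-cong (eval-• (c zero) (p zero) x) (eval-combination (c ∘ suc) (p ∘ suc) x))

    coeff-++ : ∀ (p q : Poly k) α → coeff (p ++ q) α ≈ coeff p α + coeff q α
    coeff-++ []      q α = sym (+-identityˡ _)
    coeff-++ (t ∷ p) q α = trans (+-congˡ (coeff-++ p q α)) (sym (+-assoc _ _ _))

    term-≡ : ∀ c (α : Monomial k) → (if does (≡-decℕ α α) then c else 0#) ≈ c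
    term-≡ c α rewrite dec-true (≡-decℕ α α) ≡.refl = refl

    term-≢ : ∀ c (α β : Monomial k) → α ≢ β → (if does (≡-decℕ α β) then c else 0#) ≈ 0#
    term-≢ c α β p rewrite dec-false (≡-decℕ α β) p = refl

    coeff-• : ∀ a (p : Poly k) α → coeff (a • p) α ≈ a * coeff p α
    coeff-• a []            α = sym (zeroʳ a)
    coeff-• a ((c , β) ∷ p) α = trans (+-cong (scale (≡-decℕ β α)) (coeff-• a p α)) (sym (distribˡ a _ _))
      where
      scale : (d : Dec (β ≡ α)) → (if does d then a * c else 0#) ≈ a * (if does d then c else 0#)
      scale (yes _) = refl
      scale (no _)  = sym (zeroʳ a)

  slice : ∀ {k} → ℕ → Poly (suc k) → Poly k
  slice e []                  = []
  slice e ((c , e′ ∷ α) ∷ p) with e′ ℕ.≟ e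
  ... | yes _ = (c , α) ∷ slice e p
  ... | no _  = slice e p

  coeff-slice : ∀ {k} e (p : Poly (suc k)) α → coeff (slice e p) α ≈ coeff p (e ∷ α)
  coeff-slice e []                 α = refl
  coeff-slice e ((c , e′ ∷ β) ∷ p) α with e′ ℕ.≟ e
  ... | yes ≡.refl = +-cong (lemma (≡-decℕ β α)) (coeff-slice e p α)
    where
    lemma : (d : Dec (β ≡ α)) → (if does d then c else 0#) ≈ (if does (≡-decℕ (e ∷ β) (e ∷ α)) then c else 0#)
    lemma (yes ≡.refl) = sym (term-≡ c (e ∷ β))
    lemma (no β≢α)     = sym (term-≢ c (e ∷ β) (e ∷ α) (β≢α ∘ Vec.∷-injectiveʳ))
  ... | no e′≢e = trans (coeff-slice e p α) (sym (trans
    (+-congʳ (term-≢ c (e′ ∷ β) (e ∷ α) (e′≢e ∘ Vec.∷-injectiveˡ))) (+-identityˡ _)))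

  private
    -- The Kronecker symbol times `y`, by recursion on both indices so that it follows the recursion
    -- of `horner` along `dense`.
    δ : ℕ → ℕ → Carrier → Carrier
    δ zero    zero    y = y
    δ (suc d) (suc e) y = δ d e y
    δ zero    (suc e) y = 0#
    δ (suc d) zero    y = 0#

    δ-≡ : ∀ d y → δ d d y ≈ y
    δ-≡ zero    y = refl
    δ-≡ (suc d) y = δ-≡ d y

    δ-≢ : ∀ d e y → d ≢ e → δ d e y ≈ 0#
    δ-≢ zero    zero    y p = ⊥-elim (p ≡.refl)
    δ-≢ zero    (suc e) y p = refl
    δ-≢ (suc d) zero    y p = refl
    δ-≢ (suc d) (suc e) y p = δ-≢ d e y (p ∘ cong suc)

  dense : (ℕ → Carrier) → ℕ → List Carrier
  dense F N = List.applyUpTo F N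

  horner-dense-+ : ∀ {F G H : ℕ → Carrier} N x → (∀ e → F e ≈ G e + H e) →
                   horner (dense F N) x ≈ horner (dense G N) x + horner (dense H N) x
  horner-dense-+ zero    x p = sym (+-identityˡ 0#)
  horner-dense-+ {F} {G} {H} (suc N) x p = trans (+-cong (p 0) (*-congˡ (horner-dense-+ N x (p ∘ suc))))
    (solve 5 (λ a b x y z → a :+ b :+ x :* (y :+ z) := a :+ x :* y :+ (b :+ x :* z)) refl
      (G 0) (H 0) x (horner (dense (G ∘ suc) N) x) (horner (dense (H ∘ suc) N) x))

  horner-dense-0 : ∀ {F : ℕ → Carrier} N x → (∀ e → F e ≈ 0#) → horner (dense F N) x ≈ 0#
  horner-dense-0 zero    x p = refl
  horner-dense-0 (suc N) x p = trans (+-cong (p 0) (trans (*-congˡ (horner-dense-0 N x (p ∘ suc))) (zeroʳ x))) (+-identityˡ 0#)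

  horner-dense-δ : ∀ d N x y → d ℕ.< N → horner (dense (λ e → δ d e y) N) x ≈ x ^ d * y
  horner-dense-δ zero    (suc N) x y _ = trans
    (+-congˡ (trans (*-congˡ (horner-dense-0 N x (λ _ → refl))) (zeroʳ x)))
    (trans (+-identityʳ y) (sym (*-identityˡ y)))
  horner-dense-δ (suc d) (suc N) x y (ℕ.s≤s l) = trans (+-identityˡ _)
    (trans (*-congˡ (horner-dense-δ d N x y l)) (sym (*-assoc _ _ _)))

  dense-zero : ∀ {F : ℕ → Carrier} N → All (_≈ 0#) (dense F N) → ∀ e → e ℕ.< N → F e ≈ 0#
  dense-zero (suc N) (p ∷ ps) zero    _         = p
  dense-zero (suc N) (p ∷ ps) (suc e) (ℕ.s≤s l) = dense-zero N ps e l

  headBound : ∀ {k} → Poly (suc k) → ℕ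
  headBound []                = 0
  headBound ((c , e ∷ α) ∷ p) = suc e ℕ.⊔ headBound p

  eval-slices : ∀ {k} (p : Poly (suc k)) N → headBound p ℕ.≤ N → ∀ x →
                eval p x ≈ horner (dense (λ e → eval (slice e p) (x ∘ suc)) N) (x zero)
  eval-slices []                N _ x = sym (horner-dense-0 N (x zero) (λ _ → refl))
  eval-slices ((c , e ∷ α) ∷ p) N l x = begin
    c * (x zero ^ e * power α (x ∘ suc)) + eval p x
      ≈⟨ +-cong (solve 3 (λ a b c → a :* (b :* c) := b :* (a :* c)) refl c (x zero ^ e) (power α (x ∘ suc)))
                (eval-slices p N (ℕ.≤-trans (ℕ.m≤n⊔m (suc e) (headBound p)) l) x) ⟩
    x zero ^ e * (c * power α (x ∘ suc)) + horner (dense (λ e′ → eval (slice e′ p) (x ∘ suc)) N) (x zero)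
      ≈⟨ +-congʳ (horner-dense-δ e N (x zero) _ (ℕ.≤-trans (ℕ.m≤m⊔n (suc e) (headBound p)) l)) ⟨
    horner (dense (λ e′ → δ e e′ (c * power α (x ∘ suc))) N) (x zero) +
    horner (dense (λ e′ → eval (slice e′ p) (x ∘ suc)) N) (x zero)
      ≈⟨ horner-dense-+ N (x zero) step ⟨
    horner (dense (λ e′ → eval (slice e′ ((c , e ∷ α) ∷ p)) (x ∘ suc)) N) (x zero) ∎
    where
    step : ∀ e′ → eval (slice e′ ((c , e ∷ α) ∷ p)) (x ∘ suc) ≈
                  δ e e′ (c * power α (x ∘ suc)) + eval (slice e′ p) (x ∘ suc)
    step e′ with e ℕ.≟ e′
    ... | yes ≡.refl = +-congʳ (sym (δ-≡ e _))
    ... | no e≢e′    = sym (trans (+-congʳ (δ-≢ e e′ _ e≢e′)) (+-identityˡ _))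

  eval-constant : ∀ (p : Poly 0) x → eval p x ≈ coeff p []
  eval-constant []             x = refl
  eval-constant ((c , []) ∷ p) x = +-cong (*-identityʳ c) (eval-constant p x)

  -- Polynomials count as equal when their coefficients agree, however the terms are listed. This
  -- makes evaluation compatible with that equality, one variable at a time.
  eval-zero : ∀ {k} (p : Poly k) → (∀ α → coeff p α ≈ 0#) → ∀ x → eval p x ≈ 0#
  eval-zero {zero}  p q x = trans (eval-constant p x) (q [])
  eval-zero {suc k} p q x = trans (eval-slices p (headBound p) ℕ.≤-refl x)
    (horner-dense-0 (headBound p) (x zero) λ e →
      eval-zero (slice e p) (λ α → trans (coeff-slice e p α) (q (e ∷ α))) (x ∘ suc))

  -- Interpolation at 1, 2, 3 and so on in each variable uses only points without zero coordinates.
  -- The restriction matters later, where the coordinates belonging to the s-variables are inverted.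
  coeff-zero : ∀ {k} (p : Poly k) → (∀ x → (∀ i → ¬ x i ≈ 0#) → eval p x ≈ 0#) → ∀ α → coeff p α ≈ 0#
  coeff-zero {zero}  p q []      = trans (sym (eval-constant p (λ ()))) (q (λ ()) (λ ()))
  coeff-zero {suc k} p q (e ∷ α) = trans (sym (coeff-slice e p α)) (coeff-zero (slice e p) sliceZero α)
    where
    -- The list of slices must be long enough to contain slice `e` even if `p` has no such power.
    N = headBound p ℕ.⊔ suc e
    sliceZero : ∀ x → (∀ i → ¬ x i ≈ 0#) → eval (slice e p) x ≈ 0#
    sliceZero x x≉0 = dense-zero N
      (roots⇒zero (dense (λ e → eval (slice e p) x) N) (λ i → ι (suc i))
        (λ i j i<j → ι-separated (suc i) (suc j) (ℕ.s≤s i<j))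
        λ i → trans (sym (eval-slices p N (ℕ.m≤m⊔n (headBound p) (suc e)) (cons (ι (suc i)) x)))
                    (q (cons (ι (suc i)) x) λ { zero → suc×1≉0 i ; (suc j) → x≉0 j }))
      e (ℕ.m≤n⊔m (headBound p) (suc e))

  difference : ∀ {k} → Poly k → Poly k → Poly k
  difference p q = p ++ (- 1#) • q

  eval-difference : ∀ {k} (p q : Poly k) x → eval (difference p q) x ≈ eval p x - eval q x
  eval-difference p q x = trans (eval-++ p ((- 1#) • q) x) (trans (+-congˡ (eval-• (- 1#) q x))
    (solve 2 (λ a b → a :+ (:- 𝟙) :* b := a :- b) refl (eval p x) (eval q x)))

  coeff-difference : ∀ {k} (p q : Poly k) α → coeff (difference p q) α ≈ coeff p α - coeff q α
  coeff-difference p q α = trans (coeff-++ p ((- 1#) • q) α) (trans (+-congˡ (coeff-• (- 1#) q α))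
    (solve 2 (λ a b → a :+ (:- 𝟙) :* b := a :- b) refl (coeff p α) (coeff q α)))

  eval-cong : ∀ {k} (p q : Poly k) → (∀ α → coeff p α ≈ coeff q α) → ∀ x → eval p x ≈ eval q x
  eval-cong p q r x = x-y≈0⇒x≈y (trans (sym (eval-difference p q x))
    (eval-zero (difference p q) (λ α → trans (coeff-difference p q α) (x≈y⇒x-y≈0 (r α))) x))

  eval-injective : ∀ {k} (p q : Poly k) → (∀ x → (∀ i → ¬ x i ≈ 0#) → eval p x ≈ eval q x) →
                   ∀ α → coeff p α ≈ coeff q α
  eval-injective p q r α = x-y≈0⇒x≈y (trans (sym (coeff-difference p q α))
    (coeff-zero (difference p q) (λ x x≉0 → trans (eval-difference p q x) (x≈y⇒x-y≈0 (r x x≉0))) α))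

  -- The multigrading and setting s = 1

  module _ {m : ℕ} where

    multidegree : Monomial (m ℕ.+ m) → Vec ℕ (suc m)
    multidegree α = Vec.sum (Vec.drop m α) ∷ Vec.take m α ⊕ Vec.drop m α

    pair : Point m → Point m → Point (m ℕ.+ m)
    pair s x = [ s , x ]′ ∘ splitAt m

  power-pair : ∀ {m n} (α : Monomial (m ℕ.+ n)) (s : Point m) (x : Point n) →
               power α ([ s , x ]′ ∘ splitAt m) ≈ power (Vec.take m α) s * power (Vec.drop m α) x
  power-pair {zero}  α       s x = sym (*-identityˡ _)
  power-pair {suc m} (e ∷ α) s x = trans
    (*-congˡ (trans (power-cong α shift) (power-pair α (s ∘ suc) x))) (sym (*-assoc _ _ _))
    where
    shift : ∀ i → ([ s , x ]′ ∘ splitAt (suc m)) (suc i) ≈ ([ s ∘ suc , x ]′ ∘ splitAt m) i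
    shift i with splitAt m i
    ... | inj₁ _ = refl
    ... | inj₂ _ = refl

  module _ {m : ℕ} where

    -- Stronger than homogeneity, which speaks about total coefficients and tolerates terms of other
    -- degrees that cancel; `component` discards such terms.
    AllDegree : Vec ℕ (suc m) → Poly (m ℕ.+ m) → Set
    AllDegree δ = All (λ (c , α) → multidegree α ≡ δ)

    AllDegree⇒Homogeneous : ∀ {δ p} → AllDegree δ p → ∀ α → multidegree α ≢ δ → coeff p α ≈ 0#
    AllDegree⇒Homogeneous []       α q = refl
    AllDegree⇒Homogeneous {p = (c , β) ∷ p} (d ∷ ds) α q = trans
      (+-cong (term-≢ c β α λ { ≡.refl → q d }) (AllDegree⇒Homogeneous ds α q)) (+-identityˡ 0#)

    component : Vec ℕ (suc m) → Poly (m ℕ.+ m) → Poly (m ℕ.+ m)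
    component δ = List.filter (λ (c , α) → ≡-decℕ (multidegree α) δ)

    component-degree : ∀ δ p → AllDegree δ (component δ p)
    component-degree δ p = All.all-filter (λ (c , α) → ≡-decℕ (multidegree α) δ) p

    coeff-component : ∀ δ p α → multidegree α ≡ δ → coeff (component δ p) α ≈ coeff p α
    coeff-component δ []            α q = refl
    coeff-component δ ((c , β) ∷ p) α q with ≡-decℕ (multidegree β) δ
    ... | yes _ = +-congˡ (coeff-component δ p α q)
    ... | no r  = trans (coeff-component δ p α q)
      (sym (trans (+-congʳ (term-≢ c β α λ { ≡.refl → r q })) (+-identityˡ _)))

    component-≈ : ∀ δ p → (∀ α → multidegree α ≢ δ → coeff p α ≈ 0#) → ∀ α → coeff (component δ p) α ≈ coeff p α
    component-≈ δ p hom α with ≡-decℕ (multidegree α) δ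
    ... | yes q = coeff-component δ p α q
    ... | no ¬q = trans (AllDegree⇒Homogeneous (component-degree δ p) α ¬q) (sym (hom α ¬q))

    -- In a term with exponents σ of s and τ of t, degree `u` means σ + τ = u. Writing each x as s
    -- times x y therefore takes out the power `u` of s and leaves the value at s = 1.
    eval-rescale : ∀ {d u} {p : Poly (m ℕ.+ m)} → AllDegree (d ∷ u) p →
                   ∀ {s y : Point m} → (∀ i → s i * y i ≈ 1#) → ∀ (x : Point m) →
                   eval p (pair s x) ≈ power u s * eval p (pair (λ _ → 1#) (λ i → x i * y i))
    eval-rescale []       {s} {y} sy≈1 x = sym (zeroʳ _)
    eval-rescale {d} {u} {(c , α) ∷ p} (q ∷ qs) {s} {y} sy≈1 x = begin
      c * power α (pair s x) + eval p (pair s x)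
        ≈⟨ +-cong (*-congˡ (power-pair α s x)) (eval-rescale qs sy≈1 x) ⟩
      c * (power σ s * power τ x) + power u s * eval p (pair (λ _ → 1#) xy)
        ≈⟨ +-congʳ (*-congˡ (begin
             power σ s * power τ x
               ≈⟨ *-congˡ (power-cong τ (λ i → begin
                    x i                   ≈⟨ solve 1 (λ x → x := x :* 𝟙) refl (x i) ⟩
                    x i * 1#              ≈⟨ *-congˡ (sy≈1 i) ⟨
                    x i * (s i * y i)     ≈⟨ solve 3 (λ x s y → x :* (s :* y) := s :* (x :* y)) refl (x i) (s i) (y i) ⟩
                    s i * (x i * y i)     ∎)) ⟩
             power σ s * power τ (λ i → s i * xy i)
               ≈⟨ *-congˡ (power-* τ s xy) ⟩
             power σ s * (power τ s * power τ xy)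
               ≈⟨ *-assoc _ _ _ ⟨
             power σ s * power τ s * power τ xy
               ≈⟨ *-congʳ (power-⊕ σ τ s) ⟨
             power (σ ⊕ τ) s * power τ xy
               ≡⟨ cong (λ z → power z s * power τ xy) (Vec.∷-injectiveʳ q) ⟩
             power u s * power τ xy
               ≈⟨ *-congˡ (sym (trans (power-pair α (λ _ → 1#) xy) (trans (*-congʳ (power-1 σ)) (*-identityˡ _)))) ⟩
             power u s * power α (pair (λ _ → 1#) xy) ∎)) ⟩
      c * (power u s * power α (pair (λ _ → 1#) xy)) + power u s * eval p (pair (λ _ → 1#) xy)
        ≈⟨ solve 4 (λ c u a b → c :* (u :* a) :+ u :* b := u :* (c :* a :+ b)) refl
             c (power u s) (power α (pair (λ _ → 1#) xy)) (eval p (pair (λ _ → 1#) xy)) ⟩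
      power u s * (c * power α (pair (λ _ → 1#) xy) + eval p (pair (λ _ → 1#) xy)) ∎
      where
      σ = Vec.take m α
      τ = Vec.drop m α
      xy : Point m
      xy i = x i * y i

    eval-scale : ∀ {d u} {p : Poly (m ℕ.+ m)} → AllDegree (d ∷ u) p → ∀ τ (x : Point m) →
                 eval p (pair (λ _ → 1#) (λ i → τ * x i)) ≈ τ ^ d * eval p (pair (λ _ → 1#) x)
    eval-scale []       τ x = sym (zeroʳ _)
    eval-scale {d} {u} {(c , α) ∷ p} (q ∷ qs) τ x = begin
      c * power α (pair (λ _ → 1#) (λ i → τ * x i)) + eval p (pair (λ _ → 1#) (λ i → τ * x i))
        ≈⟨ +-cong (*-congˡ (trans (dehomogenise (λ i → τ * x i)) (power-scale β τ x))) (eval-scale qs τ x) ⟩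
      c * (τ ^ Vec.sum β * power β x) + τ ^ d * eval p (pair (λ _ → 1#) x)
        ≡⟨ cong (λ z → c * (τ ^ z * power β x) + τ ^ d * eval p (pair (λ _ → 1#) x)) (Vec.∷-injectiveˡ q) ⟩
      c * (τ ^ d * power β x) + τ ^ d * eval p (pair (λ _ → 1#) x)
        ≈⟨ solve 4 (λ c u a b → c :* (u :* a) :+ u :* b := u :* (c :* a :+ b)) refl
             c (τ ^ d) (power β x) (eval p (pair (λ _ → 1#) x)) ⟩
      τ ^ d * (c * power β x + eval p (pair (λ _ → 1#) x))
        ≈⟨ *-congˡ (+-congʳ (*-congˡ (dehomogenise x))) ⟨
      τ ^ d * (c * power α (pair (λ _ → 1#) x) + eval p (pair (λ _ → 1#) x)) ∎
      where
      β = Vec.drop m α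
      dehomogenise : ∀ (x : Point m) → power α (pair (λ _ → 1#) x) ≈ power β x
      dehomogenise x = trans (power-pair α (λ _ → 1#) x) (trans (*-congʳ (power-1 (Vec.take m α))) (*-identityˡ _))

-- Invariants as functions of bounded degree

module ZonotopalCoxRing (K : CharacteristicZeroField) {r n m : ℕ} where
  open PolynomialEvaluation K public

  module Invariants (A : Arrangement r n) (essential : Arrangement.Essential A) (L : Lines A m) where
    open Arrangement A using (form; IsRankFunction)
    open Lines L using (h)
    private
      module L = Lines L

    φ : Fin n → Point m
    φ j = pullback h (form j)

    tree : Tree n
    tree = proj₁ (resolve identity φ)

    resolution : Resolution identity φ tree
    resolution = proj₂ (resolve identity φ)

    ∈identity : ∀ {k} {x : Point k} → x ∈ᴾ identity
    ∈identity = fixed λ _ → refl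

    form-determined : ∀ l l′ → (∀ x → (pullback h l ∙ x) ≈ (pullback h l′ ∙ x)) → l ≋ l′
    form-determined l l′ p i with lift A essential L (unit i)
    ... | x , q = begin
      l i                    ≈⟨ coordinate l ⟩
      pullback h l ∙ x       ≈⟨ p x ⟩
      pullback h l′ ∙ x      ≈⟨ coordinate l′ ⟨
      l′ i                   ∎
      where
      coordinate : ∀ l → l i ≈ (pullback h l ∙ x)
      coordinate l = begin
        l i                  ≈⟨ sum-unit i l ⟨
        unit i ∙ l           ≈⟨ ∙-comm (unit i) l ⟩
        l ∙ unit i           ≈⟨ ∙-cong (λ _ → refl) q ⟨
        l ∙ Φ h x            ≈⟨ pullback-∙ h l x ⟨
        pullback h l ∙ x     ∎

    pullback-combination : ∀ {k} (c : Fin k → Carrier) (l : Fin k → Point r) x →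
      (pullback h (V.combination r c l) ∙ x) ≈ sum (λ i → c i * (pullback h (l i) ∙ x))
    pullback-combination {k} c l x = begin
      pullback h (V.combination r c l) ∙ x      ≈⟨ pullback-∙ h (V.combination r c l) x ⟩
      V.combination r c l ∙ Φ h x               ≈⟨ ∙-comm _ (Φ h x) ⟩
      Φ h x ∙ V.combination r c l               ≈⟨ ∙-combination (Φ h x) c l ⟩
      sum (λ i → c i * (Φ h x ∙ l i))
        ≈⟨ sum-cong {k} {λ i → c i * (Φ h x ∙ l i)} {λ i → c i * (pullback h (l i) ∙ x)}
             (λ i → *-congˡ (trans (∙-comm (Φ h x) (l i)) (sym (pullback-∙ h (l i) x)))) ⟩
      sum (λ i → c i * (pullback h (l i) ∙ x)) ∎

    -- The tree is built from the pulled back forms on K^m. As `Φ h` is onto, pulling back loses no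
    -- information, so spans and relations carry over to the forms on V.
    rank-isRankFunction : IsRankFunction (rank tree)
    rank-isRankFunction B = record
      { basis       = form ∘ index
      ; basis∈P     = λ i → 1 , (λ _ → index i , index∈ i) , (λ _ → 1#) ,
                            λ p → solve 1 (λ x → x := 𝟙 :* x :+ 𝟘) refl (form (index i) p)
      ; independent = λ c q → independent c λ x _ → begin
          sum (λ i → c i * (φ (index i) ∙ x))                  ≈⟨ pullback-combination c (form ∘ index) x ⟨
          pullback h (V.combination r c (form ∘ index)) ∙ x    ≈⟨ pullback-∙ h _ x ⟩
          V.combination r c (form ∘ index) ∙ Φ h x             ≈⟨ ∙-cong q (λ _ → refl) ⟩
          origin ∙ Φ h x                                       ≈⟨ ∙-comm origin (Φ h x) ⟩
          Φ h x ∙ origin                                       ≈⟨ ∙-origin (Φ h x) ⟩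
          0#                                                   ∎
      ; spanning    = λ { l (k , ι′ , c , q) → let e , s = expand c ι′ in
          rank tree B , (λ i → i) , e , λ p → trans (q p) (s p) }
      }
      where
      open IndependentForms (independentForms {φ = φ} resolution B)
      ρ = rank tree B
      element : ∀ (jB : ∃ (Subset._∈ B)) → ∃ λ (e : Point ρ) → form (proj₁ jB) ≋ V.combination r e (form ∘ index)
      element (j , j∈B) = let e , p = spanning j j∈B in
        e , form-determined _ _ (λ x → trans (p x ∈identity) (sym (pullback-combination e (form ∘ index) x)))
      expand : ∀ {k} (c : Fin k → Carrier) (ι′ : Fin k → ∃ (Subset._∈ B)) →
               ∃ λ (e : Point ρ) → V.combination r c (form ∘ proj₁ ∘ ι′) ≋ V.combination r e (form ∘ index)
      expand {zero}  c ι′ = origin , λ p → sym (trans (combination-apply origin (form ∘ index) p)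
        (sum-zero {ρ} {λ i → 0# * form (index i) p} (λ i → zeroˡ _)))
      expand {suc k} c ι′ = let e , q = expand (c ∘ suc) (ι′ ∘ suc) ; e′ , q′ = element (ι′ zero) in
        e +[ c zero ] e′ , λ p → begin
          c zero * form (proj₁ (ι′ zero)) p + V.combination r (c ∘ suc) (form ∘ proj₁ ∘ ι′ ∘ suc) p
            ≈⟨ +-cong (*-congˡ (trans (q′ p) (combination-apply e′ (form ∘ index) p)))
                      (trans (q p) (combination-apply e (form ∘ index) p)) ⟩
          c zero * Φ (form ∘ index) e′ p + Φ (form ∘ index) e p
            ≈⟨ +-comm _ _ ⟩
          Φ (form ∘ index) e p + c zero * Φ (form ∘ index) e′ p
            ≈⟨ Φ-+[] (form ∘ index) e (c zero) e′ p ⟨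
          Φ (form ∘ index) (e +[ c zero ] e′) p
            ≈⟨ combination-apply (e +[ c zero ] e′) (form ∘ index) p ⟨
          V.combination r (e +[ c zero ] e′) (form ∘ index) p ∎

    -- The directions in which an invariant polynomial has bounded degree: the coordinate
    -- directions, mapped by Φ h to the lines, and the kernel G of Φ h.

    Direction : Point m → Set
    Direction x = (∃ λ i → x ≡ unit i) ⊎ (Φ h x ≋ origin)

    -- The subspaces of the recursion are the preimages of flats, and every flat is spanned by its lines.
    record Good (Q : Projector m) : Set where
      field
        flat  : Flat A essential L
        image : ∀ {x} → x ∈ᴾ Q → Φ h x ∈ᴾ Flat.subspace flat
        preimage : ∀ {x} → Φ h x ∈ᴾ Flat.subspace flat → x ∈ᴾ Q

    identity-good : Good identity
    identity-good = record { flat = whole A essential L ; image = λ _ → ∈identity ; preimage = λ _ → ∈identity }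

    restrict-good : ∀ Q j w (w∈Q : w ∈ᴾ Q) (φw≈1 : (φ j ∙ w) ≈ 1#) → Good Q → Good (restrict Q (φ j) w w∈Q φw≈1)
    restrict-good Q j w w∈Q φw≈1 good = record
      { flat  = meet A essential L flat j (image w∈Q) (trans (sym (pullback-∙ h (form j) w)) φw≈1)
      ; image = λ {x} x∈ → ∈-restrict⁺ _ (image (∈-restrict⁻₁ Q x∈)) (trans (sym (pullback-∙ h (form j) x)) (∈-restrict⁻₂ Q x∈))
      ; preimage = λ {x} x∈ → ∈-restrict⁺ Q (preimage (∈-restrict⁻₁ _ x∈))
                                      (trans (pullback-∙ h (form j) x) (∈-restrict⁻₂ _ x∈))
      }
      where open Good good

    open Spanning Direction

    -- The path follows one summand after another and stays in the subspace; a vector with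
    -- coefficient 0 may lie outside and is skipped.
    constant-along-all : ∀ Q {g} → IsPolynomial g → ∀ {k} (v : Fin k → Point m) (c : Fin k → Carrier) →
      (∀ i → c i ≈ 0# ⊎ (v i ∈ᴾ Q × Degree< Q (v i) 1 g)) → ∀ x → x ∈ᴾ Q → g (x +[ 1# ] Φ v c) ≈ g x
    constant-along-all Q G {zero}  v c p x x∈ = polynomial-cong G (λ i → solve 1 (λ x → x :+ 𝟙 :* 𝟘 := x) refl (x i))
    constant-along-all Q {g} G {suc k} v c p x x∈ with p zero
    ... | inj₁ c≈0 = trans
      (polynomial-cong G (λ i → trans (+-congˡ (*-congˡ (+-congʳ (*-congʳ c≈0))))
        (solve 3 (λ x y z → x :+ 𝟙 :* (𝟘 :* y :+ z) := x :+ 𝟙 :* z) refl (x i) (v zero i) (Φ (v ∘ suc) (c ∘ suc) i))))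
      (constant-along-all Q G (v ∘ suc) (c ∘ suc) (p ∘ suc) x x∈)
    ... | inj₂ (v∈ , d) = begin
      g (x +[ 1# ] Φ v c)
        ≈⟨ polynomial-cong G (λ i → solve 4 (λ x c y z → x :+ 𝟙 :* (c :* y :+ z) := x :+ c :* y :+ 𝟙 :* z) refl
             (x i) (c zero) (v zero i) (Φ (v ∘ suc) (c ∘ suc) i)) ⟩
      g ((x +[ c zero ] v zero) +[ 1# ] Φ (v ∘ suc) (c ∘ suc))
        ≈⟨ constant-along-all Q G (v ∘ suc) (c ∘ suc) (p ∘ suc) _ (∈ᴾ-+[] Q (c zero) x∈ v∈) ⟩
      g (x +[ c zero ] v zero)
        ≈⟨ constant-along v∈ G d x x∈ (c zero) ⟩
      g x ∎

    -- The image of `x` is a combination, with coefficients `y`, of lines inside the flat. So `x`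
    -- and `y` differ by an element of G, along which `g` is constant, and `y` is reached from the
    -- origin through the coordinate directions of those lines.
    good-constant : ∀ Q → Good Q → ConstantIfFlat Q
    good-constant Q good {g} G deg x x∈Q = combine-lines (lines-span A essential L flat (image x∈Q))
      where
      open Good good
      combine-lines : LineCombination A essential L flat (Φ h x) → g x ≈ g origin
      combine-lines (y , q , lines) = begin
        g x
          ≈⟨ polynomial-cong G (λ i → solve 2 (λ x y → x := y :+ 𝟙 :* (x :+ (:- 𝟙) :* y)) refl (x i) (y i)) ⟩
        g (y +[ 1# ] k)
          ≈⟨ x-y≈0⇒x≈y (Δ^≈0 (deg k (inj₂ Φk≈0) k∈Q) y y∈Q) ⟩
        g y
          ≈⟨ polynomial-cong G (λ i → trans (linear-expansion (λ z → z i) (λ p → p i) (λ _ _ _ → refl) y)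
               (solve 1 (λ y → y := 𝟘 :+ 𝟙 :* y) refl (Φ unit y i))) ⟩
        g (origin +[ 1# ] Φ unit y)
          ≈⟨ constant-along-all Q G unit y directions origin (∈ᴾ-origin Q) ⟩
        g origin ∎
        where
        k : Point m
        k = x +[ - 1# ] y
        Φk≈0 : Φ h k ≋ origin
        Φk≈0 p = trans (Φ-+[] h x (- 1#) y p) (trans (+-congʳ (q p))
          (solve 1 (λ x → x :+ (:- 𝟙) :* x := 𝟘) refl (Φ h y p)))
        y∈Q : y ∈ᴾ Q
        y∈Q = preimage (∈ᴾ-resp (Flat.subspace flat) q (image x∈Q))
        k∈Q : k ∈ᴾ Q
        k∈Q = ∈ᴾ-+[] Q (- 1#) x∈Q y∈Q
        directions : ∀ i → y i ≈ 0# ⊎ (unit i ∈ᴾ Q × Degree< Q (unit i) 1 g)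
        directions i = [ inj₁ , (λ hi∈ → let u∈ = preimage (∈ᴾ-resp (Flat.subspace flat) (λ p → sym (Φ-unit h i p)) hi∈)
                                         in inj₂ (u∈ , deg (unit i) (inj₁ (i , ≡.refl)) u∈)) ]′ (lines i)

    dehomogenise : Poly (m ℕ.+ m) → Point m → Carrier
    dehomogenise p x = eval p (pair (λ _ → 1#) x)

    power-dehomogenise : ∀ α (x : Point m) → power α (pair (λ _ → 1#) x) ≈ monomial unit (Vec.drop m α) x
    power-dehomogenise α x = trans (power-pair α (λ _ → 1#) x)
      (trans (trans (*-congʳ (power-1 (Vec.take m α))) (*-identityˡ _)) (as-monomial unit (λ i → sym (sum-unit i x)) (Vec.drop m α)))
      where
      as-monomial : ∀ {k} {y : Point k} (ψ : Fin k → Point m) → (∀ i → y i ≈ (ψ i ∙ x)) → ∀ β → power β y ≈ monomial ψ β x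
      as-monomial ψ p []      = refl
      as-monomial ψ p (e ∷ β) = *-cong (^-cong e (p zero)) (as-monomial (ψ ∘ suc) (p ∘ suc) β)

    dehomogenise-polynomial : ∀ p → IsPolynomial (dehomogenise p)
    dehomogenise-polynomial []            = constant 0#
    dehomogenise-polynomial ((c , α) ∷ p) = respects (λ x → +-congʳ (*-congˡ (sym (power-dehomogenise α x))))
      ((constant c ⊠ monomial-polynomial unit (Vec.drop m α)) ⊞ dehomogenise-polynomial p)

    weight-unit : ∀ {k} (ψ : Fin k → Point m) (τ : Vec ℕ k) z i → (∀ j → j ≢ i → (ψ j ∙ z) ≈ 0#) → weight ψ τ z ℕ.≤ lookup τ i
    weight-unit ψ (e ∷ τ) z zero    p = ℕ.≤-trans
      (ℕ.+-mono-≤ (ℕ.*-monoˡ-≤ e (nonzero-≤1 ((ψ zero ∙ z) ≟ 0#))) (ℕ.≤-reflexive (weight-zero (ψ ∘ suc) τ λ j → p (suc j) λ ())))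
      (ℕ.≤-reflexive (≡.trans (ℕ.+-identityʳ _) (ℕ.*-identityˡ e)))
      where
      nonzero-≤1 : ∀ {x} → Dec (x ≈ 0#) → nonzero x ℕ.≤ 1
      nonzero-≤1 (yes q) = ℕ.≤-trans (ℕ.≤-reflexive (nonzero-0 q)) ℕ.z≤n
      nonzero-≤1 (no ¬q) = ℕ.≤-reflexive (nonzero-1 ¬q)
      weight-zero : ∀ {k} (ψ : Fin k → Point m) τ → (∀ j → (ψ j ∙ z) ≈ 0#) → weight ψ τ z ≡ 0
      weight-zero ψ []      p = ≡.refl
      weight-zero ψ (e ∷ τ) p = ≡.trans (weight-loop ψ e τ z (p zero)) (weight-zero (ψ ∘ suc) τ (p ∘ suc))
    weight-unit ψ (e ∷ τ) z (suc i) p = ℕ.≤-trans (ℕ.≤-reflexive (weight-loop ψ e τ z (p zero λ ())))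
      (weight-unit (ψ ∘ suc) τ z i (λ j j≢i → p (suc j) (j≢i ∘ Fin.suc-injective)))

    lookup-⊕ : ∀ {k} (σ τ : Vec ℕ k) i → lookup τ i ℕ.≤ lookup (σ ⊕ τ) i
    lookup-⊕ σ τ i = ℕ.≤-trans (ℕ.m≤n+m (lookup τ i) (lookup σ i)) (ℕ.≤-reflexive (≡.sym (Vec.lookup-zipWith ℕ._+_ i σ τ)))

    -- Since `u` is the sum of the exponents of s and t, the exponent of t in position `i` is at
    -- most the entry of `u` there.
    dehomogenise-degree : ∀ {d u p} → AllDegree (d ∷ u) p → ∀ i →
                          Degree< identity (unit i) (suc (lookup u i)) (dehomogenise p)
    dehomogenise-degree {u = u} []       i = degree-zero ∈identity (suc (lookup u i)) (λ _ _ → refl)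
    dehomogenise-degree {u = u} {(c , α) ∷ p} (q ∷ qs) i = degree-resp ∈identity
      (λ x _ → trans (+-comm _ _) (+-congʳ (*-congˡ (sym (power-dehomogenise α x)))))
      (degree-+* ∈identity c (dehomogenise-degree qs i)
        (degree-mono ∈identity (ℕ.s≤s bound) (degree-monomial ∈identity unit τ)))
      where
      τ = Vec.drop m α
      bound : weight unit τ (unit i) ℕ.≤ lookup u i
      bound = ℕ.≤-trans (weight-unit unit τ (unit i) i (λ j j≢i → trans (sum-unit j (unit i)) (unit-≢ (j≢i ∘ ≡.sym))))
        (ℕ.≤-trans (lookup-⊕ (Vec.take m α) τ i) (ℕ.≤-reflexive (cong (λ z → lookup z i) (Vec.∷-injectiveʳ q))))

    eval-act : ∀ κ p (s x : Point m) → eval (L.act κ p) (pair s x) ≈ eval p (pair s (λ i → x i + κ i * s i))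
    eval-act κ p s x = trans (eval-substitute _ p (pair s x)) (eval-≋ p pointwise)
      where
      left : ∀ i → eval (L.s i) (pair s x) ≈ s i
      left i = trans (eval-var (i ↑ˡ m) (pair s x)) (reflexive (cong [ s , x ]′ (Fin.splitAt-↑ˡ m i m)))
      right : ∀ i → eval (L.t i) (pair s x) ≈ x i
      right i = trans (eval-var (m ↑ʳ i) (pair s x)) (reflexive (cong [ s , x ]′ (Fin.splitAt-↑ʳ m m i)))
      pointwise : ∀ i → eval (([ L.s , (λ i → L.t i ++ κ i • L.s i) ]′ ∘ splitAt m) i) (pair s x) ≈
                        pair s (λ i → x i + κ i * s i) i
      pointwise i with splitAt m i
      ... | inj₁ j = left j
      ... | inj₂ j = trans (eval-++ (L.t j) (κ j • L.s j) (pair s x))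
        (+-cong (right j) (trans (eval-• (κ j) (L.s j) (pair s x)) (*-congˡ (left j))))

    weight-φ : ∀ a i → weight φ a (unit i) ≡ lookup (L.H· a) i
    weight-φ a i = ≡.trans
      (cong Vec.sum (Vec.tabulate-cong λ j → cong (ℕ._* lookup a j) (nonzero-cong (trans (∙-comm (φ j) (unit i)) (sum-unit i (φ j))))))
      (≡.sym (Vec.lookup∘tabulate (λ i → weight form a (h i)) i))

    module _ (d : ℕ) (a : Vec ℕ n) where

      degreeBasis : List (Vec ℕ n)
      degreeBasis = basisOfDegree tree d a

      invariant-expansion : ∀ p → L.𝒵 (d , a) p → ∃ λ c →
        ∀ x → dehomogenise (component (d ∷ L.H· a) p) x ≈ combine φ degreeBasis c x
      invariant-expansion p (invariant , homogeneous) = c , λ x → extract x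
        where
        u = L.H· a
        p′ = component (d ∷ u) p
        f = dehomogenise p′
        p′≈p : ∀ z → eval p′ z ≈ eval p z
        p′≈p = eval-cong p′ p (component-≈ (d ∷ u) p homogeneous)
        p′-degree = component-degree (d ∷ u) p
        bounded : ∀ v → Direction v → v ∈ᴾ identity → Degree< identity v (suc (weight φ a v)) f
        bounded v (inj₁ (i , ≡.refl)) _ = subst (λ z → Degree< identity (unit i) (suc z) f) (≡.sym (weight-φ a i))
          (dehomogenise-degree p′-degree i)
        -- At s = 1 an element of G acts as translation by itself, so invariance is precisely degree
        -- 0 in its direction.
        bounded v (inj₂ v∈G) _ = degree-mono ∈identity (ℕ.s≤s ℕ.z≤n) (degree< λ x _ → x≈y⇒x-y≈0 (begin
          eval p′ (pair (λ _ → 1#) (x +[ 1# ] v))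
            ≈⟨ p′≈p _ ⟩
          eval p (pair (λ _ → 1#) (x +[ 1# ] v))
            ≈⟨ eval-≋ p (λ i → pair-cong (λ j → +-congˡ (*-comm 1# (v j))) i) ⟩
          eval p (pair (λ _ → 1#) (λ i → x i + v i * 1#))
            ≈⟨ eval-act v p (λ _ → 1#) x ⟨
          eval (L.act v p) (pair (λ _ → 1#) x)
            ≈⟨ eval-cong (L.act v p) p (invariant v (λ i → trans (combination-apply v h i) (v∈G i))) _ ⟩
          eval p (pair (λ _ → 1#) x)
            ≈⟨ p′≈p _ ⟨
          eval p′ (pair (λ _ → 1#) x) ∎))
          where
          pair-cong : ∀ {x y : Point m} → x ≋ y → pair (λ _ → 1#) x ≋ pair (λ _ → 1#) y
          pair-cong q i with splitAt m i
          ... | inj₁ _ = refl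
          ... | inj₂ j = q j
        spans = combine-spans Good good-constant {φ = φ} resolution restrict-good identity-good a
                  (dehomogenise-polynomial p′) bounded
        c = proj₁ spans

        -- Compare the coefficients of τ ^ d in f (τ x) = τ ^ d * f x.
        extract : ∀ x → f x ≈ combine φ degreeBasis c x
        extract x = sym (x-y≈0⇒x≈y (begin
          combine φ degreeBasis c x - f x
            ≈⟨ +-cong (coeff-terms (basis tree a)) coeff-last ⟨
          coeff (terms (basis tree a)) (d ∷ []) + coeff last (d ∷ [])
            ≈⟨ coeff-++ (terms (basis tree a)) last (d ∷ []) ⟨
          coeff (terms (basis tree a) ++ last) (d ∷ [])
            ≈⟨ coeff-zero (terms (basis tree a) ++ last) (λ τ _ → vanishing τ) (d ∷ []) ⟩
          0# ∎))
          where
          terms : List (Vec ℕ n) → Poly 1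
          terms = List.map (λ b → (c b * monomial φ b x , Vec.sum b ∷ []))
          last : Poly 1
          last = (- f x , d ∷ []) ∷ []
          coeff-last : coeff last (d ∷ []) ≈ - f x
          coeff-last = trans (+-identityʳ _) (term-≡ (- f x) (d ∷ []))
          coeff-terms : ∀ bs → coeff (terms bs) (d ∷ []) ≈ combine φ (List.filter (λ b → Vec.sum b ℕ.≟ d) bs) c x
          coeff-terms []       = refl
          coeff-terms (b ∷ bs) = cases (Vec.sum b ℕ.≟ d)
            where
            y = c b * monomial φ b x
            cases : Dec (Vec.sum b ≡ d) → coeff (terms (b ∷ bs)) (d ∷ []) ≈
                                          combine φ (List.filter (λ b → Vec.sum b ℕ.≟ d) (b ∷ bs)) c x
            cases (yes e) = trans
              (+-cong (trans (reflexive (cong (λ z → if does (≡-decℕ (z ∷ []) (d ∷ [])) then y else 0#) e)) (term-≡ y (d ∷ [])))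
                      (coeff-terms bs))
              (reflexive (cong (λ L → combine φ L c x) (≡.sym (List.filter-accept (λ b → Vec.sum b ℕ.≟ d) {b} {bs} e))))
            cases (no ne) = trans
              (+-cong (term-≢ y (Vec.sum b ∷ []) (d ∷ []) (ne ∘ Vec.∷-injectiveˡ)) (coeff-terms bs))
              (trans (+-identityˡ _)
                (reflexive (cong (λ L → combine φ L c x) (≡.sym (List.filter-reject (λ b → Vec.sum b ℕ.≟ d) {b} {bs} ne)))))
          monomial-scale : ∀ {k} (ψ : Fin k → Point m) b τ →
            monomial ψ b (λ i → τ * x i) ≈ τ ^ Vec.sum b * monomial ψ b x
          monomial-scale ψ []      τ = sym (*-identityˡ 1#)
          monomial-scale ψ (e ∷ b) τ = begin
            (ψ zero ∙ (λ i → τ * x i)) ^ e * monomial (ψ ∘ suc) b (λ i → τ * x i)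
              ≈⟨ *-cong (trans (^-cong e scale) (^-* τ (ψ zero ∙ x) e)) (monomial-scale (ψ ∘ suc) b τ) ⟩
            τ ^ e * (ψ zero ∙ x) ^ e * (τ ^ Vec.sum b * monomial (ψ ∘ suc) b x)
              ≈⟨ solve 4 (λ a b c d → a :* b :* (c :* d) := a :* c :* (b :* d)) refl
                   (τ ^ e) ((ψ zero ∙ x) ^ e) (τ ^ Vec.sum b) (monomial (ψ ∘ suc) b x) ⟩
            τ ^ e * τ ^ Vec.sum b * ((ψ zero ∙ x) ^ e * monomial (ψ ∘ suc) b x)
              ≈⟨ *-congʳ (^-+ τ e (Vec.sum b)) ⟨
            τ ^ (e ℕ.+ Vec.sum b) * ((ψ zero ∙ x) ^ e * monomial (ψ ∘ suc) b x) ∎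
            where
            scale : (ψ zero ∙ (λ i → τ * x i)) ≈ τ * (ψ zero ∙ x)
            scale = trans
              (sum-cong {m} {λ i → ψ zero i * (τ * x i)} {λ i → τ * (ψ zero i * x i)}
                (λ i → solve 3 (λ a b c → a :* (b :* c) := b :* (a :* c)) refl (ψ zero i) τ (x i)))
              (sum-*ˡ τ (λ i → ψ zero i * x i))
          eval-terms : ∀ bs (τ : Point 1) → eval (terms bs) τ ≈ combine φ bs c (λ i → τ zero * x i)
          eval-terms []       τ = refl
          eval-terms (b ∷ bs) τ = +-cong
            (trans (solve 3 (λ c y t → c :* y :* (t :* 𝟙) := c :* (t :* y)) refl (c b) (monomial φ b x) (τ zero ^ Vec.sum b))
                   (*-congˡ (sym (monomial-scale φ b (τ zero)))))
            (eval-terms bs τ)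
          vanishing : ∀ (τ : Point 1) → eval (terms (basis tree a) ++ last) τ ≈ 0#
          vanishing τ = begin
            eval (terms (basis tree a) ++ last) τ
              ≈⟨ eval-++ (terms (basis tree a)) last τ ⟩
            eval (terms (basis tree a)) τ + eval last τ
              ≈⟨ +-cong (trans (eval-terms (basis tree a) τ) (sym (proj₂ spans (λ i → τ zero * x i) ∈identity)))
                        (solve 2 (λ f t → (:- f) :* (t :* 𝟙) :+ 𝟘 := :- (t :* f)) refl (f x) (τ zero ^ d)) ⟩
            f (λ i → τ zero * x i) - τ zero ^ d * f x
              ≈⟨ x≈y⇒x-y≈0 (eval-scale p′-degree (τ zero) x) ⟩
            0# ∎

-- Bases of the graded components

module GradedComponents (K : CharacteristicZeroField) {r n m : ℕ} where
  open ZonotopalCoxRing K {r} {n} {m} public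

  module _ (A : Arrangement r n) (essential : Arrangement.Essential A) (L : Lines A m) where
    open Arrangement A using (form; IsRankFunction)
    open Lines L using (h)
    open Invariants A essential L
    private
      module L = Lines L

    Bounded : ℕ → (Fin m → ℕ) → Poly m → Set
    Bounded d u = All (λ (c , τ) → Vec.sum τ ≡ d × (∀ i → lookup τ i ℕ.≤ u i))

    private
      _*ᴾ_ : Poly m → Poly m → Poly m
      _*ᴾ_ = RawRing._*_ (polyRing m)

      1ᴾ : Poly m
      1ᴾ = RawRing.1# (polyRing m)

      _^ᴾ_ : Poly m → ℕ → Poly m
      _^ᴾ_ = PolyOps._^_ {m}

    bounded-* : ∀ {d d′ u u′ p q} → Bounded d u p → Bounded d′ u′ q → Bounded (d ℕ.+ d′) (λ i → u i ℕ.+ u′ i) (p *ᴾ q)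
    bounded-* {p = p} {q} P Q = All.cartesianProductWith⁺ (≡.setoid _) (≡.setoid _) _ p q
      λ {(c , σ)} {(c′ , τ)} σ∈ τ∈ →
        let s , b = All.lookup P σ∈ ; s′ , b′ = All.lookup Q τ∈ in
        ≡.trans (sum-⊕ σ τ) (cong₂ ℕ._+_ s s′)
      , λ i → ℕ.≤-trans (ℕ.≤-reflexive (Vec.lookup-zipWith ℕ._+_ i σ τ)) (ℕ.+-mono-≤ (b i) (b′ i))

    sum-0 : ∀ k → Vec.sum (Vec.replicate k 0) ≡ 0
    sum-0 zero    = ≡.refl
    sum-0 (suc k) = sum-0 k

    bounded-1 : Bounded 0 (λ _ → 0) 1ᴾ
    bounded-1 = (sum-0 m , λ i → ℕ.≤-reflexive (Vec.lookup-replicate i 0)) ∷ []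

    bounded-resp : ∀ {d d′ u u′ p} → d ≡ d′ → (∀ i → u i ≡ u′ i) → Bounded d u p → Bounded d′ u′ p
    bounded-resp ≡.refl q = All.map λ (s , b) → s , λ i → ℕ.≤-trans (b i) (ℕ.≤-reflexive (q i))

    bounded-^ : ∀ {u p} → Bounded 1 u p → ∀ e → Bounded e (λ i → u i ℕ.* e) (p ^ᴾ e)
    bounded-^ {u} P zero    = bounded-resp ≡.refl (λ i → ≡.sym (ℕ.*-zeroʳ (u i))) bounded-1
    bounded-^ {u} P (suc e) = bounded-resp ≡.refl (λ i → ≡.sym (ℕ.*-suc (u i) e)) (bounded-* P (bounded-^ P e))

    -- Terms with coefficient 0 are left out, so that t_i occurs only if h_i is not on the hyperplane.
    formTerms : Fin n → List (Fin m) → Poly m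
    formTerms j is = List.map (λ i → (φ j i , Vec.updateAt (Vec.replicate m 0) i suc))
                              (List.filter (λ i → ¬? (φ j i ≟ 0#)) is)

    formPoly : Fin n → Poly m
    formPoly j = formTerms j (List.allFin m)

    eval-formTerms : ∀ j is x → eval (formTerms j is) x ≈ Σᴸ is (λ i → φ j i * x i)
    eval-formTerms j []       x = refl
    eval-formTerms j (i ∷ is) x with φ j i ≟ 0#
    ... | yes z = trans (eval-formTerms j is x) (sym (trans (+-congʳ (trans (*-congʳ z) (zeroˡ _))) (+-identityˡ _)))
    ... | no _  = +-cong (*-congˡ (power-unit i x)) (eval-formTerms j is x)

    Σᴸ-tabulate : ∀ {B : Set} {k} (g : Fin k → B) f → Σᴸ (List.tabulate g) f ≈ sum (f ∘ g)
    Σᴸ-tabulate {k = zero}  g f = refl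
    Σᴸ-tabulate {k = suc k} g f = +-congˡ (Σᴸ-tabulate (g ∘ suc) f)

    eval-formPoly : ∀ j x → eval (formPoly j) x ≈ (φ j ∙ x)
    eval-formPoly j x = trans (eval-formTerms j (List.allFin m) x) (Σᴸ-tabulate (λ i → i) (λ i → φ j i * x i))

    bounded-formPoly : ∀ j → Bounded 1 (λ i → nonzero (φ j i)) (formPoly j)
    bounded-formPoly j = All.map⁺ (All.map (λ {i} ne → sum-exponent i , bound i ne)
                                           (All.all-filter (λ i → ¬? (φ j i ≟ 0#)) (List.allFin m)))
      where
      sum-exponent : ∀ {k} (i : Fin k) → Vec.sum (Vec.updateAt (Vec.replicate k 0) i suc) ≡ 1
      sum-exponent {suc k} zero    = cong suc (sum-0 k)
      sum-exponent {suc k} (suc i) = sum-exponent i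
      bound : ∀ i → ¬ φ j i ≈ 0# → ∀ i′ → lookup (Vec.updateAt (Vec.replicate m 0) i suc) i′ ℕ.≤ nonzero (φ j i′)
      bound i ne i′ with i Fin.≟ i′
      ... | yes ≡.refl = ℕ.≤-reflexive (≡.trans (Vec.lookup∘updateAt i (Vec.replicate m 0))
        (≡.trans (cong suc (Vec.lookup-replicate i 0)) (≡.sym (nonzero-1 ne))))
      ... | no i≢i′ = ℕ.≤-trans (ℕ.≤-reflexive (≡.trans (Vec.lookup∘updateAt′ i′ i (i≢i′ ∘ ≡.sym) (Vec.replicate m 0))
        (Vec.lookup-replicate i′ 0))) ℕ.z≤n

    productPoly : ∀ {k} → (Fin k → Poly m) → Vec ℕ k → Poly m
    productPoly f []      = 1ᴾ
    productPoly f (e ∷ b) = (f zero ^ᴾ e) *ᴾ productPoly (f ∘ suc) b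

    eval-productPoly : ∀ {k} (f : Fin k → Poly m) (ψ : Fin k → Point m) b x → (∀ j → eval (f j) x ≈ (ψ j ∙ x)) →
                       eval (productPoly f b) x ≈ monomial ψ b x
    eval-productPoly f ψ []      x p = eval-1 x
    eval-productPoly f ψ (e ∷ b) x p = trans (eval-* (f zero ^ᴾ e) (productPoly (f ∘ suc) b) x)
      (*-cong (trans (eval-^ (f zero) e x) (^-cong e (p zero))) (eval-productPoly (f ∘ suc) (ψ ∘ suc) b x (p ∘ suc)))

    bounded-productPoly : ∀ {k} (f : Fin k → Poly m) (w : Fin m → Fin k → ℕ) → (∀ j → Bounded 1 (λ i → w i j) (f j)) →
      ∀ b → Bounded (Vec.sum b) (λ i → Vec.sum (tabulate (λ j → w i j ℕ.* lookup b j))) (productPoly f b)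
    bounded-productPoly f w p []      = bounded-1
    bounded-productPoly f w p (e ∷ b) =
      bounded-* (bounded-^ (p zero) e) (bounded-productPoly (f ∘ suc) (λ i j → w i (suc j)) (p ∘ suc) b)

    -- Powers of the s-variables fill every term up to degree `u`; for polynomials that satisfy
    -- `Bounded` the subtraction is never cut off.
    homogenise : Vec ℕ m → Poly m → Poly (m ℕ.+ m)
    homogenise u = List.map (λ (c , τ) → (c , Vec.zipWith ℕ._∸_ u τ Vec.++ τ))

    private
      take-++ : ∀ {k l} (σ : Vec ℕ k) (τ : Vec ℕ l) → Vec.take k (σ Vec.++ τ) ≡ σ
      take-++ []      τ = ≡.refl
      take-++ (e ∷ σ) τ = cong (e ∷_) (take-++ σ τ)

      drop-++ : ∀ {k l} (σ : Vec ℕ k) (τ : Vec ℕ l) → Vec.drop k (σ Vec.++ τ) ≡ τ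
      drop-++ []      τ = ≡.refl
      drop-++ (e ∷ σ) τ = drop-++ σ τ

      ∸-⊕ : ∀ {k} (u τ : Vec ℕ k) → τ ≼ u → Vec.zipWith ℕ._∸_ u τ ⊕ τ ≡ u
      ∸-⊕ []      []      p = ≡.refl
      ∸-⊕ (d ∷ u) (e ∷ τ) p = cong₂ _∷_ (ℕ.m∸n+n≡m (p zero)) (∸-⊕ u τ (p ∘ suc))

    homogenise-degree : ∀ {d} u {p} → Bounded d (lookup u) p → AllDegree (d ∷ u) (homogenise u p)
    homogenise-degree u []                           = []
    homogenise-degree u {(c , τ) ∷ p} ((s , b) ∷ bs) = cong₂ _∷_
      (≡.trans (cong Vec.sum (drop-++ (Vec.zipWith ℕ._∸_ u τ) τ)) s)
      (≡.trans (cong₂ _⊕_ (take-++ (Vec.zipWith ℕ._∸_ u τ) τ) (drop-++ (Vec.zipWith ℕ._∸_ u τ) τ)) (∸-⊕ u τ b))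
      ∷ homogenise-degree u bs

    dehomogenise-homogenise : ∀ u p x → dehomogenise (homogenise u p) x ≈ eval p x
    dehomogenise-homogenise u []            x = refl
    dehomogenise-homogenise u ((c , τ) ∷ p) x = +-cong (*-congˡ (begin
      power (σ Vec.++ τ) (pair (λ _ → 1#) x)
        ≈⟨ power-pair (σ Vec.++ τ) (λ _ → 1#) x ⟩
      power (Vec.take m (σ Vec.++ τ)) (λ _ → 1#) * power (Vec.drop m (σ Vec.++ τ)) x
        ≈⟨ *-cong (power-1 (Vec.take m (σ Vec.++ τ))) (reflexive (cong (λ z → power z x) (drop-++ σ τ))) ⟩
      1# * power τ x   ≈⟨ *-identityˡ _ ⟩
      power τ x        ∎)) (dehomogenise-homogenise u p x)
      where σ = Vec.zipWith ℕ._∸_ u τ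

    monomial-translate : ∀ {k} (ψ : Fin k → Point m) b {x y} → (∀ j → (ψ j ∙ x) ≈ (ψ j ∙ y)) → monomial ψ b x ≈ monomial ψ b y
    monomial-translate ψ []      p = refl
    monomial-translate ψ (e ∷ b) p = *-cong (^-cong e (p zero)) (monomial-translate (ψ ∘ suc) b (p ∘ suc))

    Σᴸ-lookup : ∀ {B : Set} (xs : List B) f → sum (λ i → f (List.lookup xs i)) ≈ Σᴸ xs f
    Σᴸ-lookup []       f = refl
    Σᴸ-lookup (x ∷ xs) f = +-congˡ (Σᴸ-lookup xs f)

    module _ (d : ℕ) (a : Vec ℕ n) where
      private
        u  = L.H· a
        bs = degreeBasis d a

      element : Vec ℕ n → Poly (m ℕ.+ m)
      element b = homogenise u (productPoly formPoly b)

      dehomogenise-element : ∀ b x → dehomogenise (element b) x ≈ monomial φ b x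
      dehomogenise-element b x = trans (dehomogenise-homogenise u (productPoly formPoly b) x)
        (eval-productPoly formPoly φ b x (λ j → eval-formPoly j x))

      element-degree : ∀ {b} → b ≼ a → Vec.sum b ≡ d → AllDegree (d ∷ u) (element b)
      element-degree {b} b≼a s = homogenise-degree u (All.map
        (λ (s′ , p) → ≡.trans s′ s , λ i → ℕ.≤-trans (p i) (ℕ.≤-trans (weight-mono form a b (h i) b≼a)
          (ℕ.≤-reflexive (≡.sym (Vec.lookup∘tabulate (λ i → weight form a (h i)) i)))))
        (bounded-productPoly formPoly (λ i j → nonzero (φ j i)) bounded-formPoly b))

      pair-split : ∀ (z : Point (m ℕ.+ m)) → z ≋ pair (z ∘ (_↑ˡ m)) (z ∘ (m ↑ʳ_))
      pair-split z i with splitAt m i | Fin.join-splitAt m m i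
      ... | inj₁ _ | ≡.refl = refl
      ... | inj₂ _ | ≡.refl = refl

      -- Where no s_i vanishes, homogeneous polynomials can be rescaled to s = 1.
      equal-at-units : ∀ p q → (∀ {s y : Point m} → (∀ i → s i * y i ≈ 1#) → ∀ x → eval p (pair s x) ≈ eval q (pair s x)) →
                       ∀ α → coeff p α ≈ coeff q α
      equal-at-units p q e = eval-injective p q λ z z≉0 → begin
        eval p z                                      ≈⟨ eval-≋ p (pair-split z) ⟩
        eval p (pair (z ∘ (_↑ˡ m)) (z ∘ (m ↑ʳ_)))
          ≈⟨ e (λ i → proj₂ (invertible (z (i ↑ˡ m)) (z≉0 (i ↑ˡ m)))) (z ∘ (m ↑ʳ_)) ⟩
        eval q (pair (z ∘ (_↑ˡ m)) (z ∘ (m ↑ʳ_)))     ≈⟨ eval-≋ q (pair-split z) ⟨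
        eval q z                                      ∎

      -- Rescaled to s = 1 the action becomes translation by `κ`, and every pulled back form
      -- vanishes on `κ` because `Φ h` sends it to 0.
      element-invariant : ∀ {b} → AllDegree (d ∷ u) (element b) → L.Invariant (element b)
      element-invariant {b} deg κ κ∈G = equal-at-units (L.act κ B) B λ {s} {y} sy≈1 x → begin
        eval (L.act κ B) (pair s x)                             ≈⟨ eval-act κ B s x ⟩
        eval B (pair s (λ i → x i + κ i * s i))                 ≈⟨ eval-rescale deg sy≈1 (λ i → x i + κ i * s i) ⟩
        power u s * dehomogenise B (λ i → (x i + κ i * s i) * y i)
          ≈⟨ *-congˡ (translate (λ i → (x i + κ i * s i) * y i) (λ i → x i * y i) λ i → begin
               (x i + κ i * s i) * y i
                 ≈⟨ solve 4 (λ x k s y → (x :+ k :* s) :* y := x :* y :+ k :* (s :* y)) refl (x i) (κ i) (s i) (y i) ⟩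
               x i * y i + κ i * (s i * y i)
                 ≈⟨ +-congˡ (trans (*-congˡ (sy≈1 i)) (*-comm (κ i) 1#)) ⟩
               x i * y i + 1# * κ i ∎) ⟩
        power u s * dehomogenise B (λ i → x i * y i)            ≈⟨ eval-rescale deg sy≈1 x ⟨
        eval B (pair s x)                                       ∎
        where
        B = element b
        translate : ∀ x′ x → x′ ≋ x +[ 1# ] κ → dehomogenise B x′ ≈ dehomogenise B x
        translate x′ x p = trans (dehomogenise-element b x′) (trans
          (monomial-translate φ b λ j → begin
            φ j ∙ x′                                 ≈⟨ ∙-cong (λ _ → refl) p ⟩
            φ j ∙ (x +[ 1# ] κ)                      ≈⟨ ∙-+[] (φ j) x κ 1# ⟩
            (φ j ∙ x) + 1# * (φ j ∙ κ)               ≈⟨ +-congˡ (*-congˡ (begin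
              φ j ∙ κ                                  ≈⟨ pullback-∙ h (form j) κ ⟩
              form j ∙ Φ h κ                           ≈⟨ ∙-cong (λ _ → refl) (λ i → trans (sym (combination-apply κ h i)) (κ∈G i)) ⟩
              form j ∙ origin                          ≈⟨ ∙-origin (form j) ⟩
              0#                                       ∎)) ⟩
            (φ j ∙ x) + 1# * 0#                      ≈⟨ solve 1 (λ x → x :+ 𝟙 :* 𝟘 := x) refl (φ j ∙ x) ⟩
            φ j ∙ x                                  ∎)
          (sym (dehomogenise-element b x)))

      degreeBasis-∈ : All (λ b → b ∈ basis tree a × Vec.sum b ≡ d) bs
      degreeBasis-∈ = All.tabulate (∈-filter⁻ (λ b → Vec.sum b ℕ.≟ d))

      degreeBasis-degree : All (λ b → AllDegree (d ∷ u) (element b)) bs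
      degreeBasis-degree = All.map (λ {b} (b∈ , s) → element-degree {b} (All.lookup (basis-≼ tree a) b∈) s) degreeBasis-∈

      private
        β : Fin (List.length bs) → Vec ℕ n
        β = List.lookup bs

        E : Fin (List.length bs) → Poly (m ℕ.+ m)
        E = element ∘ β

        bs-unique : Unique bs
        bs-unique = Unique.filter⁺ (λ b → Vec.sum b ℕ.≟ d) (basis-unique tree a)

      dehomogenise-combination : ∀ (c : Fin (List.length bs) → Carrier) (c′ : Vec ℕ n → Carrier) → (∀ i → c′ (β i) ≈ c i) → ∀ x →
        combine φ bs c′ x ≈ sum (λ i → c i * dehomogenise (E i) x)
      dehomogenise-combination c c′ p x = trans (sym (Σᴸ-lookup bs (λ b → c′ b * monomial φ b x)))
        (sum-cong {List.length bs} {λ i → c′ (β i) * monomial φ (β i) x} {λ i → c i * dehomogenise (E i) x}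
          (λ i → *-cong (p i) (sym (dehomogenise-element (β i) x))))

      -- A relation in degree `d` is extended by 0 to the exponent vectors of other degrees, since
      -- `combine-independent` concerns the whole basis. Reading the coefficients off by exponent
      -- vector, as `at` does, needs a list without repetitions.
      element-independent : ∀ (c : Fin (List.length bs) → Carrier) →
        L.RLin.combination c E L.R.≈ᴹ L.R.0ᴹ → ∀ i → c i ≈ 0#
      element-independent c p i =
        let b∈ , s = All.lookup degreeBasis-∈ (∈-lookup i) in begin
          c i                  ≈⟨ at-lookup bs bs-unique c i ⟨
          c′ (β i)             ≈⟨ restricted-≡ s ⟨
          restricted (β i)     ≈⟨ All.lookup vanishing b∈ ⟩
          0#                   ∎
        where
        at : (L : List (Vec ℕ n)) → (Fin (List.length L) → Carrier) → Vec ℕ n → Carrier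
        at []      c b = 0#
        at (b′ ∷ L) c b = if does (≡-decℕ b′ b) then c zero else at L (c ∘ suc) b
        at-lookup : ∀ L → Unique L → ∀ c i → at L c (List.lookup L i) ≈ c i
        at-lookup (b ∷ L) (_ ∷ uniq) c zero rewrite dec-true (≡-decℕ b b) ≡.refl = refl
        at-lookup (b ∷ L) (ne ∷ uniq) c (suc i)
          rewrite dec-false (≡-decℕ b (List.lookup L i)) (All.lookup ne (∈-lookup i)) = at-lookup L uniq (c ∘ suc) i
        c′ : Vec ℕ n → Carrier
        c′ = at bs c
        restricted : Vec ℕ n → Carrier
        restricted b = if does (Vec.sum b ℕ.≟ d) then c′ b else 0#
        restricted-≡ : ∀ {b} → Vec.sum b ≡ d → restricted b ≈ c′ b
        restricted-≡ {b} s rewrite dec-true (Vec.sum b ℕ.≟ d) s = refl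
        restricted-≢ : ∀ {b} → Vec.sum b ≢ d → restricted b ≈ 0#
        restricted-≢ {b} s rewrite dec-false (Vec.sum b ℕ.≟ d) s = refl
        combine-restricted : ∀ L x → combine φ L restricted x ≈ combine φ (List.filter (λ b → Vec.sum b ℕ.≟ d) L) c′ x
        combine-restricted []      x = refl
        combine-restricted (b ∷ L) x = cases (Vec.sum b ℕ.≟ d)
          where
          cases : Dec (Vec.sum b ≡ d) →
                  combine φ (b ∷ L) restricted x ≈ combine φ (List.filter (λ b → Vec.sum b ℕ.≟ d) (b ∷ L)) c′ x
          cases (yes s) = trans (+-cong (*-congʳ (restricted-≡ s)) (combine-restricted L x))
            (reflexive (cong (λ L → combine φ L c′ x) (≡.sym (List.filter-accept (λ b → Vec.sum b ℕ.≟ d) {b} {L} s))))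
          cases (no ¬s) = trans (+-cong (trans (*-congʳ (restricted-≢ ¬s)) (zeroˡ _)) (combine-restricted L x))
            (trans (+-identityˡ _)
              (reflexive (cong (λ L → combine φ L c′ x) (≡.sym (List.filter-reject (λ b → Vec.sum b ℕ.≟ d) {b} {L} ¬s)))))
        vanishing : All (λ b → restricted b ≈ 0#) (basis tree a)
        vanishing = combine-independent resolution a restricted λ x _ → begin
          combine φ (basis tree a) restricted x        ≈⟨ combine-restricted (basis tree a) x ⟩
          combine φ bs c′ x                            ≈⟨ dehomogenise-combination c c′ (at-lookup bs bs-unique c) x ⟩
          sum (λ i → c i * dehomogenise (E i) x)       ≈⟨ eval-combination c E (pair (λ _ → 1#) x) ⟨
          dehomogenise (L.RLin.combination c E) x      ≈⟨ eval-zero (L.RLin.combination c E) p (pair (λ _ → 1#) x) ⟩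
          0#                                           ∎

      -- The expansion is known at s = 1; both sides have degree `u`, so rescaling multiplies them
      -- by the same power of s.
      element-spanning : ∀ p → L.𝒵 (d , a) p → L.RLin.Span E p
      element-spanning p p∈ = List.length bs , (λ i → i) , c ∘ β , equal-at-units p q λ {s} {y} sy≈1 x →
        let xy = λ i → x i * y i in begin
          eval p (pair s x)                   ≈⟨ eval-cong p′ p (component-≈ (d ∷ u) p (proj₂ p∈)) (pair s x) ⟨
          eval p′ (pair s x)                  ≈⟨ eval-rescale (component-degree (d ∷ u) p) sy≈1 x ⟩
          power u s * dehomogenise p′ xy
            ≈⟨ *-congˡ (trans (proj₂ expansion xy) (dehomogenise-combination (c ∘ β) c (λ i → refl {c (β i)}) xy)) ⟩
          power u s * sum (λ i → c (β i) * dehomogenise (E i) xy)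
            ≈⟨ sum-*ˡ (power u s) (λ i → c (β i) * dehomogenise (E i) xy) ⟨
          sum (λ i → power u s * (c (β i) * dehomogenise (E i) xy))
            ≈⟨ sum-cong {List.length bs} {λ i → power u s * (c (β i) * dehomogenise (E i) xy)}
                 {λ i → c (β i) * eval (E i) (pair s x)}
                 (λ i → trans (solve 3 (λ a b c → a :* (b :* c) := b :* (a :* c)) refl
                                 (power u s) (c (β i)) (dehomogenise (E i) xy))
                              (*-congˡ (sym (eval-rescale (All.lookup degreeBasis-degree (∈-lookup i)) sy≈1 x)))) ⟩
          sum (λ i → c (β i) * eval (E i) (pair s x))
            ≈⟨ eval-combination (c ∘ β) E (pair s x) ⟨
          eval q (pair s x)                   ∎
        where
        p′ = component (d ∷ u) p
        expansion = invariant-expansion d a p p∈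
        c = proj₁ expansion
        q = L.RLin.combination (c ∘ β) E

      component-dimension : L.RLin.HasDimension (L.𝒵 (d , a)) (basisCount tree d a)
      component-dimension = subst (L.RLin.HasDimension (L.𝒵 (d , a))) (length-basisOfDegree tree d a) record
        { basis       = E
        ; basis∈P     = λ i → let deg = All.lookup degreeBasis-degree (∈-lookup i) in
                          element-invariant {β i} deg , AllDegree⇒Homogeneous deg
        ; independent = element-independent
        ; spanning    = element-spanning
        }

    -- Some line lies off each hyperplane and contributes an entry 1 to its column.
    positive-columns : ∀ j → 0 ℕ.< Vec.sum (tabulate (λ i → L.H i j))
    positive-columns j = let i , ne = line-off-hyperplane A essential L j in
      ℕ.<-≤-trans (ℕ.≤-reflexive (≡.sym (nonzero-1 ne))) (entry≤sum (λ i → L.H i j) i)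
      where
      entry≤sum : ∀ {k} (f : Fin k → ℕ) i → f i ℕ.≤ Vec.sum (tabulate f)
      entry≤sum f zero    = ℕ.m≤m+n (f zero) _
      entry≤sum f (suc i) = ℕ.≤-trans (entry≤sum (f ∘ suc) i) (ℕ.m≤n+m _ (f zero))

-- The Hilbert series over a field of characteristic zero

module _ (K : CharacteristicZeroField) where
  open CharacteristicZeroField K using (rawRing; _≟_)
  open Arrangements rawRing _≟_

  hilbert-series : ∀ {r n m} (A : Arrangement r n) → Arrangement.Essential A → (L : Lines A m) →
    let open Arrangement A
        open Lines L
        open PowerSeries (suc m)
    in
    ∃ λ (Hilb : Series) → ∃ λ (rk : Subset n → ℕ) →
      IsHilbertSeries Hilb × IsRankFunction rk ×
      Hilb ≈ inverse (product (λ i → 1# - S i * tₛ))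
             * Z̃ rk (1# - tₛ) (λ j → S j * (1# - tₛ) * inverse (1# - S j))
  hilbert-series A essential L = TreeSeries.gf H (basisCount tree) , rank tree
    , ((λ (d , a) → basisCount tree d a) , (λ (d , a) → component-dimension A essential L d a)
      , HilbertSeries.gf-isSumOfMonomials H positive (basisCount tree))
    , rank-isRankFunction
    , TreeSeries.gf-tree tree H positive S (λ j → HilbertSeries.product-variables (λ i → does (i ∈H? j)))
    where
    open GradedComponents K using (module Invariants; component-dimension; positive-columns)
    open Invariants A essential L using (tree; rank-isRankFunction)
    open Lines L using (H; S; _∈H?_)
    positive = positive-columns A essential L

-- The complex numbers as a field of characteristic zero

module ComplexField (ℝ : CompleteOrderedField) where
  private
    module ℝ = CompleteOrderedField ℝ
  open CompleteOrderedField ℝ using (_<_; compare; isStrictTotalOrder; 0<1; +-monoˡ-<; *-positive; invertible)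
  open CommutativeRing ℝ.commutativeRing hiding (zero)
  open IntegerSolver ℝ.commutativeRing
  open import Relation.Binary.Structures using (IsStrictTotalOrder)
  open IsStrictTotalOrder isStrictTotalOrder using (<-respˡ-≈; <-respʳ-≈; irrefl) renaming (trans to <-trans)
  open ComplexNumbers ℝ using (ℂ; _≟ℂ_)
  private
    module ℂ = RawRing ℂ
  open import Relation.Binary.Definitions using (tri<; tri≈; tri>)

  +-positive : ∀ {x y} → 0# < x → 0# < y → 0# < x + y
  +-positive {x} {y} p q = <-trans q (<-respˡ-≈ (+-identityˡ y) (+-monoˡ-< y p))

  square-positive : ∀ x → ¬ x ≈ 0# → 0# < x * x
  square-positive x x≉0 with compare x 0#
  ... | tri> _ _ 0<x = *-positive 0<x 0<x
  ... | tri≈ _ p _   = ⊥-elim (x≉0 p)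
  ... | tri< x<0 _ _ = <-respʳ-≈ (solve 1 (λ x → :- x :* :- x := x :* x) refl x) (*-positive 0<-x 0<-x)
    where
    0<-x : 0# < - x
    0<-x = <-respˡ-≈ (-‿inverseʳ x) (<-respʳ-≈ (+-identityˡ (- x)) (+-monoˡ-< (- x) x<0))

  norm-positive : ∀ a b → ¬ (a ≈ 0# × b ≈ 0#) → 0# < a * a + b * b
  norm-positive a b p with a ℝ.≟ 0# | b ℝ.≟ 0#
  ... | yes q | yes q′ = ⊥-elim (p (q , q′))
  ... | no q  | no q′  = +-positive (square-positive a q) (square-positive b q′)
  ... | no q  | yes q′ = <-respʳ-≈ (sym (trans (+-congˡ (trans (*-congˡ q′) (zeroʳ b))) (+-identityʳ _))) (square-positive a q)
  ... | yes q | no q′  = <-respʳ-≈ (sym (trans (+-congʳ (trans (*-congˡ q) (zeroʳ a))) (+-identityˡ _))) (square-positive b q′)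

  positive⇒≉0 : ∀ {x} → 0# < x → ¬ x ≈ 0#
  positive⇒≉0 p q = irrefl (sym q) p

  ℂ-commutativeRing : CommutativeRing 0ℓ 0ℓ
  ℂ-commutativeRing = record
    { Carrier = ℂ.Carrier ; _≈_ = ℂ._≈_ ; _+_ = ℂ._+_ ; _*_ = ℂ._*_ ; -_ = ℂ.-_ ; 0# = ℂ.0# ; 1# = ℂ.1#
    ; isCommutativeRing = record
      { isRing = record
        { +-isAbelianGroup = record
          { isGroup = record
            { isMonoid = record
              { isSemigroup = record
                { isMagma = record
                  { isEquivalence = record
                    { refl  = refl , refl
                    ; sym   = λ (p , q) → sym p , sym q
                    ; trans = λ (p , q) (p′ , q′) → trans p p′ , trans q q′ }
                  ; ∙-cong = λ (p , q) (p′ , q′) → +-cong p p′ , +-cong q q′ }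
                ; assoc = λ _ _ _ → +-assoc _ _ _ , +-assoc _ _ _ }
              ; identity = (λ _ → +-identityˡ _ , +-identityˡ _) , (λ _ → +-identityʳ _ , +-identityʳ _) }
            ; inverse = (λ _ → -‿inverseˡ _ , -‿inverseˡ _) , (λ _ → -‿inverseʳ _ , -‿inverseʳ _)
            ; ⁻¹-cong = λ (p , q) → -‿cong p , -‿cong q }
          ; comm = λ _ _ → +-comm _ _ , +-comm _ _ }
        ; *-cong = λ (p , q) (p′ , q′) → +-cong (*-cong p p′) (-‿cong (*-cong q q′)) , +-cong (*-cong p q′) (*-cong q p′)
        ; *-assoc = λ (a , b) (c , d) (e , f) →
            solve 6 (λ a b c d e f → (a :* c :- b :* d) :* e :- (a :* d :+ b :* c) :* f :=
                                     a :* (c :* e :- d :* f) :- b :* (c :* f :+ d :* e)) refl a b c d e f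
          , solve 6 (λ a b c d e f → (a :* c :- b :* d) :* f :+ (a :* d :+ b :* c) :* e :=
                                     a :* (c :* f :+ d :* e) :+ b :* (c :* e :- d :* f)) refl a b c d e f
        ; *-identity = (λ (a , b) → solve 2 (λ a b → 𝟙 :* a :- 𝟘 :* b := a) refl a b
                                  , solve 2 (λ a b → 𝟙 :* b :+ 𝟘 :* a := b) refl a b)
                     , (λ (a , b) → solve 2 (λ a b → a :* 𝟙 :- b :* 𝟘 := a) refl a b
                                  , solve 2 (λ a b → a :* 𝟘 :+ b :* 𝟙 := b) refl a b)
        ; distrib = (λ (a , b) (c , d) (e , f) →
            solve 6 (λ a b c d e f → a :* (c :+ e) :- b :* (d :+ f) := (a :* c :- b :* d) :+ (a :* e :- b :* f)) refl a b c d e f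
          , solve 6 (λ a b c d e f → a :* (d :+ f) :+ b :* (c :+ e) := (a :* d :+ b :* c) :+ (a :* f :+ b :* e)) refl a b c d e f)
                  , (λ (a , b) (c , d) (e , f) →
            solve 6 (λ a b c d e f → (c :+ e) :* a :- (d :+ f) :* b := (c :* a :- d :* b) :+ (e :* a :- f :* b)) refl a b c d e f
          , solve 6 (λ a b c d e f → (c :+ e) :* b :+ (d :+ f) :* a := (c :* b :+ d :* a) :+ (e :* b :+ f :* a)) refl a b c d e f)
        }
      ; *-comm = λ (a , b) (c , d) → solve 4 (λ a b c d → a :* c :- b :* d := c :* a :- d :* b) refl a b c d
                                   , solve 4 (λ a b c d → a :* d :+ b :* c := c :* b :+ d :* a) refl a b c d
      }
    }

  private
    module Multℝ = Algebra.Properties.Semiring.Mult semiring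
    module Multℂ = Algebra.Properties.Semiring.Mult (CommutativeRing.semiring ℂ-commutativeRing)

  real-part : ∀ n → proj₁ (n Multℂ.× ℂ.1#) ≡ n Multℝ.× 1#
  real-part zero    = ≡.refl
  real-part (suc n) = cong (λ z → 1# + z) (real-part n)

  suc×1-positive : ∀ n → 0# < suc n Multℝ.× 1#
  suc×1-positive zero    = <-respʳ-≈ (sym (+-identityʳ 1#)) 0<1
  suc×1-positive (suc n) = +-positive 0<1 (suc×1-positive n)

  ℂ-field : CharacteristicZeroField
  ℂ-field = record
    { commutativeRing = ℂ-commutativeRing
    ; _≟_             = _≟ℂ_
    ; invertible      = λ (a , b) p → inverse a b (invertible (a * a + b * b) (positive⇒≉0 (norm-positive a b p)))
    ; suc×1≉0         = λ n (p , _) → positive⇒≉0 (suc×1-positive n) (trans (reflexive (≡.sym (real-part (suc n)))) p)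
    }
    where
    inverse : ∀ a b → (∃ λ y → (a * a + b * b) * y ≈ 1#) → ∃ λ z → (a , b) ℂ.* z ℂ.≈ ℂ.1#
    -- The complex conjugate divided by the squared absolute value, whose inverse is `y`.
    inverse a b (y , q) = (a * y , - b * y)
      , trans (solve 3 (λ a b y → a :* (a :* y) :- b :* (:- b :* y) := (a :* a :+ b :* b) :* y) refl a b y) q
      , solve 3 (λ a b y → a :* (:- b :* y) :+ b :* (a :* y) := 𝟘) refl a b y

theorem6p8 : (ℝ : CompleteOrderedField) →
    let open ComplexNumbers ℝ
        open Arrangements ℂ _≟ℂ_
    in
    ∀ (r n m : ℕ) (A : Arrangement r n) → Arrangement.Essential A →
    (L : Lines A m) →
    let open Arrangement A
        open Lines L
        open PowerSeries (suc m)
    in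
    ∃ λ (Hilb : Series) → ∃ λ (rk : Subset n → ℕ) →
      IsHilbertSeries Hilb × IsRankFunction rk ×
      Hilb ≈ inverse (product (λ i → 1# - S i * tₛ))
             * Z̃ rk (1# - tₛ) (λ j → S j * (1# - tₛ) * inverse (1# - S j))
theorem6p8 ℝ r n m A essential L = hilbert-series (ComplexField.ℂ-field ℝ) A essential L
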